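{- Among all $k$-uniform linear unicyclic hypergraphs with $m\ge3$ hyperedges, the second last hypergraph in $S_\alpha$-order is $C^{(k)}_{3;m-4,1,0}$ for $k\ge2$ and $0<\alpha<1$.
   Context: Hypergraphs are finite; $k$-uniform means every hyperedge has exactly $k$ vertices; linear means any two distinct hyperedges share at most one vertex; unicyclic means connected with exactly one cycle. A cored vertex is a vertex of degree one. "Adding a pendant hyperedge to a vertex $v$" means adding a new hyperedge consisting of $v$ and $k-1$ new vertices. The hypercycle $C_g^{(k)}$ is obtained from the cycle graph $C_g$ by inserting $k-2$ new (cored) vertices into each edge. $C^{(k)}_{3;n_1,n_2,n_3}$ is the $k$-uniform linear unicyclic hypergraph obtained from $C_3^{(k)}$ by adding $n_1,n_2,n_3$ pendant hyperedges to the three non-cored (degree-two) vertices of $C_3^{(k)}$, respectively. For a $k$-uniform hypergraph $\mathcal{H}$ on $[n]$, $\mathcal{A}(\mathcal{H})$ is the $k$-order $n$-dimensional tensor with entry $\frac1{(k-1)!}$ at $(i_1,\dots,i_k)$ if $\{i_1,\dots,i_k\}\in E(\mathcal{H})$ and $0$ otherwise; $\mathcal{D}(\mathcal{H})$ is the diagonal tensor of vertex degrees; $\mathcal{A}_\alpha(\mathcal{H})=\alpha\mathcal{D}(\mathcal{H})+(1-\alpha)\mathcal{A}(\mathcal{H})$. For a tensor $\mathcal{T}$, $\mathrm{Tr}_d(\mathcal{T})$ is the sum of the $d$-th powers of all $n(k-1)^{n-1}$ eigenvalues of $\mathcal{T}$; in particular $\mathrm{Tr}_0(\mathcal{T})=n(k-1)^{n-1}$,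 and for $d\ge1$ $$\mathrm{Tr}_{d}(\mathcal{T})=(k-1)^{n-1}\sum_{d_1+\cdots+d_n=d}\ \prod_{i=1}^{n}\frac{1}{(d_i(k-1))!}\Big(\sum_{\gamma\in[n]^{k-1}}(\mathcal{T})_{i\gamma}\frac{\partial}{\partial a_{i\gamma}}\Big)^{d_i}\mathrm{tr}\big(A^{d(k-1)}\big),$$ with $A=(a_{ij})$ an $n\times n$ matrix of indeterminates, $d_i\ge0$ integers, $\frac{\partial}{\partial a_{i\gamma}}=\frac{\partial}{\partial a_{i i_2}}\cdots\frac{\partial}{\partial a_{i i_k}}$ for $\gamma=i_2\cdots i_k$. $S_\alpha$-order: for $k$-uniform hypergraphs $\mathcal{H}_1,\mathcal{H}_2$ with $n$ vertices, $\mathcal{H}_1\prec_\alpha\mathcal{H}_2$ ($\mathcal{H}_1$ comes before $\mathcal{H}_2$) if there is $d\in\{1,\dots,n(k-1)^{n-1}-1\}$ with $\mathrm{Tr}_t(\mathcal{A}_\alpha(\mathcal{H}_1))=\mathrm{Tr}_t(\mathcal{A}_\alpha(\mathcal{H}_2))$ for $t=0,\dots,d-1$ and $\mathrm{Tr}_d(\mathcal{A}_\alpha(\mathcal{H}_1))<\mathrm{Tr}_d(\mathcal{A}_\alpha(\mathcal{H}_2))$. The last hypergraph $L$ in a class is the member with $\mathcal{H}\prec_\alpha L$ for every other member $\mathcal{H}$ of the class (up to isomorphism); the second last is the last among the members other than $L$.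
   Formalization: Proved for m ≥ 5 instead of m ≥ 3: for m = 3 the parameter m−4 is negative, and for m = 4 the hypergraph C_{3;0,1,0} is isomorphic to C_{3;1,0,0}, which is the last hypergraph, so the claim fails there. -}

module Defs where

open import Level using (_⊔_; 0ℓ) renaming (suc to lsuc)
open import Algebra.Apartness.Bundles using (HeytingField)
open import Algebra.Bundles using (CommutativeRing)
import Algebra.Definitions as AlgDefs
import Algebra.Properties.Monoid.Mult as Mult
import Algebra.Properties.Ring as RingProperties
open import Data.Bool using () renaming (_≟_ to _≟ᵇ_)
open import Data.Fin using (Fin; zero; suc; toℕ; _↑ˡ_; _≟_)
open import Data.Fin.Properties using (any?)
open import Data.Fin.Patterns using (0F; 1F; 2F)
open import Data.Fin.Subset using (Subset; _∈_; _∪_; _∩_; ⁅_⁆; ∣_∣; ⊤; ⊥)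
open import Data.Fin.Subset.Properties using (_∈?_)
open import Data.List as List
  using (List; []; _∷_; concatMap; cartesianProductWith; allFin; upTo; length; filter)
open import Data.Nat as ℕ using (ℕ; zero; suc; _≤_; _∸_; _!)
open import Data.Nat.DivMod using (_mod_)
open import Data.Nat.GeneralisedArithmetic using (fold)
open import Data.Nat.Properties using (_!≢0)
open import Data.Product using (_×_; _,_; proj₁; proj₂; ∃; Σ-syntax; ∃-syntax)
open import Data.Product.Properties using () renaming (≡-dec to ×-≡-dec)
open import Data.Sum using (_⊎_; inj₁; inj₂)
open import Data.Vec as Vec using (Vec; []; _∷_)
open import Data.Vec.Properties using () renaming (≡-dec to Vec-≡-dec)
import Data.Vec.Relation.Unary.All as VecAll
open import Function.Bundles using (_↔_; _⇔_; Inverse)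
open import Function.Definitions using (Injective)
open import Relation.Binary using (Rel; IsStrictPartialOrder)
open import Relation.Binary.Construct.Closure.ReflexiveTransitive using (Star)
open import Relation.Binary.PropositionalEquality using (_≡_; _≢_)
open import Relation.Nullary using (¬_; yes; no)

-- The library has no type of real numbers, so scalars are taken in an
-- arbitrary ordered field.  Classically this record is the usual
-- notion: apartness is inequality, and `#⇒<>` is totality of the order.
-- Decidability of the order is not required, so that constructive real
-- numbers are an instance as well.

record OrderedField c ℓ₁ ℓ₂ : Set (lsuc (c ⊔ ℓ₁ ⊔ ℓ₂)) where
  infix 4 _<_
  field
    heytingField : HeytingField c ℓ₁ ℓ₂
  open HeytingField heytingField public
  field
    _<_                  : Rel Carrier ℓ₂
    isStrictPartialOrder : IsStrictPartialOrder _≈_ _<_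
    <⇒#                  : ∀ {x y} → x < y → x # y
    #⇒<>                 : ∀ {x y} → x # y → x < y ⊎ y < x
    +-monoˡ-<            : ∀ z {x y} → x < y → x + z < y + z
    *-positive           : ∀ {x y} → 0# < x → 0# < y → 0# < x * y

  commutativeRing : CommutativeRing c ℓ₁
  commutativeRing = record { isCommutativeRing = isCommutativeRing }

  open CommutativeRing commutativeRing public using (ring; +-monoid)
  open Mult +-monoid public using () renaming (_×_ to _·_)
  open AlgDefs _≈_ public using (Invertible)
  private
    module < = IsStrictPartialOrder isStrictPartialOrder
    open RingProperties ring using (-0#≈0#; -‿distribˡ-*; -‿involutive)

  x-0#≈x : ∀ x → x - 0# ≈ x
  x-0#≈x x = trans (+-congˡ -0#≈0#) (+-identityʳ x)

  positive⇒invertible : ∀ {x} → 0# < x → Invertible 1# _*_ x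
  positive⇒invertible {x} 0<x with #⇒invertible (#-sym (<⇒# 0<x))
  ... | y , yx≈1 , xy≈1 = y , trans (*-congˡ (sym (x-0#≈x x))) yx≈1
                            , trans (*-congʳ (sym (x-0#≈x x))) xy≈1

  0#<1# : 0# < 1#
  0#<1# with #⇒<> (invertible⇒# (1# , 1*[1-0]≈1 , [1-0]*1≈1))
    where
    [1-0]*1≈1 : (1# - 0#) * 1# ≈ 1#
    [1-0]*1≈1 = trans (*-identityʳ _) (x-0#≈x 1#)
    1*[1-0]≈1 : 1# * (1# - 0#) ≈ 1#
    1*[1-0]≈1 = trans (*-identityˡ _) (x-0#≈x 1#)
  ... | inj₂ 0<1 = 0<1
  ... | inj₁ 1<0 = <.<-respʳ-≈ [-1]²≈1 (*-positive 0<-1 0<-1)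
    where
    0<-1 : 0# < - 1#
    0<-1 = <.<-respʳ-≈ (+-identityˡ _) (<.<-respˡ-≈ (-‿inverseʳ 1#) (+-monoˡ-< (- 1#) 1<0))
    [-1]²≈1 : (- 1#) * (- 1#) ≈ 1#
    [-1]²≈1 = trans (sym (-‿distribˡ-* 1# (- 1#)))
                    (trans (-‿cong (*-identityˡ (- 1#))) (-‿involutive 1#))

  0#<suc : ∀ n → 0# < suc n · 1#
  0#<suc zero    = <.<-respʳ-≈ (sym (+-identityʳ 1#)) 0#<1#
  0#<suc (suc n) = <.trans (0#<suc n)
    (<.<-respˡ-≈ (+-identityˡ _) (+-monoˡ-< (suc n · 1#) 0#<1#))

  reciprocal : (n : ℕ) .{{_ : ℕ.NonZero n}} → Carrier
  reciprocal (suc n) = proj₁ (positive⇒invertible (0#<suc n))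

  reciprocal-inverse : ∀ n .{{_ : ℕ.NonZero n}} → (n · 1#) * reciprocal n ≈ 1#
  reciprocal-inverse (suc n) = proj₂ (proj₂ (positive⇒invertible (0#<suc n)))

  1/_! : ℕ → Carrier
  1/ n ! = reciprocal (n !) {{n !≢0}}

-- The hyperedges are an indexed family of vertex sets.  The family is not
-- required to be injective: for a k-uniform hypergraph with k ≥ 2 this
-- follows from `Linear` below, as equal hyperedges would share k vertices.

record Hypergraph : Set where
  field
    order : ℕ
    size  : ℕ
    edge  : Fin size → Subset order

  Vertex = Fin order
  Edge   = Fin size

open Hypergraph public

degree : (H : Hypergraph) → Vertex H → ℕ
degree H v = length (filter (λ e → v ∈? edge H e) (allFin (size H)))

Uniform : ℕ → Hypergraph → Set
Uniform k H = ∀ e → ∣ edge H e ∣ ≡ k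

Linear : Hypergraph → Set
Linear H = ∀ e f → e ≢ f → ∣ edge H e ∩ edge H f ∣ ≤ 1

Adjacent : (H : Hypergraph) → Rel (Vertex H) 0ℓ
Adjacent H u v = ∃[ e ] u ∈ edge H e × v ∈ edge H e

Connected : Hypergraph → Set
Connected H = ∀ u v → Star (Adjacent H) u v

-- i ↦ i + 1 modulo g
next : ∀ {g} → Fin g → Fin g
next {suc g} i = suc (toℕ i) mod suc g

-- A cycle v₀ e₀ v₁ e₁ … v_{ℓ-1} e_{ℓ-1} v₀ with distinct vertices and
-- distinct hyperedges.
record Cycle (H : Hypergraph) : Set where
  field
    len              : ℕ
    len≥2            : 2 ≤ len
    vertex           : Fin len → Vertex H
    hyperedge        : Fin len → Edge H
    vertex-injective : Injective _≡_ _≡_ vertex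
    edge-injective   : Injective _≡_ _≡_ hyperedge
    incidentˡ        : ∀ i → vertex i ∈ edge H (hyperedge i)
    incidentʳ        : ∀ i → vertex (next i) ∈ edge H (hyperedge i)

  Traverses : Vertex H → Edge H → Set
  Traverses v e = ∃[ i ] e ≡ hyperedge i × (v ≡ vertex i ⊎ v ≡ vertex (next i))

-- Two sequences describe the same cycle when they use the same incidences,
-- i.e. when they agree up to starting point and direction.
SameCycle : ∀ {H} → Rel (Cycle H) 0ℓ
SameCycle C D = ∀ v e → Cycle.Traverses C v e ⇔ Cycle.Traverses D v e

Unicyclic : Hypergraph → Set
Unicyclic H = Connected H × (Σ[ C ∈ Cycle H ] (∀ D → SameCycle C D))

record LinearUnicyclic (k m : ℕ) (H : Hypergraph) : Set where
  field
    uniform   : Uniform k H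
    linear    : Linear H
    unicyclic : Unicyclic H
    size≡m    : size H ≡ m

infix 4 _≅_

record _≅_ (G H : Hypergraph) : Set where
  field
    vertices : Vertex G ↔ Vertex H
    edges    : Edge G ↔ Edge H
    incident : ∀ v e →
      v ∈ edge G e ⇔ Inverse.to vertices v ∈ edge H (Inverse.to edges e)

-- Vertices 0 … g-1 are those of the cycle graph; they are followed by g
-- blocks of k-2 cored vertices, the i-th block being inserted into {i, i+1}.
hypercycle : (k g : ℕ) → Hypergraph
hypercycle k g = record
  { order = g ℕ.+ g ℕ.* (k ∸ 2)
  ; size  = g
  ; edge  = λ i → (⁅ i ⁆ ∪ ⁅ next i ⁆)
                  Vec.++ Vec.concat (Vec.replicate g ⊥ Vec.[ i ]≔ ⊤)
  }

-- The k-1 new vertices come after the old ones; hyperedge 0 is the new one.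
addPendant : ℕ → (H : Hypergraph) → Vertex H → Hypergraph
addPendant k H v = record
  { order = order H ℕ.+ (k ∸ 1)
  ; size  = suc (size H)
  ; edge  = λ { zero    → ⁅ v ⁆ Vec.++ ⊤
              ; (suc e) → edge H e Vec.++ ⊥ }
  }

addPendants : ∀ {t} → ℕ → (H : Hypergraph) → Vec (Vertex H) t → Hypergraph
addPendants k H []       = H
addPendants k H (v ∷ vs) = addPendants k (addPendant k H v) (Vec.map (_↑ˡ (k ∸ 1)) vs)

-- n₁, n₂, n₃ pendant hyperedges at the three non-cored vertices of the
-- hypercycle.  C₃ k (m ∸ 4) 1 0 has m hyperedges only for m ≥ 4, and for
-- m = 4 it is isomorphic to C₃ k 1 0 0.
C₃ : (k n₁ n₂ n₃ : ℕ) → Hypergraph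
C₃ k n₁ n₂ n₃ = addPendants k (hypercycle k 3)
  (Vec.replicate n₁ (corner 0F) Vec.++ Vec.replicate n₂ (corner 1F)
    Vec.++ Vec.replicate n₃ (corner 2F))
  where
  corner : Fin 3 → Vertex (hypercycle k 3)
  corner i = i ↑ˡ (3 ℕ.* (k ∸ 2))

words : ∀ n p → List (Vec (Fin n) p)
words n zero    = [] ∷ []
words n (suc p) = cartesianProductWith _∷_ (allFin n) (words n p)

-- All (d₁ , … , dₙ) with d₁ + ⋯ + dₙ = d.
compositions : ∀ n → ℕ → List (Vec ℕ n)
compositions zero    zero    = [] ∷ []
compositions zero    (suc d) = []
compositions (suc n) d       =
  concatMap (λ j → List.map (j ∷_) (compositions n (d ∸ j))) (upTo (suc d))

module _ {c ℓ₁ ℓ₂} (F : OrderedField c ℓ₁ ℓ₂) where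
  open OrderedField F

  ∑ : List Carrier → Carrier
  ∑ = List.foldr _+_ 0#

  -- A tensor of order k ≥ 1; the first index is split off, as in T_{iγ}.
  Tensor : ℕ → ℕ → Set c
  Tensor k n = Fin n → Vec (Fin n) (k ∸ 1) → Carrier

  module _ (k : ℕ) (H : Hypergraph) where

    private
      n = order H

    ⟦_⟧ : ∀ {p} → Vec (Fin n) p → Subset n
    ⟦ [] ⟧    = ⊥
    ⟦ i ∷ γ ⟧ = ⁅ i ⁆ ∪ ⟦ γ ⟧

    adjacencyTensor : Tensor k n
    adjacencyTensor i γ with any? (λ e → Vec-≡-dec _≟ᵇ_ (edge H e) ⟦ i ∷ γ ⟧)
    ... | yes _ = 1/ (k ∸ 1) !
    ... | no  _ = 0#

    degreeTensor : Tensor k n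
    degreeTensor i γ with VecAll.all? (i ≟_) γ
    ... | yes _ = degree H i · 1#
    ... | no  _ = 0#

    Aα-tensor : Carrier → Tensor k n
    Aα-tensor α i γ = α * degreeTensor i γ + (1# - α) * adjacencyTensor i γ

  -- Polynomials in the entries of an n × n matrix of indeterminates, as
  -- formal sums of terms c · x₁ ⋯ xᵣ.  Neither the order of the variables in
  -- a term nor that of the terms matters for `constantTerm`.
  module Indeterminates (n : ℕ) where

    Var : Set
    Var = Fin n × Fin n

    Poly : Set c
    Poly = List (Carrier × List Var)

    Matrix : Set c
    Matrix = Fin n → Fin n → Poly

    _∙_ : Carrier → Poly → Poly
    a ∙ p = List.map (λ (b , w) → a * b , w) p

    _⊛_ : Poly → Poly → Poly
    _⊛_ = cartesianProductWith (λ (a , u) (b , v) → a * b , u List.++ v)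

    -- Leibniz rule: one summand for each occurrence of x.
    remove : Var → List Var → List (List Var)
    remove x []      = []
    remove x (y ∷ w) with ×-≡-dec _≟_ _≟_ x y
    ... | yes _ = w ∷ List.map (y ∷_) (remove x w)
    ... | no  _ = List.map (y ∷_) (remove x w)

    ∂ : Var → Poly → Poly
    ∂ x = concatMap (λ (a , w) → List.map (a ,_) (remove x w))

    constantTerm : Poly → Carrier
    constantTerm []                = 0#
    constantTerm ((a , [])    ∷ p) = a + constantTerm p
    constantTerm ((a , _ ∷ _) ∷ p) = constantTerm p

    A : Matrix
    A i j = (1# , (i , j) ∷ []) ∷ []

    A^_ : ℕ → Matrix
    (A^ zero) i j with i ≟ j
    ... | yes _ = (1# , []) ∷ []
    ... | no  _ = []
    (A^ suc N) i j = concatMap (λ l → A i l ⊛ (A^ N) l j) (allFin n)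

    tr : Matrix → Poly
    tr M = concatMap (λ i → M i i) (allFin n)

    -- ∂/∂a_{iγ}
    ∂[_,_] : ∀ {p} → Fin n → Vec (Fin n) p → Poly → Poly
    ∂[ i , []    ] q = q
    ∂[ i , j ∷ γ ] q = ∂ (i , j) (∂[ i , γ ] q)

    -- ∑_γ T_{iγ} ∂/∂a_{iγ}
    𝒟 : ∀ {k} → Tensor k n → Fin n → Poly → Poly
    𝒟 {k} T i q = concatMap (λ γ → T i γ ∙ ∂[ i , γ ] q) (words n (k ∸ 1))

  -- Tr d T is the sum of the d-th powers of the eigenvalues of T, expressed
  -- through the entries of T by the Morozov–Shakirov formula.  The
  -- differential operator applied for (d₁ , … , dₙ) has order d(k-1), the
  -- degree of tr (A^{d(k-1)}), so the result is a constant.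
  Tr : ∀ {k n} → ℕ → Tensor k n → Carrier
  Tr {k} {n} zero      T = (n ℕ.* (k ∸ 1) ℕ.^ (n ∸ 1)) · 1#
  Tr {k} {n} d@(suc _) T =
    ((k ∸ 1) ℕ.^ (n ∸ 1)) · ∑ (List.map term (compositions n d))
    where
    open Indeterminates n

    term : Vec ℕ n → Carrier
    term ds = constantTerm (List.foldr apply (tr (A^ (d ℕ.* (k ∸ 1)))) (allFin n))
      where
      apply : Fin n → Poly → Poly
      apply i q = let dᵢ = Vec.lookup ds i in
        (1/ (dᵢ ℕ.* (k ∸ 1)) !) ∙ fold q (𝒟 {k} T i) dᵢ

  -- H₁ comes before H₂ in the S_α-order of k-uniform hypergraphs.
  Precedes : ℕ → Carrier → Hypergraph → Hypergraph → Set (ℓ₁ ⊔ ℓ₂)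
  Precedes k α H₁ H₂ =
    order H₁ ≡ order H₂ ×
    (∃[ d ] 1 ≤ d × d ≤ order H₁ ℕ.* (k ∸ 1) ℕ.^ (order H₁ ∸ 1) ∸ 1
          × (∀ t → t ℕ.< d → moment H₁ t ≈ moment H₂ t)
          × moment H₁ d < moment H₂ d)
    where
    moment : Hypergraph → ℕ → Carrier
    moment H t = Tr {k} t (Aα-tensor k H α)

module _ {ℓ} (_≺_ : Rel Hypergraph ℓ) where

  IsLast : (Hypergraph → Set) → Hypergraph → Set ℓ
  IsLast 𝒞 L = 𝒞 L × (∀ H → 𝒞 H → ¬ (H ≅ L) → H ≺ L)

  IsSecondLast : (Hypergraph → Set) → Hypergraph → Set ℓ
  IsSecondLast 𝒞 S =
    ∃[ L ] IsLast 𝒞 L × IsLast (λ H → 𝒞 H × ¬ (H ≅ L)) S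

-- The trace of order 0 of the tensor depends on k and the number of vertices only,
-- and that of order 1 on the sum of the degrees.  In the formula for the trace of
-- order 2, a summand counts closed walks consisting of k-1 prescribed arcs from i
-- and k-1 prescribed arcs from j.  For i = j only the loops at i contribute, and for
-- i ≠ j nothing does unless k = 2 and ij is an edge.  Hence this trace equals
-- (k-1)^(n-1) (α² ∑ d_v² + c) with c depending on k, α and m alone, so that H₁
-- precedes H₂ as soon as ∑ d_v² is smaller for H₁.
--
-- A unicyclic hypergraph has n = m(k-1) vertices: its incidence graph has as many
-- edges as nodes.  Put x_v = d_v - 1, so that ∑ x_v = m.  The cycle has at least
-- three vertices by linearity, each with x_v ≥ 1.  If some other vertex also has
-- x_v ≥ 1 then ∑ x_v² ≤ (m-3)² + 3, which is less than the value (m-3)² + 5 of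
-- C₃;m-4,1,0.  Otherwise the hypergraph is a triangle with n₁, n₂, n₃ pendant
-- hyperedges at its corners and ∑ x_v² = ∑ (1 + nᵢ)², whose two largest values are
-- attained exactly at (m-3, 0, 0) and (m-4, 1, 0) up to permutation.

module Submission where

open import Defs
open import Algebra.Bundles using (CommutativeRing; CommutativeSemiring)
import Algebra.Properties.CommutativeSemigroup as CommutativeSemigroupProperties
import Algebra.Properties.Semiring.Mult as SemiringMult
open import Data.Bool using () renaming (_≟_ to _≟ᵇ_)
open import Data.Fin
  using (Fin; zero; suc; toℕ; fromℕ<; _≟_; punchIn; punchOut; splitAt; remQuot; combine; _↑ˡ_;
    _↑ʳ_)
open import Data.Fin.Patterns using (0F; 1F; 2F)
open import Data.Fin.Permutation as Permutation
  using (Permutation; Permutation′; _⟨$⟩ʳ_; _⟨$⟩ˡ_; _∘ₚ_; insert; insert-punchIn; inverseʳ;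
    inverseˡ; transpose)
open import Data.Fin.Properties
  using (all?; any?; pigeonhole; toℕ<n; toℕ-fromℕ<; toℕ-injective; injective⇒≤;
    punchOut-injective; splitAt-↑ˡ; splitAt⁻¹-↑ˡ; splitAt⁻¹-↑ʳ; combine-remQuot)
open import Data.Fin.Subset using (Subset; inside; outside; ⊤; ⊥; ⁅_⁆; _∪_; _∩_; _∈_; ∣_∣)
open import Data.Fin.Subset.Properties
  using (_∈?_; ∈⊤; ∉⊥; ∣⊤∣≡n; ∣⊥∣≡0; ∣⁅x⁆∣≡1; x∈⁅x⁆; x∈⁅y⁆⇒x≡y; ⊆-antisym; x∈p∪q⁻; x∈p∪q⁺;
    x∈p∩q⁻; x∈p∩q⁺; x∈p⇒∣p-x∣<∣p∣; x∈p∧x≢y⇒x∈p-y)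
open import Data.List as List
  using (List; []; _∷_; _++_; map; foldr; filter; length; allFin; concatMap; upTo;
    cartesianProductWith)
open import Data.List.Membership.Propositional using () renaming (_∈_ to _∈ˡ_)
open import Data.List.Membership.Propositional.Properties
  using (∈-++⁺ˡ; ∈-++⁺ʳ; ∈-++⁻; ∈-map⁺; ∈-map⁻; ∈-filter⁺; ∈-filter⁻; ∈-allFin; ∈-∃++)
open import Data.List.Properties
  using (++-identityʳ; map-tabulate; foldr-map; length-tabulate; length-++; length-map)
open import Data.List.Relation.Binary.Permutation.Propositional as Perm
  using (_↭_; ↭-refl; ↭-sym; ↭-trans; ↭-prep; ↭-swap; ↭⇒↭ₛ)
open import Data.List.Relation.Binary.Permutation.Propositional.Properties
  using (∈-resp-↭; shift; ↭-length; ++⁺ˡ) renaming (++-identityʳ to ↭-++-identityʳ)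
import Data.List.Relation.Binary.Permutation.Setoid.Properties as PermSetoid
open import Data.List.Relation.Unary.All as ListAll using ()
open import Data.List.Relation.Unary.AllPairs using ([]; _∷_)
open import Data.List.Relation.Unary.Any as Any using (here; there)
open import Data.List.Relation.Unary.Unique.Propositional using (Unique)
import Data.List.Relation.Unary.Unique.Propositional.Properties as Unique
open import Data.Nat as ℕ using (ℕ; zero; suc; _∸_; _!)
open import Data.Nat.DivMod using (m<n⇒m%n≡m; n%n≡0; m%n<n)
open import Data.Nat.GeneralisedArithmetic using (fold)
open import Data.Nat.Induction using (<-wellFounded)
import Data.Nat.Properties as ℕₚ
open import Data.Nat.Solver using (module +-*-Solver)
open import Data.Product using (_×_; _,_; proj₁; proj₂; ∃-syntax; Σ-syntax; map₂; uncurry)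
open import Data.Product.Properties using () renaming (≡-dec to ×-≡-dec)
open import Data.Sum as Sum using (_⊎_; inj₁; inj₂; [_,_]′)
open import Data.Sum.Properties using (inj₁-injective; inj₂-injective) renaming (≡-dec to ⊎-≡-dec)
open import Data.Vec as Vec using (Vec; []; _∷_; here; there; lookup)
open import Data.Vec.Properties
  using (map-∘; map-++; map-replicate; lookup-replicate; lookup∘update; lookup∘update′)
    renaming (≡-dec to Vec-≡-dec)
open import Data.Vec.Relation.Unary.All as All using (All; []; _∷_)
open import Function using (_∘_; id)
open import Function.Bundles using (_⇔_; mk⇔; Equivalence)
open import Induction.WellFounded using (Acc; acc)
open import Level using (Level)
open import Relation.Binary using (DecidableEquality; IsStrictPartialOrder)
open import Relation.Binary.Construct.Closure.ReflexiveTransitive as Star using (Star; _◅_)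
open import Relation.Binary.Definitions using (tri<; tri≈; tri>)
import Relation.Binary.PropositionalEquality as ≡
open import Relation.Binary.PropositionalEquality using (_≡_; _≢_; cong; subst)
open import Relation.Nullary using (Dec; yes; no; ¬_; contradiction)
open import Relation.Nullary.Decidable using (¬?; _⊎-dec_; _×-dec_; _→-dec_; from-yes)
open import Relation.Unary using (Decidable)

-- Finite sums

-- The trace formula is never expanded. A formal polynomial is seen only through its pairings `ev φ`
-- with functionals on monomials, and each differential operator is moved to the functional; what is
-- left of tr (A^N) is a sum over closed walks, which vanishes as soon as no closed walk can
-- traverse the prescribed arcs. Vanishing is proved and never tested, since equality of scalars
-- need not be decidable. The count n = m(k-1) is needed twice: the order compares only hypergraphs
-- on equally many vertices, and the count turns the handshake identity into ∑ x_v = m. One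
-- inequality grows the incidence graph from the cycle; for the other a single incidence of the
-- cycle is deleted, which by uniqueness destroys every cycle, and leaves are stripped. Isomorphisms
-- are not built by hand: a triangle with pendants is encoded by a kind for each hyperedge and a
-- label for each vertex, from which incidence can be read off, so equal numbers of each kind and
-- label already yield one. The same encoding shows that the candidates themselves are linear and
-- unicyclic.

module Sums {c ℓ} (R : CommutativeSemiring c ℓ) where
  open CommutativeSemiring R hiding (zero)
  open import Relation.Binary.Reasoning.Setoid setoid

  ⨁ : ∀ {a} {A : Set a} → List A → (A → Carrier) → Carrier
  ⨁ xs f = foldr _+_ 0# (map f xs)

  module _ {a} {A : Set a} where

    ⨁-cong-∈ : ∀ xs {f g : A → Carrier} → (∀ x → x ∈ˡ xs → f x ≈ g x) → ⨁ xs f ≈ ⨁ xs g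
    ⨁-cong-∈ []       f≈g = refl
    ⨁-cong-∈ (x ∷ xs) f≈g = +-cong (f≈g x (here ≡.refl)) (⨁-cong-∈ xs (λ y → f≈g y ∘ there))

    ⨁-cong : ∀ xs {f g : A → Carrier} → (∀ x → f x ≈ g x) → ⨁ xs f ≈ ⨁ xs g
    ⨁-cong xs f≈g = ⨁-cong-∈ xs (λ x _ → f≈g x)

    ⨁-zero : ∀ xs {f : A → Carrier} → (∀ x → x ∈ˡ xs → f x ≈ 0#) → ⨁ xs f ≈ 0#
    ⨁-zero []       f≈0 = refl
    ⨁-zero (x ∷ xs) f≈0 =
      trans (+-cong (f≈0 x (here ≡.refl)) (⨁-zero xs (λ y → f≈0 y ∘ there))) (+-identityˡ 0#)

    ⨁-++ : ∀ xs ys (f : A → Carrier) → ⨁ (xs ++ ys) f ≈ ⨁ xs f + ⨁ ys f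
    ⨁-++ []       ys f = sym (+-identityˡ _)
    ⨁-++ (x ∷ xs) ys f = trans (+-congˡ (⨁-++ xs ys f)) (sym (+-assoc _ _ _))

    ⨁-+ : ∀ xs (f g : A → Carrier) → ⨁ xs (λ x → f x + g x) ≈ ⨁ xs f + ⨁ xs g
    ⨁-+ []       f g = sym (+-identityˡ 0#)
    ⨁-+ (x ∷ xs) f g = begin
      f x + g x + ⨁ xs (λ y → f y + g y) ≈⟨ +-congˡ (⨁-+ xs f g) ⟩
      f x + g x + (⨁ xs f + ⨁ xs g)      ≈⟨ +-assoc _ _ _ ⟩
      f x + (g x + (⨁ xs f + ⨁ xs g))    ≈⟨ +-congˡ (+-assoc _ _ _) ⟨
      f x + (g x + ⨁ xs f + ⨁ xs g)      ≈⟨ +-congˡ (+-congʳ (+-comm _ _)) ⟩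
      f x + (⨁ xs f + g x + ⨁ xs g)      ≈⟨ +-congˡ (+-assoc _ _ _) ⟩
      f x + (⨁ xs f + (g x + ⨁ xs g))    ≈⟨ +-assoc _ _ _ ⟨
      f x + ⨁ xs f + (g x + ⨁ xs g)      ∎

    ⨁-*ˡ : ∀ xs s (f : A → Carrier) → ⨁ xs (λ x → s * f x) ≈ s * ⨁ xs f
    ⨁-*ˡ []       s f = sym (zeroʳ s)
    ⨁-*ˡ (x ∷ xs) s f = trans (+-congˡ (⨁-*ˡ xs s f)) (sym (distribˡ _ _ _))

    ⨁-↭ : ∀ {xs ys} (f : A → Carrier) → xs ↭ ys → ⨁ xs f ≈ ⨁ ys f
    ⨁-↭ f Perm.refl         = refl
    ⨁-↭ f (Perm.prep x p)   = +-congˡ (⨁-↭ f p)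
    ⨁-↭ {x ∷ y ∷ xs} {_ ∷ _ ∷ ys} f (Perm.swap x y p) = begin
      f x + (f y + ⨁ xs f) ≈⟨ +-assoc _ _ _ ⟨
      f x + f y + ⨁ xs f   ≈⟨ +-cong (+-comm _ _) (⨁-↭ f p) ⟩
      f y + f x + ⨁ ys f   ≈⟨ +-assoc _ _ _ ⟩
      f y + (f x + ⨁ ys f) ∎
    ⨁-↭ f (Perm.trans p q)  = trans (⨁-↭ f p) (⨁-↭ f q)

  ⨁-map : ∀ {a b} {A : Set a} {B : Set b} (g : A → B) xs (f : B → Carrier) →
    ⨁ (map g xs) f ≈ ⨁ xs (f ∘ g)
  ⨁-map g []       f = refl
  ⨁-map g (x ∷ xs) f = +-congˡ (⨁-map g xs f)

  ⨁-swap : ∀ {a b} {A : Set a} {B : Set b} xs ys (f : A → B → Carrier) →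
    ⨁ xs (λ x → ⨁ ys (f x)) ≈ ⨁ ys (λ y → ⨁ xs (λ x → f x y))
  ⨁-swap []       ys f = sym (⨁-zero ys (λ _ _ → refl))
  ⨁-swap (x ∷ xs) ys f = trans (+-congˡ (⨁-swap xs ys f)) (sym (⨁-+ ys _ _))

  ⨁-concatMap : ∀ {a b} {A : Set a} {B : Set b} (g : A → List B) xs (f : B → Carrier) →
    ⨁ (concatMap g xs) f ≈ ⨁ xs (λ x → ⨁ (g x) f)
  ⨁-concatMap g []       f = refl
  ⨁-concatMap g (x ∷ xs) f =
    trans (⨁-++ (g x) (concatMap g xs) f) (+-congˡ (⨁-concatMap g xs f))

  ⨁-suc : ∀ n (f : Fin (suc n) → Carrier) →
    ⨁ (allFin (suc n)) f ≈ f zero + ⨁ (allFin n) (f ∘ suc)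
  ⨁-suc n f = +-congˡ (reflexive (cong (foldr _+_ 0#)
    (≡.trans (map-tabulate suc f) (≡.sym (map-tabulate (λ i → i) (f ∘ suc))))))

  ⨁-single : ∀ n (f : Fin n → Carrier) i → (∀ j → j ≢ i → f j ≈ 0#) →
    ⨁ (allFin n) f ≈ f i
  ⨁-single (suc n) f zero    f≈0 = trans (⨁-suc n f)
    (trans (+-congˡ (⨁-zero (allFin n) (λ j _ → f≈0 (suc j) (λ ())))) (+-identityʳ _))
  ⨁-single (suc n) f (suc i) f≈0 = trans (⨁-suc n f)
    (trans (+-cong (f≈0 zero (λ ()))
                   (⨁-single n (f ∘ suc) i (λ j j≢i → f≈0 (suc j) (λ { ≡.refl → j≢i ≡.refl }))))
           (+-identityˡ _))

  ⨁-↑ : ∀ m n (f : Fin (m ℕ.+ n) → Carrier) →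
    ⨁ (allFin (m ℕ.+ n)) f ≈ ⨁ (allFin m) (f ∘ (_↑ˡ n)) + ⨁ (allFin n) (f ∘ (m ↑ʳ_))
  ⨁-↑ zero    n f = sym (+-identityˡ _)
  ⨁-↑ (suc m) n f = begin
    ⨁ (allFin (suc m ℕ.+ n)) f                    ≈⟨ ⨁-suc (m ℕ.+ n) f ⟩
    f zero + ⨁ (allFin (m ℕ.+ n)) (f ∘ suc)       ≈⟨ +-congˡ (⨁-↑ m n (f ∘ suc)) ⟩
    f zero + (⨁ (allFin m) (f ∘ suc ∘ (_↑ˡ n)) + _) ≈⟨ +-assoc _ _ _ ⟨
    f zero + ⨁ (allFin m) (f ∘ suc ∘ (_↑ˡ n)) + _ ≈⟨ +-congʳ (⨁-suc m (f ∘ (_↑ˡ n))) ⟨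
    ⨁ (allFin (suc m)) (f ∘ (_↑ˡ n)) + _           ∎

  ⨁-pair : ∀ m (f : Fin m → Carrier) i j → i ≢ j → (∀ l → l ≢ i → l ≢ j → f l ≈ 0#) →
    ⨁ (allFin m) f ≈ f i + f j
  ⨁-pair (suc m) f zero    zero    i≢j f≈0 = contradiction ≡.refl i≢j
  ⨁-pair (suc m) f zero    (suc j) i≢j f≈0 = trans (⨁-suc m f)
    (+-congˡ (⨁-single m (f ∘ suc) j λ l l≢j → f≈0 (suc l) (λ ()) λ { ≡.refl → l≢j ≡.refl }))
  ⨁-pair (suc m) f (suc i) zero    i≢j f≈0 = trans (⨁-suc m f) (trans (+-comm _ _)
    (+-congʳ (⨁-single m (f ∘ suc) i λ l l≢i → f≈0 (suc l) (λ { ≡.refl → l≢i ≡.refl }) λ ())))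
  ⨁-pair (suc m) f (suc i) (suc j) i≢j f≈0 = trans (⨁-suc m f) (trans
    (+-cong (f≈0 zero (λ ()) λ ()) (⨁-pair m (f ∘ suc) i j (i≢j ∘ cong suc)
      λ l l≢i l≢j → f≈0 (suc l) (λ { ≡.refl → l≢i ≡.refl }) λ { ≡.refl → l≢j ≡.refl }))
    (+-identityˡ _))

  -- The sum over pairs i < j, recursive in the way `compositions` peels off coordinates, so that
  -- `sum-compositions-2` is an induction along it.
  pairSum : ∀ m → (Fin m → Fin m → Carrier) → Carrier
  pairSum zero    f = 0#
  pairSum (suc m) f = ⨁ (allFin m) (f zero ∘ suc) + pairSum m (λ i j → f (suc i) (suc j))

  pairSum-cong : ∀ m {f g} → (∀ i j → i ≢ j → f i j ≈ g i j) → pairSum m f ≈ pairSum m g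
  pairSum-cong zero    f≈g = refl
  pairSum-cong (suc m) f≈g = +-cong (⨁-cong (allFin m) λ j → f≈g zero (suc j) (λ ()))
    (pairSum-cong m λ i j i≢j → f≈g (suc i) (suc j) λ { ≡.refl → i≢j ≡.refl })

  pairSum-*ˡ : ∀ m s f → pairSum m (λ i j → s * f i j) ≈ s * pairSum m f
  pairSum-*ˡ zero    s f = sym (zeroʳ s)
  pairSum-*ˡ (suc m) s f =
    trans (+-cong (⨁-*ˡ (allFin m) s _) (pairSum-*ˡ m s _)) (sym (distribˡ _ _ _))

  pairSum-⨁ : ∀ m {a} {A : Set a} (xs : List A) (f : A → Fin m → Fin m → Carrier) →
    pairSum m (λ i j → ⨁ xs (λ x → f x i j)) ≈ ⨁ xs (λ x → pairSum m (f x))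
  pairSum-⨁ zero    xs f = sym (⨁-zero xs (λ _ _ → refl))
  pairSum-⨁ (suc m) xs f = trans
    (+-cong (⨁-swap (allFin m) xs _) (pairSum-⨁ m xs (λ x i j → f x (suc i) (suc j))))
    (sym (⨁-+ xs _ _))

  -- With 0/1 weights x it recovers the number of pairs from ∑ x alone; `pairSum-common` counts the
  -- pair inside a 2-element hyperedge this way.
  ⨁-square : ∀ m (x : Fin m → Carrier) → ⨁ (allFin m) x * ⨁ (allFin m) x ≈
    ⨁ (allFin m) (λ i → x i * x i) + (pairSum m (λ i j → x i * x j) + pairSum m (λ i j → x i * x j))
  ⨁-square zero    x = trans (zeroˡ _) (sym (trans (+-identityˡ _) (+-identityˡ _)))
  ⨁-square (suc m) x = begin
    ⨁ (allFin (suc m)) x * ⨁ (allFin (suc m)) x  ≈⟨ *-cong (⨁-suc m x) (⨁-suc m x) ⟩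
    (a + S) * (a + S)                            ≈⟨ distribˡ _ _ _ ⟩
    (a + S) * a + (a + S) * S                    ≈⟨ +-cong (distribʳ _ _ _) (distribʳ _ _ _) ⟩
    (a * a + S * a) + (a * S + S * S)
      ≈⟨ +-cong (+-congˡ (*-comm _ _)) (+-congˡ (⨁-square m (x ∘ suc))) ⟩
    (a * a + a * S) + (a * S + (Q + (P + P)))    ≈⟨ rearrange ⟩
    (a * a + Q) + ((a * S + P) + (a * S + P))    ≈⟨ +-cong (sym (⨁-suc m _)) (+-cong p p) ⟩
    ⨁ (allFin (suc m)) (λ i → x i * x i) + (pairSum (suc m) product + pairSum (suc m) product) ∎
    where
    a = x zero
    S = ⨁ (allFin m) (x ∘ suc)
    Q = ⨁ (allFin m) (λ i → x (suc i) * x (suc i))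
    P = pairSum m (λ i j → x (suc i) * x (suc j))
    product : Fin (suc m) → Fin (suc m) → Carrier
    product i j = x i * x j
    p : a * S + P ≈ pairSum (suc m) product
    p = +-congʳ (sym (⨁-*ˡ (allFin m) a (x ∘ suc)))
    open CommutativeSemigroupProperties +-commutativeSemigroup using (x∙yz≈y∙xz; interchange)
    rearrange : (a * a + a * S) + (a * S + (Q + (P + P))) ≈ (a * a + Q) + ((a * S + P) + (a * S + P))
    rearrange = begin
      (a * a + a * S) + (a * S + (Q + (P + P))) ≈⟨ +-assoc _ _ _ ⟩
      a * a + (a * S + (a * S + (Q + (P + P)))) ≈⟨ +-congˡ (+-assoc _ _ _) ⟨
      a * a + ((a * S + a * S) + (Q + (P + P))) ≈⟨ +-congˡ (x∙yz≈y∙xz _ _ _) ⟩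
      a * a + (Q + ((a * S + a * S) + (P + P))) ≈⟨ +-assoc _ _ _ ⟨
      (a * a + Q) + ((a * S + a * S) + (P + P)) ≈⟨ +-congˡ (interchange _ _ _ _) ⟩
      (a * a + Q) + ((a * S + P) + (a * S + P)) ∎

-- Traces as weighted counts of closed walks

module Trace {c ℓ₁ ℓ₂} (F : OrderedField c ℓ₁ ℓ₂) where
  open OrderedField F hiding (zero)
  private module R = CommutativeRing commutativeRing
  open SemiringMult R.semiring using (×-assocˡ; ×-homo-1; ×-congʳ)
  open Sums (CommutativeRing.commutativeSemiring commutativeRing) public
  open import Relation.Binary.Reasoning.Setoid setoid

  module _ {n : ℕ} where
    open Indeterminates F n

    Functional : Set c
    Functional = List Var → Carrier

    -- The linear extension of a functional on monomials. Facts about polynomials are stated through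
    -- such pairings, so formal sums need no normal form.
    ev : Functional → Poly → Carrier
    ev φ p = ⨁ p (λ (a , w) → a * φ w)

    ε : Functional
    ε []      = 1#
    ε (_ ∷ _) = 0#

    constantTerm≈ev : ∀ p → constantTerm p ≈ ev ε p
    constantTerm≈ev []                = refl
    constantTerm≈ev ((a , []) ∷ p)    = +-cong (sym (*-identityʳ a)) (constantTerm≈ev p)
    constantTerm≈ev ((a , _ ∷ _) ∷ p) =
      trans (constantTerm≈ev p) (trans (sym (+-identityˡ _)) (+-congʳ (sym (zeroʳ a))))

    ev-∙ : ∀ φ a p → ev φ (a ∙ p) ≈ a * ev φ p
    ev-∙ φ a p = begin
      ev φ (a ∙ p)                         ≈⟨ ⨁-map _ p _ ⟩
      ⨁ p (λ (b , w) → a * b * φ w)        ≈⟨ ⨁-cong p (λ _ → *-assoc _ _ _) ⟩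
      ⨁ p (λ (b , w) → a * (b * φ w))      ≈⟨ ⨁-*ˡ p a _ ⟩
      a * ev φ p                           ∎

    infixl 5 _◁_ _◀_
    -- The transpose of `∂ x`: instead of differentiating the polynomial, one occurrence of x is
    -- deleted, in all possible ways, before φ is applied.
    _◁_ : Functional → Var → Functional
    (φ ◁ x) w = ⨁ (remove x w) φ

    _◀_ : Functional → List Var → Functional
    φ ◀ []      = φ
    φ ◀ (x ∷ u) = (φ ◁ x) ◀ u

    ◀-++ : ∀ φ u v → (φ ◀ u) ◀ v ≡ φ ◀ (u ++ v)
    ◀-++ φ []      v = ≡.refl
    ◀-++ φ (x ∷ u) v = ◀-++ (φ ◁ x) u v

    ev-∂ : ∀ φ x p → ev φ (∂ x p) ≈ ev (φ ◁ x) p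
    ev-∂ φ x p = trans (⨁-concatMap _ p _) (⨁-cong p λ (a , w) →
      trans (⨁-map (a ,_) (remove x w) _) (⨁-*ˡ (remove x w) a φ))

    arcs : ∀ {p} → Fin n → Vec (Fin n) p → List Var
    arcs i []      = []
    arcs i (j ∷ γ) = (i , j) ∷ arcs i γ

    ev-∂[] : ∀ {p} φ i (γ : Vec (Fin n) p) q → ev φ (∂[ i , γ ] q) ≈ ev (φ ◀ arcs i γ) q
    ev-∂[] φ i []      q = refl
    ev-∂[] φ i (j ∷ γ) q = trans (ev-∂ φ (i , j) (∂[ i , γ ] q)) (ev-∂[] (φ ◁ (i , j)) i γ q)

    ev-⊛ : ∀ φ i l q → ev φ (A i l ⊛ q) ≈ ev (λ w → φ ((i , l) ∷ w)) q
    ev-⊛ φ i l q = begin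
      ev φ (A i l ⊛ q)
        ≡⟨ cong (ev φ) (++-identityʳ (map (λ (b , v) → 1# * b , (i , l) ∷ v) q)) ⟩
      ev φ (map (λ (b , v) → 1# * b , (i , l) ∷ v) q)       ≈⟨ ⨁-map _ q _ ⟩
      ⨁ q (λ (b , v) → 1# * b * φ ((i , l) ∷ v))
        ≈⟨ ⨁-cong q (λ _ → *-congʳ (*-identityˡ _)) ⟩
      ev (λ w → φ ((i , l) ∷ w)) q                          ∎

    ev-A^suc : ∀ φ N p q → ev φ ((A^ suc N) p q) ≈
      ⨁ (allFin n) (λ l → ev (λ w → φ ((p , l) ∷ w)) ((A^ N) l q))
    ev-A^suc φ N p q = trans (⨁-concatMap _ (allFin n) _)
      (⨁-cong (allFin n) (λ l → ev-⊛ φ p l ((A^ N) l q)))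

    data Walk : Fin n → List Var → Fin n → Set where
      nil  : ∀ {p} → Walk p [] p
      cons : ∀ {p l q w} → Walk l w q → Walk p ((p , l) ∷ w) q

    ev-A^-zero : ∀ N p q φ → (∀ w → Walk p w q → φ w ≈ 0#) → ev φ ((A^ N) p q) ≈ 0#
    ev-A^-zero zero p q φ φ≈0 with p ≟ q
    ... | yes ≡.refl = trans (+-identityʳ _) (trans (*-identityˡ _) (φ≈0 [] nil))
    ... | no _       = refl
    ev-A^-zero (suc N) p q φ φ≈0 = trans (ev-A^suc φ N p q) (⨁-zero (allFin n) λ l _ →
      ev-A^-zero N l q _ (λ w W → φ≈0 _ (cons W)))

    ev-tr : ∀ φ N → ev φ (tr (A^ N)) ≈ ⨁ (allFin n) (λ p → ev φ ((A^ N) p p))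
    ev-tr φ N = ⨁-concatMap _ (allFin n) _

    -- A disjunction for each w, because it cannot be decided whether φ w vanishes; case
    -- distinctions on walks go through it.
    Supported : List Var → Functional → Set ℓ₁
    Supported v φ = ∀ w → φ w ≈ 0# ⊎ w ↭ v

    remove-↭ : ∀ x w w′ → w′ ∈ˡ remove x w → w ↭ x ∷ w′
    remove-↭ x (y ∷ w) w′ w′∈ with ×-≡-dec _≟_ _≟_ x y
    remove-↭ x (y ∷ w) w′ (here ≡.refl) | yes ≡.refl = ↭-refl
    remove-↭ x (y ∷ w) w′ (there w′∈)   | yes _ with ∈-map⁻ (y ∷_) w′∈
    ... | w″ , w″∈ , ≡.refl = ↭-trans (↭-prep y (remove-↭ x w w″ w″∈)) (↭-swap y x ↭-refl)
    remove-↭ x (y ∷ w) w′ w′∈ | no _ with ∈-map⁻ (y ∷_) w′∈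
    ... | w″ , w″∈ , ≡.refl = ↭-trans (↭-prep y (remove-↭ x w w″ w″∈)) (↭-swap y x ↭-refl)

    supported-◁ : ∀ {v φ} x → Supported v φ → Supported (x ∷ v) (φ ◁ x)
    supported-◁ {v} {φ} x S w = go (remove x w) (remove-↭ x w)
      where
      go : ∀ ws → (∀ w′ → w′ ∈ˡ ws → w ↭ x ∷ w′) → ⨁ ws φ ≈ 0# ⊎ w ↭ x ∷ v
      go []        _ = inj₁ refl
      go (w′ ∷ ws) P with S w′ | go ws (λ w″ → P w″ ∘ there)
      ... | inj₂ w′↭v | _      = inj₂ (↭-trans (P w′ (here ≡.refl)) (↭-prep x w′↭v))
      ... | inj₁ _    | inj₂ r = inj₂ r
      ... | inj₁ z    | inj₁ r = inj₁ (trans (+-cong z r) (+-identityˡ 0#))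

    supported-◀ : ∀ {v φ} u → Supported v φ → Supported (u ++ v) (φ ◀ u)
    supported-◀ []      S = S
    supported-◀ {v} (x ∷ u) S w with supported-◀ u (supported-◁ x S) w
    ... | inj₁ z = inj₁ z
    ... | inj₂ r = inj₂ (↭-trans r (shift x u v))

    supported-ε : ∀ u → Supported u (ε ◀ u)
    supported-ε u = subst (λ v → Supported v (ε ◀ u)) (++-identityʳ u)
      (supported-◀ u λ { [] → inj₂ ↭-refl ; (_ ∷ _) → inj₁ refl })

    -- The number of pairs of a rooted closed walk of length N and a bijection
    -- between its steps and the arcs u.
    closings : ℕ → List Var → Carrier
    closings N u = ev (ε ◀ u) (tr (A^ N))

    -- The functional `ε ◀ u` vanishes except on rearrangements of u, and the monomials in the
    -- diagonal entries of A^N are closed walks.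
    closings-zero : ∀ N u → (∀ p w → Walk p w p → ¬ (w ↭ u)) → closings N u ≈ 0#
    closings-zero N u no-walk = trans (ev-tr (ε ◀ u) N) (⨁-zero (allFin n) λ p _ →
      ev-A^-zero N p p _ (λ w W → vanish p w W))
      where
      vanish : ∀ p w → Walk p w p → (ε ◀ u) w ≈ 0#
      vanish p w W with supported-ε u w
      ... | inj₁ z = z
      ... | inj₂ r = contradiction r (no-walk p w W)

    walk-start : ∀ {p w q x} → Walk p w q → x ∈ˡ w → ∃[ z ] (p , z) ∈ˡ w
    walk-start (cons W) _ = _ , here ≡.refl

    walk-next : ∀ {p w q x y} → Walk p w q → (x , y) ∈ˡ w → y ≡ q ⊎ (∃[ z ] (y , z) ∈ˡ w)
    walk-next (cons nil)        (here ≡.refl) = inj₁ ≡.refl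
    walk-next (cons (cons W))   (here ≡.refl) = inj₂ (_ , there (here ≡.refl))
    walk-next (cons W) (there xy∈) with walk-next W xy∈
    ... | inj₁ y≡q      = inj₁ y≡q
    ... | inj₂ (z , yz) = inj₂ (z , there yz)

    -- A step into y is followed by a step out of y, the final step of the closed walk by the first
    -- one.
    closed-walk-next : ∀ {p w x y} → Walk p w p → (x , y) ∈ˡ w → ∃[ z ] (y , z) ∈ˡ w
    closed-walk-next W xy∈ with walk-next W xy∈
    ... | inj₁ ≡.refl = walk-start W xy∈
    ... | inj₂ r      = r

    loops-walk : ∀ {p w q} → Walk p w q → (∀ {x y} → (x , y) ∈ˡ w → x ≡ y) →
      ∀ {x y} → (x , y) ∈ˡ w → x ≡ p
    loops-walk (cons W) loops (here ≡.refl) = ≡.refl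
    loops-walk (cons W) loops (there xy∈) with loops (here ≡.refl)
    ... | ≡.refl = loops-walk W (loops ∘ there) xy∈

    ev-A^-loop : ∀ N i φ → (∀ w x → x ∈ˡ w → x ≢ (i , i) → φ w ≈ 0#) →
      ev φ ((A^ N) i i) ≈ φ (List.replicate N (i , i))
    ev-A^-loop zero i φ φ≈0 with i ≟ i
    ... | yes _  = trans (+-identityʳ _) (*-identityˡ _)
    ... | no i≢i = contradiction ≡.refl i≢i
    ev-A^-loop (suc N) i φ φ≈0 = begin
      ev φ ((A^ suc N) i i)                           ≈⟨ ev-A^suc φ N i i ⟩
      ⨁ (allFin n) (λ l → ev (λ w → φ ((i , l) ∷ w)) ((A^ N) l i))
        ≈⟨ ⨁-single n _ i (λ l l≢i → ev-A^-zero N l i _ (λ w _ →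
             φ≈0 _ _ (here ≡.refl) (l≢i ∘ cong proj₂))) ⟩
      ev (λ w → φ ((i , i) ∷ w)) ((A^ N) i i)
        ≈⟨ ev-A^-loop N i _ (λ w x x∈w → φ≈0 _ x (there x∈w)) ⟩
      φ (List.replicate (suc N) (i , i))              ∎

    remove-head : ∀ x w (φ : Functional) → (φ ◁ x) (x ∷ w) ≈ φ w + ((φ ∘ (x ∷_)) ◁ x) w
    remove-head x w φ with ×-≡-dec _≟_ _≟_ x x
    ... | yes _  = +-congˡ (⨁-map (x ∷_) (remove x w) φ)
    ... | no x≢x = contradiction ≡.refl x≢x

    remove-tail : ∀ x y w (φ : Functional) → x ≢ y → (φ ◁ x) (y ∷ w) ≈ ((φ ∘ (y ∷_)) ◁ x) w
    remove-tail x y w φ x≢y with ×-≡-dec _≟_ _≟_ x y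
    ... | yes x≡y = contradiction x≡y x≢y
    ... | no _    = ⨁-map (y ∷_) (remove x w) φ

    ◁-replicate : ∀ x a (φ : Functional) →
      (φ ◁ x) (List.replicate (suc a) x) ≈ suc a · φ (List.replicate a x)
    ◁-replicate x zero    φ = trans (remove-head x [] φ) refl
    ◁-replicate x (suc a) φ =
      trans (remove-head x (List.replicate (suc a) x) φ) (+-congˡ (◁-replicate x a (φ ∘ (x ∷_))))

    -- The invariant φ (x^a) = a! is carried along, since one of a + 1 equal letters can be deleted
    -- in a + 1 ways. The accumulator a makes the induction work; it starts at `ε` with a = 0.
    ◀-replicate : ∀ x N a (φ : Functional) → φ (List.replicate a x) ≈ (a !) · 1# →
      (φ ◀ List.replicate N x) (List.replicate (N ℕ.+ a) x) ≈ ((N ℕ.+ a) !) · 1#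
    ◀-replicate x zero    a φ φ≈ = φ≈
    ◀-replicate x (suc N) a φ φ≈ = begin
      (φ ◁ x ◀ List.replicate N x) (List.replicate (suc N ℕ.+ a) x)
        ≡⟨ cong (λ b → (φ ◁ x ◀ List.replicate N x) (List.replicate b x)) (ℕₚ.+-suc N a) ⟨
      (φ ◁ x ◀ List.replicate N x) (List.replicate (N ℕ.+ suc a) x)
        ≈⟨ ◀-replicate x N (suc a) (φ ◁ x) (trans (◁-replicate x a φ)
             (trans (×-congʳ (suc a) φ≈) (×-assocˡ 1# (suc a) (a !)))) ⟩
      ((N ℕ.+ suc a) !) · 1#
        ≡⟨ cong (λ b → (b !) · 1#) (ℕₚ.+-suc N a) ⟩
      ((suc N ℕ.+ a) !) · 1# ∎

    -- Only the walk that stays at i contributes, and the factorial counts the ways to match its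
    -- steps with equal arcs. It is what the normalisation 1/(dᵢ(k-1))! of the formula removes.
    closings-loop : ∀ N i → closings (suc N) (List.replicate (suc N) (i , i)) ≈ (suc N !) · 1#
    closings-loop N i = begin
      closings (suc N) u                              ≈⟨ ev-tr (ε ◀ u) (suc N) ⟩
      ⨁ (allFin n) (λ p → ev (ε ◀ u) ((A^ suc N) p p))
        ≈⟨ ⨁-single n _ i (λ p p≢i → ev-A^-zero (suc N) p p _ λ w W → vanish w λ w↭u →
             p≢i (cong proj₁ (∈-replicate (∈-resp-↭ w↭u (proj₂ (first W w↭u)))))) ⟩
      ev (ε ◀ u) ((A^ suc N) i i)
        ≈⟨ ev-A^-loop (suc N) i (ε ◀ u) (λ w x x∈w x≢ → vanish w λ w↭u →
             x≢ (∈-replicate (∈-resp-↭ w↭u x∈w))) ⟩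
      (ε ◀ u) u
        ≡⟨ cong (λ b → (ε ◀ u) (List.replicate b (i , i))) (ℕₚ.+-identityʳ (suc N)) ⟨
      (ε ◀ u) (List.replicate (suc N ℕ.+ 0) (i , i))
        ≈⟨ ◀-replicate (i , i) (suc N) 0 ε (sym (×-homo-1 1#)) ⟩
      ((suc N ℕ.+ 0) !) · 1#
        ≡⟨ cong (λ b → (b !) · 1#) (ℕₚ.+-identityʳ (suc N)) ⟩
      (suc N !) · 1# ∎
      where
      u = List.replicate (suc N) (i , i)
      ∈-replicate : ∀ {a} {x : Var} → x ∈ˡ List.replicate a (i , i) → x ≡ (i , i)
      ∈-replicate {suc a} (here eq)  = eq
      ∈-replicate {suc a} (there x∈) = ∈-replicate {a} x∈
      vanish : ∀ w → ¬ (w ↭ u) → (ε ◀ u) w ≈ 0#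
      vanish w ¬r with supported-ε u w
      ... | inj₁ z = z
      ... | inj₂ r = contradiction r ¬r
      first : ∀ {p w} → Walk p w p → w ↭ u → ∃[ z ] (p , z) ∈ˡ w
      first W w↭u = walk-start W (∈-resp-↭ (↭-sym w↭u) (here ≡.refl))

    -- A closed walk that enters y must leave y.
    closings-foreign : ∀ N u x y → (x , y) ∈ˡ u → (∀ z → ¬ (y , z) ∈ˡ u) → closings N u ≈ 0#
    closings-foreign N u x y xy∈u y∉u = closings-zero N u λ p w W w↭u →
      let z , yz∈w = closed-walk-next W (∈-resp-↭ (↭-sym w↭u) xy∈u)
      in  y∉u z (∈-resp-↭ w↭u yz∈w)

    -- A walk made of loops never leaves its starting point, so it cannot use loops at two vertices.
    closings-loops : ∀ N u i j → i ≢ j → (i , i) ∈ˡ u → (j , j) ∈ˡ u →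
      (∀ {x y} → (x , y) ∈ˡ u → x ≡ y) → closings N u ≈ 0#
    closings-loops N u i j i≢j ii∈ jj∈ loops = closings-zero N u λ p w W w↭u →
      let base = loops-walk W (λ xy∈w → loops (∈-resp-↭ w↭u xy∈w))
      in  i≢j (≡.trans (base (∈-resp-↭ (↭-sym w↭u) ii∈)) (≡.sym (base (∈-resp-↭ (↭-sym w↭u) jj∈))))

    ∈-arcs : ∀ {p} i (γ : Vec (Fin n) p) {x y} → (x , y) ∈ˡ arcs i γ → x ≡ i
    ∈-arcs i (j ∷ γ) (here ≡.refl) = ≡.refl
    ∈-arcs i (j ∷ γ) (there xy∈)   = ∈-arcs i γ xy∈

    arcs-replicate : ∀ p i → arcs i (Vec.replicate p i) ≡ List.replicate p (i , i)
    arcs-replicate zero    i = ≡.refl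
    arcs-replicate (suc p) i = cong ((i , i) ∷_) (arcs-replicate p i)

    arcs-escape : ∀ {p} i (γ : Vec (Fin n) p) → γ ≢ Vec.replicate p i →
      ∃[ y ] y ≢ i × (i , y) ∈ˡ arcs i γ
    arcs-escape i []      γ≢ = contradiction ≡.refl γ≢
    arcs-escape i (j ∷ γ) γ≢ with j ≟ i
    ... | no j≢i = j , j≢i , here ≡.refl
    ... | yes ≡.refl with arcs-escape i γ (γ≢ ∘ cong (i ∷_))
    ...   | y , y≢i , iy∈ = y , y≢i , there iy∈

    ⨁-cartesian : ∀ {a b d} {X : Set a} {Y : Set b} {Z : Set d} (h : X → Y → Z) xs ys f →
      ⨁ (cartesianProductWith h xs ys) f ≈ ⨁ xs (λ x → ⨁ ys (f ∘ h x))
    ⨁-cartesian h []       ys f = refl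
    ⨁-cartesian h (x ∷ xs) ys f = trans (⨁-++ (map (h x) ys) _ f)
      (+-cong (⨁-map (h x) ys f) (⨁-cartesian h xs ys f))

    ⨁-words : ∀ p (f : Vec (Fin n) p → Carrier) γ → (∀ δ → δ ≢ γ → f δ ≈ 0#) →
      ⨁ (words n p) f ≈ f γ
    ⨁-words zero    f []      f≈0 = +-identityʳ _
    ⨁-words (suc p) f (i ∷ γ) f≈0 = begin
      ⨁ (words n (suc p)) f
        ≈⟨ ⨁-cartesian _∷_ (allFin n) (words n p) f ⟩
      ⨁ (allFin n) (λ j → ⨁ (words n p) (f ∘ (j ∷_)))
        ≈⟨ ⨁-single n _ i (λ j j≢i → ⨁-zero (words n p) λ δ _ → f≈0 _ λ { ≡.refl → j≢i ≡.refl }) ⟩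
      ⨁ (words n p) (f ∘ (i ∷_))
        ≈⟨ ⨁-words p (f ∘ (i ∷_)) γ (λ δ δ≢γ → f≈0 _ λ { ≡.refl → δ≢γ ≡.refl }) ⟩
      f (i ∷ γ) ∎

  module _ {n K : ℕ} (T : Tensor F (suc K) n) where
    open Indeterminates F n

    infix 4 _∼_
    -- Equality as seen by every functional. It suffices, as the constant term is the pairing with
    -- `ε` and `𝒟` transposes to functionals.
    _∼_ : Poly → Poly → Set _
    p ∼ q = ∀ φ → ev φ p ≈ ev φ q

    ev-𝒟 : ∀ φ i p → ev φ (𝒟 {suc K} T i p) ≈ ⨁ (words n K) (λ γ → T i γ * ev (φ ◀ arcs i γ) p)
    ev-𝒟 φ i p = trans (⨁-concatMap _ (words n K) _) (⨁-cong (words n K) λ γ →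
      trans (ev-∙ φ (T i γ) (∂[ i , γ ] p)) (*-congˡ (ev-∂[] φ i γ p)))

    operator : ℕ → Fin n → Poly → Poly
    operator d i q = (1/ (d ℕ.* K) !) ∙ fold q (𝒟 {suc K} T i) d

    fold-cong : ∀ d i p q → p ∼ q → fold p (𝒟 {suc K} T i) d ∼ fold q (𝒟 {suc K} T i) d
    fold-cong zero    i p q p∼q φ = p∼q φ
    fold-cong (suc d) i p q p∼q φ = trans (ev-𝒟 φ i _) (trans
      (⨁-cong (words n K) λ γ → *-congˡ (fold-cong d i p q p∼q (φ ◀ arcs i γ))) (sym (ev-𝒟 φ i _)))

    operator-cong : ∀ d i p q → p ∼ q → operator d i p ∼ operator d i q
    operator-cong d i p q p∼q φ = trans (ev-∙ φ _ (fold p _ d))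
      (trans (*-congˡ (fold-cong d i p q p∼q φ)) (sym (ev-∙ φ _ (fold q _ d))))

    1/0! : 1/ 0 ! ≈ 1#
    1/0! = trans (sym (*-identityˡ _)) (trans (*-congʳ (sym (×-homo-1 1#))) (reciprocal-inverse 1))

    operator-zero : ∀ i p → operator 0 i p ∼ p
    operator-zero i p φ = trans (ev-∙ φ _ p) (trans (*-congʳ 1/0!) (*-identityˡ _))

    -- The map g sends the m remaining coordinates to vertices, so that an induction can run over m
    -- while the matrix keeps its size n.
    operators : ∀ {m} → Vec ℕ m → (Fin m → Fin n) → Poly → Poly
    operators []       g q = q
    operators (d ∷ ds) g q = operator d (g zero) (operators ds (g ∘ suc) q)

    foldr-operators : ∀ {m} (ds : Vec ℕ m) g q →
      foldr (λ i → operator (Vec.lookup ds i) (g i)) q (allFin m) ≡ operators ds g q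
    foldr-operators []       g q = ≡.refl
    foldr-operators {suc m} (d ∷ ds) g q = cong (operator d (g zero)) (≡.trans
      (cong (foldr (λ i → operator (Vec.lookup (d ∷ ds) i) (g i)) q) (≡.sym (map-tabulate id suc)))
      (≡.trans (foldr-map _ suc q (allFin m)) (foldr-operators ds (g ∘ suc) q)))

    -- In the inductions below L absorbs the operators that have already been peeled off, so it
    -- ranges over all maps that respect `∼`.
    Congruent : (Poly → Carrier) → Set _
    Congruent L = ∀ p q → p ∼ q → L p ≈ L q

    sum-compositions-0 : ∀ m g q L → Congruent L →
      ⨁ (compositions m 0) (λ ds → L (operators ds g q)) ≈ L q
    sum-compositions-0 zero    g q L Lc = +-identityʳ _
    sum-compositions-0 (suc m) g q L Lc = begin
      ⨁ (map (0 ∷_) (compositions m 0) ++ []) _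
        ≡⟨ cong (λ xs → ⨁ xs (λ ds → L (operators ds g q)))
          (++-identityʳ (map (0 ∷_) (compositions m 0))) ⟩
      ⨁ (map (0 ∷_) (compositions m 0)) _
        ≈⟨ ⨁-map (0 ∷_) (compositions m 0) _ ⟩
      ⨁ (compositions m 0) (λ ds → L (operator 0 (g zero) (operators ds (g ∘ suc) q)))
        ≈⟨ sum-compositions-0 m (g ∘ suc) q (L ∘ operator 0 (g zero))
          (λ p p′ → Lc _ _ ∘ operator-cong 0 (g zero) p p′) ⟩
      L (operator 0 (g zero) q)
        ≈⟨ Lc _ _ (operator-zero (g zero) q) ⟩
      L q ∎

    sum-compositions-1 : ∀ m g q L → Congruent L →
      ⨁ (compositions m 1) (λ ds → L (operators ds g q)) ≈
      ⨁ (allFin m) (λ i → L (operator 1 (g i) q))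
    sum-compositions-1 zero    g q L Lc = refl
    sum-compositions-1 (suc m) g q L Lc = begin
      ⨁ (concatMap (λ j → map (j ∷_) (compositions m (1 ℕ.∸ j))) (upTo 2)) f
        ≈⟨ ⨁-concatMap (λ j → map (j ∷_) (compositions m (1 ℕ.∸ j))) (upTo 2) f ⟩
      ⨁ (map (0 ∷_) (compositions m 1)) f + (⨁ (map (1 ∷_) (compositions m 0)) f + 0#)
        ≈⟨ +-cong (⨁-map (0 ∷_) (compositions m 1) f)
             (trans (+-identityʳ _) (⨁-map (1 ∷_) (compositions m 0) f)) ⟩
      ⨁ (compositions m 1) (f ∘ (0 ∷_)) + ⨁ (compositions m 0) (f ∘ (1 ∷_))
        ≈⟨ +-cong
             (trans (⨁-cong (compositions m 1) λ ds →
               Lc _ _ (operator-zero (g zero) (operators ds (g ∘ suc) q)))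
                    (sum-compositions-1 m (g ∘ suc) q L Lc))
             (sum-compositions-0 m (g ∘ suc) q (L ∘ operator 1 (g zero))
               (λ p p′ → Lc _ _ ∘ operator-cong 1 (g zero) p p′)) ⟩
      ⨁ (allFin m) (λ i → L (operator 1 (g (suc i)) q)) + L (operator 1 (g zero) q)
        ≈⟨ +-comm _ _ ⟩
      L (operator 1 (g zero) q) + ⨁ (allFin m) (λ i → L (operator 1 (g (suc i)) q))
        ≈⟨ ⨁-suc m _ ⟨
      ⨁ (allFin (suc m)) (λ i → L (operator 1 (g i) q)) ∎
      where
      f : Vec ℕ (suc m) → Carrier
      f ds = L (operators ds g q)

    -- The compositions of 2 are those with a single entry 2 and those with entries 1 at two places
    -- i < j. A first entry 0, 1 or 2 leaves the remainder 2, 1 or 0, and its operator is absorbed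
    -- into L.
    sum-compositions-2 : ∀ m g q L → Congruent L →
      ⨁ (compositions m 2) (λ ds → L (operators ds g q)) ≈
      ⨁ (allFin m) (λ i → L (operator 2 (g i) q)) +
      pairSum m (λ i j → L (operator 1 (g i) (operator 1 (g j) q)))
    sum-compositions-2 zero    g q L Lc = sym (+-identityˡ 0#)
    sum-compositions-2 (suc m) g q L Lc = begin
      ⨁ (concatMap (λ j → map (j ∷_) (compositions m (2 ℕ.∸ j))) (upTo 3)) f
        ≈⟨ ⨁-concatMap (λ j → map (j ∷_) (compositions m (2 ℕ.∸ j))) (upTo 3) f ⟩
      ⨁ (map (0 ∷_) (compositions m 2)) f + (⨁ (map (1 ∷_) (compositions m 1)) f
        + (⨁ (map (2 ∷_) (compositions m 0)) f + 0#))
        ≈⟨ +-cong (⨁-map (0 ∷_) (compositions m 2) f) (+-cong (⨁-map (1 ∷_) (compositions m 1) f)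
             (trans (+-identityʳ _) (⨁-map (2 ∷_) (compositions m 0) f))) ⟩
      ⨁ (compositions m 2) (f ∘ (0 ∷_)) + (⨁ (compositions m 1) (f ∘ (1 ∷_))
        + ⨁ (compositions m 0) (f ∘ (2 ∷_)))
        ≈⟨ +-cong
             (trans (⨁-cong (compositions m 2) λ ds →
               Lc _ _ (operator-zero (g zero) (operators ds (g ∘ suc) q)))
                    (sum-compositions-2 m (g ∘ suc) q L Lc))
             (+-cong
               (sum-compositions-1 m (g ∘ suc) q (L ∘ operator 1 (g zero))
                 (λ p p′ → Lc _ _ ∘ operator-cong 1 (g zero) p p′))
               (sum-compositions-0 m (g ∘ suc) q (L ∘ operator 2 (g zero))
                 (λ p p′ → Lc _ _ ∘ operator-cong 2 (g zero) p p′))) ⟩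
      (S₂ + P₂) + (P₁ + S₁) ≈⟨ +-comm _ _ ⟩
      (P₁ + S₁) + (S₂ + P₂) ≈⟨ +-congʳ (+-comm _ _) ⟩
      (S₁ + P₁) + (S₂ + P₂) ≈⟨ +-assoc _ _ _ ⟩
      S₁ + (P₁ + (S₂ + P₂)) ≈⟨ +-congˡ (+-assoc _ _ _) ⟨
      S₁ + (P₁ + S₂ + P₂)   ≈⟨ +-congˡ (+-congʳ (+-comm _ _)) ⟩
      S₁ + (S₂ + P₁ + P₂)   ≈⟨ +-congˡ (+-assoc _ _ _) ⟩
      S₁ + (S₂ + (P₁ + P₂)) ≈⟨ +-assoc _ _ _ ⟨
      S₁ + S₂ + (P₁ + P₂)   ≈⟨ +-congʳ (⨁-suc m _) ⟨
      ⨁ (allFin (suc m)) (λ i → L (operator 2 (g i) q)) + (P₁ + P₂) ∎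
      where
      f : Vec ℕ (suc m) → Carrier
      f ds = L (operators ds g q)
      S₁ = L (operator 2 (g zero) q)
      S₂ = ⨁ (allFin m) (λ i → L (operator 2 (g (suc i)) q))
      P₁ = ⨁ (allFin m) (λ j → L (operator 1 (g zero) (operator 1 (g (suc j)) q)))
      P₂ = pairSum m (λ i j → L (operator 1 (g (suc i)) (operator 1 (g (suc j)) q)))

-- The trace formula evaluated for d = 1 and d = 2

module LowTraces {c ℓ₁ ℓ₂} (F : OrderedField c ℓ₁ ℓ₂) where
  open OrderedField F hiding (zero)
  open Trace F
  open import Relation.Binary.Reasoning.Setoid setoid
  private module R = CommutativeRing commutativeRing
  open SemiringMult R.semiring using (×-congʳ)

  module _ {n : ℕ} where
    open Indeterminates F n

    walk-end : ∀ {p : Fin n} {w q x} → Walk p w q → x ∈ˡ w → ∃[ z ] (z , q) ∈ˡ w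
    walk-end (cons nil) _ = _ , here ≡.refl
    walk-end (cons W@(cons _)) _ with walk-end W (here ≡.refl)
    ... | z , zq∈ = z , there zq∈

    walk-previous : ∀ {p w q} {x y : Fin n} → Walk p w q → (x , y) ∈ˡ w → x ≡ p ⊎ (∃[ z ] (z , x) ∈ˡ w)
    walk-previous (cons W) (here ≡.refl) = inj₁ ≡.refl
    walk-previous (cons W) (there xy∈) with walk-previous W xy∈
    ... | inj₁ ≡.refl   = inj₂ (_ , here ≡.refl)
    ... | inj₂ (z , zx) = inj₂ (z , there zx)

    -- Dual to `closings-foreign`: a closed walk that leaves x must also enter x.
    closings-source : ∀ N u (x y : Fin n) → (x , y) ∈ˡ u → (∀ z → ¬ (z , x) ∈ˡ u) → closings N u ≈ 0#
    closings-source N u x y xy∈u x∉u = closings-zero N u λ p w W w↭u → no-target W w↭u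
      where
      no-target : ∀ {p : Fin n} {w} → Walk p w p → ¬ (w ↭ u)
      no-target W w↭u with ∈-resp-↭ (↭-sym w↭u) xy∈u
      ... | xy∈w with walk-previous W xy∈w
      ...   | inj₂ (z , zx∈w) = x∉u z (∈-resp-↭ w↭u zx∈w)
      ...   | inj₁ ≡.refl with walk-end W xy∈w
      ...     | z , zx∈w = x∉u z (∈-resp-↭ w↭u zx∈w)

    ev-A^1 : ∀ φ p q → ev φ ((A^ 1) p q) ≈ φ ((p , q) ∷ [])
    ev-A^1 φ p q = trans (ev-A^suc φ 0 p q) (trans
      (⨁-single n _ q off-diagonal) empty)
      where
      off-diagonal : ∀ l → l ≢ q → ev (λ w → φ ((p , l) ∷ w)) ((A^ 0) l q) ≈ 0#
      off-diagonal l l≢q with l ≟ q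
      ... | yes l≡q = contradiction l≡q l≢q
      ... | no _    = refl
      empty : ev (λ w → φ ((p , q) ∷ w)) ((A^ 0) q q) ≈ φ ((p , q) ∷ [])
      empty with q ≟ q
      ... | yes _  = trans (+-identityʳ _) (*-identityˡ _)
      ... | no q≢q = contradiction ≡.refl q≢q

    -- The only walks are i j i and j i j, one for each root, and each matches the two distinct arcs
    -- in exactly one way.
    closings-digon : ∀ i j → i ≢ j → closings 2 ((i , j) ∷ (j , i) ∷ []) ≈ 1# + 1#
    closings-digon i j i≢j = begin
      closings 2 u
        ≈⟨ ev-tr φ 2 ⟩
      ⨁ (allFin n) (λ p → ev φ ((A^ 2) p p))
        ≈⟨ ⨁-cong (allFin n) (λ p → trans (ev-A^suc φ 1 p p)
             (⨁-cong (allFin n) λ q → ev-A^1 (λ w → φ ((p , q) ∷ w)) q p)) ⟩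
      ⨁ (allFin n) (λ p → ⨁ (allFin n) (walk p))
        ≈⟨ ⨁-pair n _ i j i≢j (λ p p≢i p≢j → ⨁-zero (allFin n) λ q _ →
             vanish p q (λ { ≡.refl → p≢i ≡.refl }) λ { ≡.refl → p≢j ≡.refl }) ⟩
      ⨁ (allFin n) (walk i) + ⨁ (allFin n) (walk j)
        ≈⟨ +-cong
             (⨁-single n (walk i) j λ q q≢j →
               vanish i q (λ { ≡.refl → q≢j ≡.refl }) λ { ≡.refl → i≢j ≡.refl })
             (⨁-single n (walk j) i λ q q≢i →
               vanish j q (λ { ≡.refl → i≢j ≡.refl }) λ { ≡.refl → q≢i ≡.refl }) ⟩
      walk i j + walk j i
        ≈⟨ +-cong
             (trans (remove-tail (j , i) (i , j) ((j , i) ∷ []) (ε ◁ (i , j)) ji≢ij)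
               (trans (remove-head (j , i) [] _) (trans (+-identityʳ _) last)))
             (trans (remove-head (j , i) ((i , j) ∷ []) (ε ◁ (i , j)))
               (trans (+-cong last (remove-tail (j , i) (i , j) [] _ ji≢ij)) (+-identityʳ _))) ⟩
      1# + 1# ∎
      where
      u = (i , j) ∷ (j , i) ∷ []
      φ = ε ◀ u
      walk : Fin n → Fin n → Carrier
      walk p q = φ ((p , q) ∷ (q , p) ∷ [])
      ji≢ij : (j , i) ≢ (i , j)
      ji≢ij eq = i≢j (cong proj₂ eq)
      last : (ε ◁ (i , j)) ((i , j) ∷ []) ≈ 1#
      last = trans (remove-head (i , j) [] ε) (+-identityʳ _)
      vanish : ∀ p q → (p , q) ≢ (i , j) → (p , q) ≢ (j , i) → walk p q ≈ 0#
      vanish p q ≢ij ≢ji with supported-ε u ((p , q) ∷ (q , p) ∷ [])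
      ... | inj₁ z = z
      ... | inj₂ r with ∈-resp-↭ r (here ≡.refl)
      ...   | here eq         = contradiction eq ≢ij
      ...   | there (here eq) = contradiction eq ≢ji

    replicate? : ∀ {p} i (γ : Vec (Fin n) p) → Dec (γ ≡ Vec.replicate p i)
    replicate? {p} i γ = Vec-≡-dec _≟_ γ (Vec.replicate p i)

    -- All arcs of u leave i, so a letter of γ other than i would be a vertex that is entered and
    -- never left.
    closings-self : ∀ {p} N i (γ : Vec (Fin n) p) u → (∀ {x} → x ∈ˡ arcs i γ → x ∈ˡ u) →
      (∀ {x y} → (x , y) ∈ˡ u → x ≡ i) → γ ≢ Vec.replicate p i → closings N u ≈ 0#
    closings-self N i γ u ⊆u sources γ≢ with arcs-escape i γ γ≢
    ... | y , y≢i , iy∈ = closings-foreign N u i y (⊆u iy∈) (λ z yz∈ → y≢i (sources yz∈))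

  module _ {n K : ℕ} (T : Tensor F (suc (suc K)) n) where
    open Indeterminates F n

    private
      k-1 = suc K

    diagonal : Fin n → Carrier
    diagonal i = T i (Vec.replicate k-1 i)

    -- The summand of the second trace with dᵢ = dⱼ = 1.
    pairTerm : Fin n → Fin n → Carrier
    pairTerm i j = ev ε (operator T 1 i (operator T 1 j (tr (A^ (2 ℕ.* k-1)))))

    term≈ev : ∀ q ds →
      constantTerm (foldr (λ i → operator T (Vec.lookup ds i) i) q (allFin n)) ≈ ev ε
        (operators T ds id q)
    term≈ev q ds = trans (constantTerm≈ev (foldr (λ i → operator T (Vec.lookup ds i) i) q (allFin n)))
      (reflexive (cong (ev ε) (foldr-operators T ds id q)))

    reciprocal-cancel : ∀ N x → (1/ N !) * (x * ((N !) · 1#)) ≈ x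
    reciprocal-cancel N x = begin
      (1/ N !) * (x * ((N !) · 1#)) ≈⟨ *-comm _ _ ⟩
      x * ((N !) · 1#) * (1/ N !)   ≈⟨ *-assoc _ _ _ ⟩
      x * (((N !) · 1#) * (1/ N !)) ≈⟨ *-congˡ (reciprocal-inverse (N !) {{N ℕₚ.!≢0}}) ⟩
      x * 1#                        ≈⟨ *-identityʳ x ⟩
      x                             ∎

    -- The exponent d(k-1) of the formula and the number of arcs agree only propositionally, so the
    -- arcs are given through an equation.
    closings-loop′ : ∀ N (i : Fin n) u → N ≢ 0 → u ≡ List.replicate N (i , i) →
      closings N u ≈ (N !) · 1#
    closings-loop′ zero    i u N≢0 eq = contradiction ≡.refl N≢0
    closings-loop′ (suc N) i u N≢0 ≡.refl = closings-loop N i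

    ev-operator-1 : ∀ φ i p → ev φ (operator T 1 i p) ≈
      (1/ (1 ℕ.* k-1) !) * ⨁ (words n k-1) (λ γ → T i γ * ev (φ ◀ arcs i γ) p)
    ev-operator-1 φ i p = trans (ev-∙ φ _ (𝒟 {suc k-1} T i p)) (*-congˡ (ev-𝒟 T φ i p))

    operator-1-diagonal : ∀ i → ev ε (operator T 1 i (tr (A^ (1 ℕ.* k-1)))) ≈ diagonal i
    operator-1-diagonal i = begin
      ev ε (operator T 1 i (tr (A^ N)))
        ≈⟨ ev-operator-1 ε i _ ⟩
      (1/ N !) * ⨁ (words n k-1) (λ γ → T i γ * closings N (arcs i γ))
        ≈⟨ *-congˡ (⨁-words k-1 _ (Vec.replicate k-1 i) λ γ γ≢ → trans
             (*-congˡ (closings-self N i γ _ (λ x∈ → x∈) (∈-arcs i γ) γ≢)) (zeroʳ _)) ⟩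
      (1/ N !) * (diagonal i * closings N (arcs i (Vec.replicate k-1 i)))
        ≈⟨ *-congˡ (*-congˡ (closings-loop′ N i _ (λ ()) (≡.trans (arcs-replicate k-1 i)
             (cong (λ a → List.replicate a (i , i)) (≡.sym (ℕₚ.*-identityˡ k-1)))))) ⟩
      (1/ N !) * (diagonal i * ((N !) · 1#))
        ≈⟨ reciprocal-cancel N _ ⟩
      diagonal i ∎
      where N = 1 ℕ.* k-1

    -- Both words must be constantly i, and the (2(k-1))! closings cancel the prefactor.
    operator-2-diagonal : ∀ i → ev ε (operator T 2 i (tr (A^ (2 ℕ.* k-1)))) ≈ diagonal i * diagonal i
    operator-2-diagonal i = begin
      ev ε (operator T 2 i (tr (A^ N)))
        ≈⟨ trans (ev-∙ ε _ (𝒟 {suc k-1} T i (𝒟 {suc k-1} T i (tr (A^ N)))))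
          (*-congˡ (trans (ev-𝒟 T ε i _)
             (⨁-cong (words n k-1) λ γ → *-congˡ (trans (ev-𝒟 T _ i _) (⨁-cong (words n k-1) λ δ →
               *-congˡ (reflexive (cong (λ φ → ev φ (tr (A^ N))) (◀-++ ε (arcs i γ) (arcs i δ))))))))) ⟩
      (1/ N !) * ⨁ (words n k-1) (λ γ → T i γ * ⨁ (words n k-1) (λ δ →
        T i δ * closings N (arcs i γ ++ arcs i δ)))
        ≈⟨ *-congˡ (⨁-words k-1 _ (Vec.replicate k-1 i) λ γ γ≢ → trans
             (*-congˡ (⨁-zero (words n k-1) λ δ _ → trans (*-congˡ
               (closings-self N i γ _ ∈-++⁺ˡ (sources γ δ) γ≢)) (zeroʳ _))) (zeroʳ _)) ⟩
      (1/ N !) * (diagonal i * ⨁ (words n k-1) (λ δ →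
        T i δ * closings N (arcs i (Vec.replicate k-1 i) ++ arcs i δ)))
        ≈⟨ *-congˡ (*-congˡ (⨁-words k-1 _ (Vec.replicate k-1 i) λ δ δ≢ → trans (*-congˡ
             (closings-self N i δ (arcs i γ₀ ++ arcs i δ) (∈-++⁺ʳ (arcs i γ₀)) (sources γ₀ δ) δ≢))
               (zeroʳ _))) ⟩
      (1/ N !) * (diagonal i * (diagonal i * closings N u))
        ≈⟨ *-congˡ (trans (sym (*-assoc _ _ _)) (*-congˡ (closings-loop′ N i u (λ ()) u≡))) ⟩
      (1/ N !) * (diagonal i * diagonal i * ((N !) · 1#))
        ≈⟨ reciprocal-cancel N _ ⟩
      diagonal i * diagonal i ∎
      where
      N = 2 ℕ.* k-1
      γ₀ = Vec.replicate k-1 i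
      u = arcs i (Vec.replicate k-1 i) ++ arcs i (Vec.replicate k-1 i)
      sources : ∀ γ δ {x y} → (x , y) ∈ˡ arcs i γ ++ arcs i δ → x ≡ i
      sources γ δ xy∈ with ∈-++⁻ (arcs i γ) xy∈
      ... | inj₁ ∈γ = ∈-arcs i γ ∈γ
      ... | inj₂ ∈δ = ∈-arcs i δ ∈δ
      replicate-++ : ∀ a b (x : Var) →
        List.replicate a x ++ List.replicate b x ≡ List.replicate (a ℕ.+ b) x
      replicate-++ zero    b x = ≡.refl
      replicate-++ (suc a) b x = cong (x ∷_) (replicate-++ a b x)
      u≡ : u ≡ List.replicate N (i , i)
      u≡ = ≡.trans (≡.cong₂ _++_ (arcs-replicate k-1 i) (arcs-replicate k-1 i)) (≡.trans
        (replicate-++ k-1 k-1 (i , i))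
          (cong (λ a → List.replicate (k-1 ℕ.+ a) (i , i)) (≡.sym (ℕₚ.+-identityʳ k-1))))

    Tr-1 : Tr F {suc k-1} 1 T ≈ (k-1 ℕ.^ (n ∸ 1)) · ⨁ (allFin n) diagonal
    Tr-1 = ×-congʳ (k-1 ℕ.^ (n ∸ 1)) (trans (⨁-cong (compositions n 1) (term≈ev (tr (A^ (1 ℕ.* k-1)))))
      (trans (sum-compositions-1 T n id _ (ev ε) (λ _ _ p∼q → p∼q ε))
             (⨁-cong (allFin n) operator-1-diagonal)))

    Tr-2 : Tr F {suc k-1} 2 T ≈ (k-1 ℕ.^ (n ∸ 1)) ·
      (⨁ (allFin n) (λ i → diagonal i * diagonal i) + pairSum n pairTerm)
    Tr-2 = ×-congʳ (k-1 ℕ.^ (n ∸ 1)) (trans (⨁-cong (compositions n 2) (term≈ev (tr (A^ (2 ℕ.* k-1)))))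
      (trans (sum-compositions-2 T n id _ (ev ε) (λ _ _ p∼q → p∼q ε))
             (+-congʳ (⨁-cong (allFin n) operator-2-diagonal))))

    pairTerm-expand : ∀ i j → pairTerm i j ≈
      (1/ (1 ℕ.* k-1) !) * ⨁ (words n k-1) (λ γ → T i γ * ((1/ (1 ℕ.* k-1) !) *
        ⨁ (words n k-1) (λ δ → T j δ * closings (2 ℕ.* k-1) (arcs i γ ++ arcs j δ))))
    pairTerm-expand i j = trans (ev-operator-1 ε i _) (*-congˡ (⨁-cong (words n k-1) λ γ → *-congˡ
      (trans (ev-operator-1 _ j _) (*-congˡ (⨁-cong (words n k-1) λ δ → *-congˡ
        (reflexive (cong (λ φ → ev φ (tr (A^ (2 ℕ.* k-1)))) (◀-++ ε (arcs i γ) (arcs j δ)))))))))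

-- Degrees and incidences

module Counting where
  open import Data.Fin.Subset using (_-_)
  open import Data.Nat hiding (_≟_)
  open import Data.Nat.Properties hiding (_≟_)
  open import Relation.Binary.PropositionalEquality

  module Σℕ = Sums +-*-commutativeSemiring
  open Σℕ using () renaming (⨁ to ∑ℕ) public

  𝟙 : ∀ {a} {A : Set a} → Dec A → ℕ
  𝟙 (yes _) = 1
  𝟙 (no _)  = 0

  𝟙-yes : ∀ {a} {A : Set a} (d : Dec A) → A → 𝟙 d ≡ 1
  𝟙-yes (yes _) _ = refl
  𝟙-yes (no ¬a) a = contradiction a ¬a

  𝟙-no : ∀ {a} {A : Set a} (d : Dec A) → ¬ A → 𝟙 d ≡ 0
  𝟙-no (yes a) ¬a = contradiction a ¬a
  𝟙-no (no _)  _  = refl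

  𝟙≤1 : ∀ {a} {A : Set a} (d : Dec A) → 𝟙 d ≤ 1
  𝟙≤1 (yes _) = s≤s z≤n
  𝟙≤1 (no _)  = z≤n

  𝟙-idem : ∀ {a} {A : Set a} (d : Dec A) → 𝟙 d * 𝟙 d ≡ 𝟙 d
  𝟙-idem (yes _) = refl
  𝟙-idem (no _)  = refl

  𝟙-cong : ∀ {a b} {A : Set a} {B : Set b} (d : Dec A) (d′ : Dec B) → (A → B) → (B → A) → 𝟙 d ≡ 𝟙 d′
  𝟙-cong (yes a) d′ f g = sym (𝟙-yes d′ (f a))
  𝟙-cong (no ¬a) d′ f g = sym (𝟙-no d′ (¬a ∘ g))

  length-filter≡∑ : ∀ {a p} {A : Set a} {P : A → Set p} (P? : Decidable P) xs →
    length (filter P? xs) ≡ ∑ℕ xs (λ x → 𝟙 (P? x))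
  length-filter≡∑ P? []       = refl
  length-filter≡∑ P? (x ∷ xs) with P? x
  ... | yes _ = cong suc (length-filter≡∑ P? xs)
  ... | no _  = length-filter≡∑ P? xs

  ∑ℕ-const : ∀ {a} {A : Set a} (xs : List A) s → ∑ℕ xs (λ _ → s) ≡ length xs * s
  ∑ℕ-const []       s = refl
  ∑ℕ-const (x ∷ xs) s = cong (s +_) (∑ℕ-const xs s)

  ∑ℕ-mono : ∀ {a} {A : Set a} (xs : List A) {f g : A → ℕ} →
    (∀ x → x ∈ˡ xs → f x ≤ g x) → ∑ℕ xs f ≤ ∑ℕ xs g
  ∑ℕ-mono []       f≤g = z≤n
  ∑ℕ-mono (x ∷ xs) f≤g = +-mono-≤ (f≤g x (here refl)) (∑ℕ-mono xs (λ y → f≤g y ∘ there))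

  length-allFin : ∀ n → length (allFin n) ≡ n
  length-allFin n = length-tabulate {n = n} id

  ∣p∣≡∑ : ∀ {n} (p : Subset n) → ∣ p ∣ ≡ ∑ℕ (allFin n) (λ v → 𝟙 (v ∈? p))
  ∣p∣≡∑ []                  = refl
  ∣p∣≡∑ {suc n} (inside ∷ p)  = sym (trans (Σℕ.⨁-suc n (λ v → 𝟙 (v ∈? inside ∷ p)))
    (cong suc (trans (Σℕ.⨁-cong (allFin n) λ v →
      𝟙-cong (suc v ∈? inside ∷ p) (v ∈? p) (λ { (there v∈) → v∈ }) there)
      (sym (∣p∣≡∑ p)))))
  ∣p∣≡∑ {suc n} (outside ∷ p) = sym (trans (Σℕ.⨁-suc n (λ v → 𝟙 (v ∈? outside ∷ p)))
    (trans (Σℕ.⨁-cong (allFin n) λ v →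
      𝟙-cong (suc v ∈? outside ∷ p) (v ∈? p) (λ { (there v∈) → v∈ }) there)
      (sym (∣p∣≡∑ p))))

  two-members : ∀ {n} {p : Subset n} {i j} → i ≢ j → i ∈ p → j ∈ p → 2 ≤ ∣ p ∣
  two-members {p = p} {i} {j} i≢j i∈p j∈p = <-≤-trans
    (s≤s (≤-<-trans z≤n (x∈p⇒∣p-x∣<∣p∣ (x∈p∧x≢y⇒x∈p-y j∈p (i≢j ∘ sym))))) (x∈p⇒∣p-x∣<∣p∣ i∈p)

  three-members : ∀ {n} {p : Subset n} {i j l} → i ≢ j → i ≢ l → j ≢ l →
    i ∈ p → j ∈ p → l ∈ p → 3 ≤ ∣ p ∣
  three-members {p = p} {i} {j} {l} i≢j i≢l j≢l i∈p j∈p l∈p = <-≤-trans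
    (s≤s (two-members j≢l (x∈p∧x≢y⇒x∈p-y j∈p (i≢j ∘ sym)) (x∈p∧x≢y⇒x∈p-y l∈p (i≢l ∘ sym))))
    (x∈p⇒∣p-x∣<∣p∣ i∈p)

  ∣p∣≤1 : ∀ {n} {p : Subset n} {i} → (∀ {x} → x ∈ p → x ≡ i) → ∣ p ∣ ≤ 1
  ∣p∣≤1 {n} {p} {i} p⊆ =
    subst (_≤ 1) (sym (trans (∣p∣≡∑ p) (Σℕ.⨁-single n _ i λ j j≢i → 𝟙-no (j ∈? p) (j≢i ∘ p⊆))))
    (𝟙≤1 (i ∈? p))

  ∣p∣≤2 : ∀ {n} {p : Subset n} {i j} → (∀ {x} → x ∈ p → x ≡ i ⊎ x ≡ j) → ∣ p ∣ ≤ 2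
  ∣p∣≤2 {n} {p} {i} {j} p⊆ with i ≟ j
  ... | yes refl = m≤n⇒m≤1+n (∣p∣≤1 (λ x∈p → case-≡ (p⊆ x∈p)))
    where
    case-≡ : ∀ {x} → x ≡ i ⊎ x ≡ i → x ≡ i
    case-≡ (inj₁ eq) = eq
    case-≡ (inj₂ eq) = eq
  ... | no i≢j = subst (_≤ 2)
    (sym (trans (∣p∣≡∑ p)
    (Σℕ.⨁-pair n _ i j i≢j λ l l≢i l≢j → 𝟙-no (l ∈? p) λ l∈p → neither l≢i l≢j (p⊆ l∈p))))
    (+-mono-≤ (𝟙≤1 (i ∈? p)) (𝟙≤1 (j ∈? p)))
    where
    neither : ∀ {l} → l ≢ i → l ≢ j → ¬ (l ≡ i ⊎ l ≡ j)
    neither l≢i l≢j (inj₁ eq) = l≢i eq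
    neither l≢i l≢j (inj₂ eq) = l≢j eq

  linear-unique : ∀ {H} → Linear H → ∀ {e f u v} → u ≢ v →
    u ∈ edge H e → v ∈ edge H e → u ∈ edge H f → v ∈ edge H f → e ≡ f
  linear-unique lin {e} {f} u≢v u∈e v∈e u∈f v∈f with e ≟ f
  ... | yes e≡f = e≡f
  ... | no e≢f  = contradiction (lin e f e≢f)
    (<⇒≱ (two-members u≢v (x∈p∩q⁺ (u∈e , u∈f)) (x∈p∩q⁺ (v∈e , v∈f))))

  module _ (H : Hypergraph) where

    incidence : Vertex H → Edge H → ℕ
    incidence v e = 𝟙 (v ∈? edge H e)

    degree≡∑ : ∀ v → degree H v ≡ ∑ℕ (allFin (size H)) (incidence v)
    degree≡∑ v = length-filter≡∑ (λ e → v ∈? edge H e) (allFin (size H))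

    handshake : ∀ {k} → Uniform k H → ∑ℕ (allFin (order H)) (degree H) ≡ size H * k
    handshake {k} uniform = begin
      ∑ℕ (allFin (order H)) (degree H)
        ≡⟨ Σℕ.⨁-cong (allFin (order H)) degree≡∑ ⟩
      ∑ℕ (allFin (order H)) (λ v → ∑ℕ (allFin (size H)) (incidence v))
        ≡⟨ Σℕ.⨁-swap (allFin (order H)) (allFin (size H)) incidence ⟩
      ∑ℕ (allFin (size H)) (λ e → ∑ℕ (allFin (order H)) (λ v → incidence v e))
        ≡⟨ Σℕ.⨁-cong (allFin (size H)) (λ e → trans (sym (∣p∣≡∑ (edge H e))) (uniform e)) ⟩
      ∑ℕ (allFin (size H)) (λ _ → k)
        ≡⟨ ∑ℕ-const (allFin (size H)) k ⟩
      length (allFin (size H)) * k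
        ≡⟨ cong (_* k) (length-allFin (size H)) ⟩
      size H * k ∎
      where open ≡-Reasoning

open Counting

-- The traces of orders 1 and 2 of A_α

module AlphaTensor {c ℓ₁ ℓ₂} (F : OrderedField c ℓ₁ ℓ₂) where
  open OrderedField F hiding (zero; _#_)
  open Trace F
  open LowTraces F
  open import Relation.Binary.Reasoning.Setoid setoid
  private module R = CommutativeRing commutativeRing
  open SemiringMult R.semiring using (×-congʳ; ×-homo-+; ×1-homo-*)

  ∑ℕ·1# : ∀ {a} {A : Set a} (xs : List A) f → ∑ℕ xs f · 1# ≈ ⨁ xs (λ x → f x · 1#)
  ∑ℕ·1# []       f = refl
  ∑ℕ·1# (x ∷ xs) f = trans (×-homo-+ 1# (f x) (∑ℕ xs f)) (+-congˡ (∑ℕ·1# xs f))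

  pairSum·1# : ∀ m f → Σℕ.pairSum m f · 1# ≈ pairSum m (λ i j → f i j · 1#)
  pairSum·1# zero    f = refl
  pairSum·1# (suc m) f = trans (×-homo-+ 1# (∑ℕ (allFin m) (f zero ∘ suc)) _)
    (+-cong (∑ℕ·1# (allFin m) _) (pairSum·1# m _))

  module _ (K : ℕ) (H : Hypergraph) (α : Carrier) where

    private
      k : ℕ
      k = suc (suc K)
      n = order H
      T = Aα-tensor F k H α

    ∈⟦⟧ : ∀ {p} {P : Fin n → Set} {γ : Vec (Fin n) p} → All P γ → ∀ {x} → x ∈ ⟦_⟧ F k H γ → P x
    ∈⟦⟧ {γ = []}    []         x∈ = contradiction x∈ ∉⊥
    ∈⟦⟧ {γ = j ∷ γ} (pj ∷ pγ) x∈ with x∈p∪q⁻ _ _ x∈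
    ... | inj₁ x∈j = subst _ (≡.sym (x∈⁅y⁆⇒x≡y j x∈j)) pj
    ... | inj₂ x∈γ = ∈⟦⟧ pγ x∈γ

    adjacency-zero : ∀ i (γ : Vec (Fin n) (suc K)) → (∀ e → edge H e ≢ ⟦_⟧ F k H (i ∷ γ)) →
      adjacencyTensor F k H i γ ≈ 0#
    adjacency-zero i γ ≢edge with any? (λ e → Vec-≡-dec _≟ᵇ_ (edge H e) (⟦_⟧ F k H (i Vec.∷ γ)))
    ... | yes (e , eq) = contradiction eq (≢edge e)
    ... | no _         = refl

    degreeTensor-zero : ∀ i (γ : Vec (Fin n) (suc K)) → ¬ All (i ≡_) γ → degreeTensor F k H i γ ≈ 0#
    degreeTensor-zero i γ ¬all with All.all? (i ≟_) γ
    ... | yes all = contradiction all ¬all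
    ... | no _    = refl

    all-equal : ∀ {p} (i : Fin n) → All (i ≡_) (Vec.replicate p i)
    all-equal {zero}  i = []
    all-equal {suc p} i = ≡.refl ∷ all-equal i

    all-equal⁻ : ∀ {p} (i : Fin n) {γ : Vec (Fin n) p} → All (i ≡_) γ → γ ≡ Vec.replicate p i
    all-equal⁻ i []              = ≡.refl
    all-equal⁻ i (≡.refl ∷ all) = cong (i ∷_) (all-equal⁻ i all)

    degreeTensor-diagonal : ∀ i → degreeTensor F k H i (Vec.replicate (suc K) i) ≈ degree H i · 1#
    degreeTensor-diagonal i with All.all? (i ≟_) (Vec.replicate (suc K) i)
    ... | yes _   = refl
    ... | no ¬all = contradiction (all-equal i) ¬all

    module _ (uniform : Uniform k H) where

      -- The indices i, ..., i span a single vertex while a hyperedge has k ≥ 2 of them, so the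
      -- adjacency part contributes nothing.
      diagonal≈ : ∀ i → diagonal T i ≈ α * (degree H i · 1#)
      diagonal≈ i = trans (+-cong (*-congˡ (degreeTensor-diagonal i)) (trans (*-congˡ
        (adjacency-zero i _ λ e eq → contradiction
          (∣p∣≤1 {i = i} λ x∈ → ≡.sym (∈⟦⟧ {P = i ≡_} (all-equal {suc (suc K)} i) (subst (_ ∈_) eq x∈)))
          (ℕₚ.<⇒≱ (subst (2 ℕ.≤_) (≡.sym (uniform e)) (ℕ.s≤s (ℕ.s≤s ℕ.z≤n)))))) (zeroʳ _)))
            (+-identityʳ _)

      private
        In : Fin n → Fin n → Fin n → Set
        In i j x = x ≡ i ⊎ x ≡ j

        in? : ∀ i j x → Dec (In i j x)
        in? i j x = (x ≟ i) ⊎-dec (x ≟ j)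

      -- For k ≥ 3 no hyperedge fits into {i, j}, and off the diagonal the degree tensor vanishes.
      entry-zero : 1 ℕ.≤ K → ∀ i j γ → All (In i j) γ → In i j i → γ ≢ Vec.replicate (suc K) i →
        T i γ ≈ 0#
      entry-zero 1≤K i j γ γ⊆ i∈ γ≢ = trans (+-cong
        (trans (*-congˡ (degreeTensor-zero i γ (γ≢ ∘ all-equal⁻ i))) (zeroʳ α))
        (trans (*-congˡ (adjacency-zero i γ λ e eq → contradiction
          (∣p∣≤2 {i = i} {j} λ x∈ → ∈⟦⟧ {P = In i j} (i∈ ∷ γ⊆) (subst (_ ∈_) eq x∈))
          (ℕₚ.<⇒≱ (subst (3 ℕ.≤_) (≡.sym (uniform e)) (ℕ.s≤s (ℕ.s≤s 1≤K)))))) (zeroʳ _)))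
        (+-identityˡ 0#)

      foreign-letter : ∀ {p} i j a (γ : Vec (Fin n) p) → ¬ All (In i j) γ →
        ∃[ y ] ¬ In i j y × (a , y) ∈ˡ arcs {n = n} a γ
      foreign-letter i j a []      ¬all = contradiction [] ¬all
      foreign-letter i j a (x ∷ γ) ¬all with in? i j x
      ... | no ¬x = x , ¬x , here ≡.refl
      ... | yes px with foreign-letter i j a γ (¬all ∘ (px ∷_))
      ...   | y , ¬y , ay∈ = y , ¬y , there ay∈

      sources : ∀ {p q} i j (γ : Vec (Fin n) p) (δ : Vec (Fin n) q) {x y} →
        (x , y) ∈ˡ arcs i γ ++ arcs j δ → In i j x
      sources i j γ δ xy∈ with ∈-++⁻ (arcs i γ) xy∈
      ... | inj₁ ∈γ = inj₁ (∈-arcs i γ ∈γ)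
      ... | inj₂ ∈δ = inj₂ (∈-arcs j δ ∈δ)

      closings-foreignˡ : ∀ N i j (γ δ : Vec (Fin n) (suc K)) → ¬ All (In i j) γ →
        closings N (arcs i γ ++ arcs j δ) ≈ 0#
      closings-foreignˡ N i j γ δ ¬all with foreign-letter i j i γ ¬all
      ... | y , ¬y , iy∈ = closings-foreign N _ i y (∈-++⁺ˡ iy∈) (λ z yz∈ → ¬y (sources i j γ δ yz∈))

      closings-foreignʳ : ∀ N i j (γ δ : Vec (Fin n) (suc K)) → ¬ All (In i j) δ →
        closings N (arcs i γ ++ arcs j δ) ≈ 0#
      closings-foreignʳ N i j γ δ ¬all with foreign-letter i j j δ ¬all
      ... | y , ¬y , jy∈ =
        closings-foreign N _ j y (∈-++⁺ʳ (arcs i γ) jy∈) (λ z yz∈ → ¬y (sources i j γ δ yz∈))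

      closings-two-loops : ∀ N i j → i ≢ j →
        closings N (arcs i (Vec.replicate (suc K) i) ++ arcs j (Vec.replicate (suc K) j)) ≈ 0#
      closings-two-loops N i j i≢j = closings-loops N _ i j i≢j (here ≡.refl)
        (∈-++⁺ʳ (arcs i (Vec.replicate (suc K) i)) (here ≡.refl)) loops
        where
        loop : ∀ {p} a {x y} → (x , y) ∈ˡ arcs {n = n} a (Vec.replicate p a) → x ≡ y
        loop {suc p} a (here ≡.refl) = ≡.refl
        loop {suc p} a (there xy∈)   = loop {p} a xy∈
        loops : ∀ {x y} →
          (x , y) ∈ˡ arcs i (Vec.replicate (suc K) i) ++ arcs j (Vec.replicate (suc K) j) → x ≡ y
        loops xy∈ with ∈-++⁻ (arcs i (Vec.replicate (suc K) i)) xy∈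
        ... | inj₁ ∈i = loop {suc K} i ∈i
        ... | inj₂ ∈j = loop {suc K} j ∈j

      -- Either a letter outside {i, j} is a dead end, or a word is not constant and its entry
      -- vanishes, or both words are constant and their loops lie at two different vertices.
      pairTerm-zero : 1 ℕ.≤ K → ∀ i j → i ≢ j → pairTerm T i j ≈ 0#
      pairTerm-zero 1≤K i j i≢j = trans (pairTerm-expand T i j)
        (trans (*-congˡ (⨁-zero (words n (suc K)) λ γ _ → outer γ)) (zeroʳ _))
        where
        N = 2 ℕ.* suc K
        inner : ∀ γ → (∀ δ → T j δ * closings N (arcs i γ ++ arcs j δ) ≈ 0#) →
          T i γ * ((1/ (1 ℕ.* suc K) !) * ⨁ (words n (suc K))
            (λ δ → T j δ * closings N (arcs i γ ++ arcs j δ))) ≈ 0#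
        inner γ z = trans (*-congˡ (trans (*-congˡ (⨁-zero (words n (suc K)) λ δ _ → z δ)) (zeroʳ _)))
          (zeroʳ _)
        outer : ∀ γ → T i γ *
          ((1/ (1 ℕ.* suc K) !) * ⨁ (words n (suc K)) (λ δ → T j δ * closings N (arcs i γ ++ arcs j δ)))
          ≈ 0#
        outer γ with All.all? (in? i j) γ
        ... | no ¬all = inner γ λ δ → trans (*-congˡ (closings-foreignˡ N i j γ δ ¬all)) (zeroʳ _)
        ... | yes γ⊆ with replicate? i γ
        ...   | no γ≢      = trans (*-congʳ (entry-zero 1≤K i j γ γ⊆ (inj₁ ≡.refl) γ≢)) (zeroˡ _)
        ...   | yes ≡.refl = inner γ second
          where
          second : ∀ δ → T j δ * closings N (arcs i (Vec.replicate (suc K) i) ++ arcs j δ) ≈ 0#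
          second δ with All.all? (in? i j) δ
          ... | no ¬all = trans (*-congˡ (closings-foreignʳ N i j (Vec.replicate (suc K) i) δ ¬all))
            (zeroʳ _)
          ... | yes δ⊆ with replicate? j δ
          ...   | no δ≢      =
            trans (*-congʳ (entry-zero 1≤K j i δ (All.map Sum.swap δ⊆) (inj₁ ≡.refl) δ≢)) (zeroˡ _)
          ...   | yes ≡.refl = trans (*-congˡ (closings-two-loops N i j i≢j)) (zeroʳ _)

      Tr-1-Aα : Tr F {k} 1 T ≈
        (suc K ℕ.^ (n ∸ 1)) · (α * (∑ℕ (allFin n) (degree H) · 1#))
      Tr-1-Aα = trans (Tr-1 T) (×-congʳ (suc K ℕ.^ (n ∸ 1)) (trans (⨁-cong (allFin n) diagonal≈)
        (trans (⨁-*ˡ (allFin n) α _) (*-congˡ (sym (∑ℕ·1# (allFin n) (degree H)))))))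

      ∑-diagonal² : ⨁ (allFin n) (λ i → diagonal T i * diagonal T i) ≈
        α * α * (∑ℕ (allFin n) (λ i → degree H i ℕ.* degree H i) · 1#)
      ∑-diagonal² = trans (⨁-cong (allFin n) λ i → square (degree H i) (diagonal≈ i))
        (trans (⨁-*ˡ (allFin n) (α * α) _) (*-congˡ (sym (∑ℕ·1# (allFin n) _))))
        where
        square : ∀ {x} d → x ≈ α * (d · 1#) → x * x ≈ α * α * ((d ℕ.* d) · 1#)
        square {x} d x≈ = begin
          x * x                              ≈⟨ *-cong x≈ x≈ ⟩
          α * (d · 1#) * (α * (d · 1#))      ≈⟨ *-assoc _ _ _ ⟩
          α * ((d · 1#) * (α * (d · 1#)))    ≈⟨ *-congˡ (*-assoc _ _ _) ⟨
          α * ((d · 1#) * α * (d · 1#))      ≈⟨ *-congˡ (*-congʳ (*-comm _ _)) ⟩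
          α * (α * (d · 1#) * (d · 1#))      ≈⟨ *-congˡ (*-assoc _ _ _) ⟩
          α * (α * ((d · 1#) * (d · 1#)))    ≈⟨ *-assoc _ _ _ ⟨
          α * α * ((d · 1#) * (d · 1#))      ≈⟨ *-congˡ (×1-homo-* d d) ⟨
          α * α * ((d ℕ.* d) · 1#)           ∎

module AlphaTraces {c ℓ₁ ℓ₂} (F : OrderedField c ℓ₁ ℓ₂) where
  open OrderedField F hiding (zero; _#_)
  open Trace F
  open LowTraces F
  open AlphaTensor F
  open import Relation.Binary.Reasoning.Setoid setoid
  private module R = CommutativeRing commutativeRing
  open SemiringMult R.semiring using (×-homo-1; ×-congʳ)

  common : (H : Hypergraph) → Vertex H → Vertex H → ℕ
  common H i j = ∑ℕ (allFin (size H)) (λ e → incidence H i e ℕ.* incidence H j e)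

  pairSum-common : ∀ H → Uniform 2 H → Σℕ.pairSum (order H) (common H) ≡ size H
  pairSum-common H uniform = ≡.trans
    (Σℕ.pairSum-⨁ (order H) (allFin (size H)) (λ e i j → incidence H i e ℕ.* incidence H j e))
    (≡.trans (Σℕ.⨁-cong (allFin (size H)) one-pair) (≡.trans (∑ℕ-const (allFin (size H)) 1)
      (≡.trans (ℕₚ.*-identityʳ _) (length-allFin (size H)))))
    where
    one-pair : ∀ e → Σℕ.pairSum (order H) (λ i j → incidence H i e ℕ.* incidence H j e) ≡ 1
    -- An indicator x with ∑ x = 2 satisfies 4 = 2 + 2P by `⨁-square`, so P = 1.
    one-pair e = halve (ℕₚ.+-cancelˡ-≡ 2 (P ℕ.+ P) 2 (≡.trans (≡.sym
        (≡.trans (Σℕ.⨁-square (order H) x) (cong (ℕ._+ (P ℕ.+ P)) (≡.trans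
          (Σℕ.⨁-cong (allFin (order H)) λ v → 𝟙-idem (v ∈? edge H e)) ∑x≡2))))
        (≡.cong₂ ℕ._*_ ∑x≡2 ∑x≡2)))
      where
      x : Vertex H → ℕ
      x v = incidence H v e
      P = Σℕ.pairSum (order H) (λ i j → x i ℕ.* x j)
      ∑x≡2 : ∑ℕ (allFin (order H)) x ≡ 2
      ∑x≡2 = ≡.trans (≡.sym (∣p∣≡∑ (edge H e))) (uniform e)
      halve : ∀ {a} → a ℕ.+ a ≡ 2 → a ≡ 1
      halve {suc zero} _ = ≡.refl
      halve {suc (suc a)} eq with () ← ≡.trans (≡.sym (ℕₚ.+-suc a (suc a))) (cong (ℕ._∸ 2) eq)

  module Graph (H : Hypergraph) (α : Carrier) (uniform : Uniform 2 H) (linear : Linear H) where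

    private
      n : ℕ
      n = order H
      T = Aα-tensor F 2 H α

      -- Here r is the normalisation 1/1!, left unevaluated, s is the entry at an adjacent pair and
      -- t the value of `pairTerm` there, its factor 1 + 1 being the two closings of the digon.
      r s t : Carrier
      r = 1/ 1 !
      s = (1# - α) * r
      t = r * (s * (r * (s * (1# + 1#))))

    -- Unless x = j and y = i, one of i and j is left without being entered, or the arcs are two
    -- separate loops.
    closings-digon-zero : ∀ {i j : Fin n} x y → i ≢ j → (x ≢ j ⊎ y ≢ i) →
      closings 2 ((i , x) ∷ (j , y) ∷ []) ≈ 0#
    closings-digon-zero {i} {j} x₀ y₀ i≢j cross₀ = go x₀ y₀ cross₀
      where
      u : Fin n → Fin n → List (Fin n × Fin n)
      u x y = (i , x) ∷ (j , y) ∷ []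
      go : ∀ x y → x ≢ j ⊎ y ≢ i → closings 2 (u x y) ≈ 0#
      go x y cross with x ≟ j | y ≟ j
      ... | no x≢j | no y≢j = closings-source 2 (u x y) j y (there (here ≡.refl)) λ
        { z (here eq) → x≢j (≡.sym (cong proj₂ eq)) ; z (there (here eq)) →
          y≢j (≡.sym (cong proj₂ eq)) }
      ... | yes ≡.refl | _ = closings-source 2 (u x y) i x (here ≡.refl) λ
        { z (here eq) → i≢j (cong proj₂ eq)
        ; z (there (here eq)) →
          [ contradiction ≡.refl , (λ y≢i → y≢i (≡.sym (cong proj₂ eq))) ]′ cross }
      ... | no x≢j | yes ≡.refl with x ≟ i
      ...   | yes ≡.refl = closings-loops 2 (u x y) i j i≢j (here ≡.refl) (there (here ≡.refl)) λ
        { (here ≡.refl) → ≡.refl ; (there (here ≡.refl)) → ≡.refl }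
      ...   | no x≢i = closings-source 2 (u x y) i x (here ≡.refl) λ
        { z (here eq) → x≢i (≡.sym (cong proj₂ eq)) ; z (there (here eq)) → i≢j (cong proj₂ eq) }

    pairTerm-digon : ∀ i j → i ≢ j →
      pairTerm T i j ≈ r * (T i (j ∷ []) * (r * (T j (i ∷ []) * (1# + 1#))))
    pairTerm-digon i j i≢j = trans (pairTerm-expand T i j) (*-congˡ (trans
      (⨁-words 1 _ (j ∷ []) (λ { (x ∷ []) x≢j → trans (*-congˡ (trans (*-congˡ (⨁-zero (words n 1)
        λ { (y ∷ []) _ → trans (*-congˡ (closings-digon-zero x y i≢j (inj₁ (x≢j ∘ cong (_∷ [])))))
          (zeroʳ _) }))
        (zeroʳ _))) (zeroʳ _) }))
      (*-congˡ (*-congˡ (trans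
        (⨁-words 1 _ (i ∷ []) (λ { (y ∷ []) y≢i →
          trans (*-congˡ (closings-digon-zero j y i≢j (inj₂ (y≢i ∘ cong (_∷ []))))) (zeroʳ _) }))
        (*-congˡ (closings-digon i j i≢j)))))))

    pair-⊆ : ∀ {i j e} → i ≢ j → i ∈ edge H e → j ∈ edge H e →
      edge H e ≡ ⟦_⟧ F 2 H (i Vec.∷ j Vec.∷ Vec.[])
    pair-⊆ {i} {j} {e} i≢j i∈e j∈e = ⊆-antisym sub sup
      where
      sub : ∀ {x} → x ∈ edge H e → x ∈ ⟦_⟧ F 2 H (i Vec.∷ j Vec.∷ Vec.[])
      sub {x} x∈e with x ≟ i | x ≟ j
      ... | yes ≡.refl | _          = x∈p∪q⁺ (inj₁ (x∈⁅x⁆ x))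
      ... | no _       | yes ≡.refl = x∈p∪q⁺ (inj₂ (x∈p∪q⁺ (inj₁ (x∈⁅x⁆ x))))
      ... | no x≢i     | no x≢j     = contradiction (three-members x≢i x≢j i≢j x∈e i∈e j∈e)
        (ℕₚ.≤⇒≯ (ℕₚ.≤-reflexive (uniform e)))
      sup : ∀ {x} → x ∈ ⟦_⟧ F 2 H (i Vec.∷ j Vec.∷ Vec.[]) → x ∈ edge H e
      sup = ∈⟦⟧ 0 H α {P = _∈ edge H e} (i∈e ∷ j∈e ∷ [])

    -- Linearity allows at most one hyperedge through both i and j, so the adjacency entry, which
    -- only records existence, can be read off from the count `common`.
    entry-common : ∀ i j → i ≢ j →
      (common H i j ≡ 1 × T i (j ∷ []) ≈ s) ⊎ (common H i j ≡ 0 × T i (j ∷ []) ≈ 0#)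
    entry-common i j i≢j with any? (λ e → (i ∈? edge H e) ×-dec (j ∈? edge H e))
    ... | yes (e , i∈e , j∈e) = inj₁ (common≡1 , trans (+-cong (trans (*-congˡ
              (degreeTensor-zero 0 H α i (j ∷ []) λ { (i≡j ∷ []) → i≢j i≡j })) (zeroʳ _))
                (*-congˡ adjacency))
            (+-identityˡ _))
      where
      common≡1 : common H i j ≡ 1
      common≡1 = ≡.trans (Σℕ.⨁-single (size H) _ e other)
        (≡.cong₂ ℕ._*_ (𝟙-yes (i ∈? edge H e) i∈e) (𝟙-yes (j ∈? edge H e) j∈e))
        where
        other : ∀ f → f ≢ e → incidence H i f ℕ.* incidence H j f ≡ 0
        other f f≢e with i ∈? edge H f | j ∈? edge H f
        ... | no _    | _       = ≡.refl
        ... | yes _   | no _    = ≡.refl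
        ... | yes i∈f | yes j∈f = contradiction (linear-unique linear i≢j i∈f j∈f i∈e j∈e) f≢e
      adjacency : adjacencyTensor F 2 H i (j ∷ []) ≈ r
      adjacency with any? (λ e → Vec-≡-dec _≟ᵇ_ (edge H e) (⟦_⟧ F 2 H (i Vec.∷ j Vec.∷ Vec.[])))
      ... | yes _    = refl
      ... | no ¬edge = contradiction (e , pair-⊆ i≢j i∈e j∈e) ¬edge
    ... | no ¬common = inj₂ (common≡0 , trans (+-cong (trans (*-congˡ
              (degreeTensor-zero 0 H α i (j ∷ []) λ { (i≡j ∷ []) → i≢j i≡j })) (zeroʳ _))
            (trans (*-congˡ (adjacency-zero 0 H α i (j ∷ []) not-edge)) (zeroʳ _))) (+-identityˡ _))
      where
      common≡0 : common H i j ≡ 0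
      common≡0 = Σℕ.⨁-zero (allFin (size H)) λ e _ → neither e
        where
        neither : ∀ f → incidence H i f ℕ.* incidence H j f ≡ 0
        neither f with i ∈? edge H f | j ∈? edge H f
        ... | no _    | _       = ≡.refl
        ... | yes _   | no _    = ≡.refl
        ... | yes i∈f | yes j∈f = contradiction (f , i∈f , j∈f) ¬common
      not-edge : ∀ e → edge H e ≢ ⟦_⟧ F 2 H (i Vec.∷ j Vec.∷ Vec.[])
      not-edge e eq = ¬common (e , subst (i ∈_) (≡.sym eq) (x∈p∪q⁺ (inj₁ (x∈⁅x⁆ i)))
        , subst (j ∈_) (≡.sym eq) (x∈p∪q⁺ (inj₂ (x∈p∪q⁺ (inj₁ (x∈⁅x⁆ j))))))

    pairTerm-common : ∀ i j → i ≢ j → pairTerm T i j ≈ t * (common H i j · 1#)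
    pairTerm-common i j i≢j with entry-common i j i≢j | entry-common j i (i≢j ∘ ≡.sym)
    ... | inj₂ (eq , Tij≈0) | _ = begin
      pairTerm T i j                 ≈⟨ pairTerm-digon i j i≢j ⟩
      r * (T i (j ∷ []) * _)         ≈⟨ *-congˡ (trans (*-congʳ Tij≈0) (zeroˡ _)) ⟩
      r * 0#                         ≈⟨ trans (zeroʳ r) (sym (zeroʳ t)) ⟩
      t * (0 · 1#)                   ≡⟨ cong (λ a → t * (a · 1#)) eq ⟨
      t * (common H i j · 1#)        ∎
    ... | inj₁ (eq , Tij≈s) | inj₁ (_ , Tji≈s) = begin
      pairTerm T i j                 ≈⟨ pairTerm-digon i j i≢j ⟩
      r * (T i (j ∷ []) * (r * (T j (i ∷ []) * (1# + 1#))))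
        ≈⟨ *-congˡ (*-cong Tij≈s (*-congˡ (*-congʳ Tji≈s))) ⟩
      t                              ≈⟨ *-identityʳ t ⟨
      t * 1#                         ≈⟨ *-congˡ (×-homo-1 1#) ⟨
      t * (1 · 1#)                   ≡⟨ cong (λ a → t * (a · 1#)) eq ⟨
      t * (common H i j · 1#)        ∎
    ... | inj₁ (eq , _) | inj₂ (eq′ , _) with () ← ≡.trans (≡.sym eq) (≡.trans
            (Σℕ.⨁-cong (allFin (size H)) λ e → ℕₚ.*-comm (incidence H i e) (incidence H j e)) eq′)

    pairSum-pairTerm : pairSum n (pairTerm T) ≈ t * (size H · 1#)
    pairSum-pairTerm = begin
      pairSum n (pairTerm T)                       ≈⟨ pairSum-cong n pairTerm-common ⟩
      pairSum n (λ i j → t * (common H i j · 1#))  ≈⟨ pairSum-*ˡ n t _ ⟩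
      t * pairSum n (λ i j → common H i j · 1#)    ≈⟨ *-congˡ (pairSum·1# n (common H)) ⟨
      t * (Σℕ.pairSum n (common H) · 1#)
        ≡⟨ cong (λ a → t * (a · 1#)) (pairSum-common H uniform) ⟩
      t * (size H · 1#)                            ∎

  -- For k = 2 + K = 2 this is 2 (1 - α)² m, since 1/1! = 1.
  pairContribution : (K : ℕ) → Carrier → (m : ℕ) → Carrier
  pairContribution zero    α m = (1/ 1 !) * ((1# - α) * (1/ 1 !) *
    ((1/ 1 !) * ((1# - α) * (1/ 1 !) * (1# + 1#)))) * (m · 1#)
  pairContribution (suc _) α m = 0#

  pairSum-Aα : ∀ K H α → Uniform (suc (suc K)) H → Linear H →
    pairSum (order H) (pairTerm (Aα-tensor F (suc (suc K)) H α)) ≈ pairContribution K α (size H)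
  pairSum-Aα zero    H α uniform linear = Graph.pairSum-pairTerm H α uniform linear
  pairSum-Aα (suc K) H α uniform linear = trans
    (pairSum-cong (order H) (pairTerm-zero (suc K) H α uniform (ℕ.s≤s ℕ.z≤n))) (vanish (order H))
    where
    vanish : ∀ m → pairSum m (λ _ _ → 0#) ≈ 0#
    vanish zero    = refl
    vanish (suc m) = trans (+-cong (⨁-zero (allFin m) λ _ _ → refl) (vanish m)) (+-identityˡ 0#)

  Tr-2-Aα : ∀ K H α → Uniform (suc (suc K)) H → Linear H →
    Tr F {suc (suc K)} 2 (Aα-tensor F (suc (suc K)) H α) ≈ (suc K ℕ.^ (order H ∸ 1)) ·
      (α * α * (∑ℕ (allFin (order H)) (λ v → degree H v ℕ.* degree H v) · 1#) + pairContribution K α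
        (size H))
  Tr-2-Aα K H α uniform linear = trans (Tr-2 (Aα-tensor F (suc (suc K)) H α))
    (×-congʳ (suc K ℕ.^ (order H ∸ 1))
      (+-cong (∑-diagonal² K H α uniform) (pairSum-Aα K H α uniform linear)))

∑d² : Hypergraph → ℕ
∑d² H = ∑ℕ (allFin (order H)) (λ v → degree H v ℕ.* degree H v)

-- Comparison in the S_α-order through the second trace

module Order {c ℓ₁ ℓ₂} (F : OrderedField c ℓ₁ ℓ₂) where
  open OrderedField F hiding (zero; _#_)
  open AlphaTensor F
  open AlphaTraces F
  private
    module R = CommutativeRing commutativeRing
    module < = IsStrictPartialOrder isStrictPartialOrder
  open SemiringMult R.semiring using (×-homo-1; ×-congʳ; ×-assoc-*; ×-homo-+)

  +-monoʳ-< : ∀ z {x y} → x < y → z + x < z + y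
  +-monoʳ-< z x<y = <.<-respˡ-≈ (+-comm _ _) (<.<-respʳ-≈ (+-comm _ _) (+-monoˡ-< z x<y))

  *-monoʳ-< : ∀ a {x y} → 0# < a → x < y → a * x < a * y
  *-monoʳ-< a {x} {y} 0<a x<y =
    <.<-respˡ-≈ (+-identityˡ _) (<.<-respʳ-≈ cancel (+-monoˡ-< (a * x) (*-positive 0<a 0<y-x)))
    where
    0<y-x : 0# < y - x
    0<y-x = <.<-respˡ-≈ (-‿inverseʳ x) (+-monoˡ-< (- x) x<y)
    cancel : a * (y - x) + a * x ≈ a * y
    cancel = trans (sym (distribˡ a _ _)) (*-congˡ (trans (+-assoc _ _ _)
      (trans (+-congˡ (-‿inverseˡ x)) (+-identityʳ y))))

  ·1#-mono-< : ∀ {p q} → p ℕ.< q → p · 1# < q · 1#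
  ·1#-mono-< {p} {q} p<q = <.<-respˡ-≈ (+-identityˡ _) (<.<-respʳ-≈
    (trans (sym (×-homo-+ 1# (suc (q ∸ suc p)) p)) (reflexive (cong (_· 1#) eq)))
    (+-monoˡ-< (p · 1#) (0#<suc (q ∸ suc p))))
    where
    eq : suc (q ∸ suc p) ℕ.+ p ≡ q
    eq = ≡.trans (≡.sym (ℕₚ.+-suc (q ∸ suc p) p)) (ℕₚ.m∸n+n≡m p<q)

  ·-monoʳ-< : ∀ n .{{_ : ℕ.NonZero n}} {x y} → x < y → n · x < n · y
  ·-monoʳ-< (suc n) x<y =
    <.<-respˡ-≈ (scale _) (<.<-respʳ-≈ (scale _) (*-monoʳ-< (suc n · 1#) (0#<suc n) x<y))
    where
    scale : ∀ z → (suc n · 1#) * z ≈ suc n · z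
    scale z = trans (×-assoc-* (suc n) 1# z) (×-congʳ (suc n) (*-identityˡ z))

  precedes : ∀ K {α} → 0# < α → ∀ {G H} →
    Uniform (suc (suc K)) G → Linear G → Uniform (suc (suc K)) H → Linear H →
    order G ≡ order H → size G ≡ size H → 3 ℕ.≤ order G → ∑d² G ℕ.< ∑d² H →
    Precedes F (suc (suc K)) α G H
  precedes K {α} 0<α {G} {H} uniG linG uniH linH order≡ size≡ 3≤n d²< =
    order≡ , 2 , ℕ.s≤s ℕ.z≤n , bound , below , less
    where
    C : Hypergraph → ℕ
    C J = suc K ℕ.^ (order J ∸ 1)
    C≡ : C G ≡ C H
    C≡ = cong (λ a → suc K ℕ.^ (a ∸ 1)) order≡
    bound : 2 ℕ.≤ order G ℕ.* C G ∸ 1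
    -- The index d = 2 has to lie in the admissible range up to n(k-1)^(n-1) - 1, which it does
    -- because n ≥ 3.
    bound = ℕₚ.∸-monoˡ-≤ 1
      (ℕₚ.≤-trans 3≤n (ℕₚ.m≤m*n (order G) (C G) {{ℕₚ.m^n≢0 (suc K) (order G ∸ 1)}}))
    ∑d≡ : ∑ℕ (allFin (order G)) (degree G) ≡ ∑ℕ (allFin (order H)) (degree H)
    ∑d≡ = ≡.trans (handshake G uniG)
      (≡.trans (cong (ℕ._* suc (suc K)) size≡) (≡.sym (handshake H uniH)))
    below : ∀ d → d ℕ.< 2 →
      Tr F {suc (suc K)} d (Aα-tensor F (suc (suc K)) G α) ≈ Tr F {suc (suc K)} d
      (Aα-tensor F (suc (suc K)) H α)
    below zero _ = reflexive (cong (λ a → (a ℕ.* suc K ℕ.^ (a ∸ 1)) · 1#) order≡)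
    below (suc zero) _ = trans (Tr-1-Aα K G α uniG) (trans
      (reflexive (≡.cong₂ (λ a b → a · (α * (b · 1#))) C≡ ∑d≡)) (sym (Tr-1-Aα K H α uniH)))
    below (suc (suc d)) (ℕ.s≤s (ℕ.s≤s ()))
    less : Tr F {suc (suc K)} 2 (Aα-tensor F (suc (suc K)) G α) < Tr F {suc (suc K)} 2
      (Aα-tensor F (suc (suc K)) H α)
    less = <.<-respˡ-≈ (sym (Tr-2-Aα K G α uniG linG)) (<.<-respʳ-≈
      (trans (reflexive
        (≡.cong₂ (λ a b → a · (α * α * (∑d² H · 1#) + pairContribution K α b)) C≡ size≡))
        (sym (Tr-2-Aα K H α uniH linH)))
      (·-monoʳ-< (C G) {{ℕₚ.m^n≢0 (suc K) (order G ∸ 1)}}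
        (+-monoˡ-< (pairContribution K α (size G))
          (*-monoʳ-< (α * α) (*-positive 0<α 0<α) (·1#-mono-< d²<)))))

open import Data.Nat hiding (_≟_)
open import Data.Nat.Properties hiding (_≟_)
open import Relation.Binary.PropositionalEquality

-- Cycles and the number of vertices

toℕ-next-< : ∀ {L} (i : Fin (suc L)) → toℕ i < L → toℕ (next i) ≡ suc (toℕ i)
toℕ-next-< {L} i i<L = trans (toℕ-fromℕ< (m%n<n (suc (toℕ i)) (suc L))) (m<n⇒m%n≡m (s≤s i<L))

toℕ-next-last : ∀ {L} (i : Fin (suc L)) → toℕ i ≡ L → toℕ (next i) ≡ 0
toℕ-next-last {L} i i≡L = trans (toℕ-fromℕ< (m%n<n (suc (toℕ i)) (suc L)))
  (trans (cong (λ a → suc a % suc L) i≡L) (n%n≡0 (suc L)))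

next-surjective : ∀ {g} (i : Fin g) → ∃[ j ] next j ≡ i
next-surjective {suc L} zero = fromℕ< (n<1+n L) , toℕ-injective
  (toℕ-next-last (fromℕ< (n<1+n L)) (toℕ-fromℕ< (n<1+n L)))
next-surjective {suc L} (suc i) = fromℕ< i<1+L , toℕ-injective
  (trans (toℕ-next-< (fromℕ< i<1+L) (subst (_< L) (sym (toℕ-fromℕ< i<1+L)) (toℕ<n i)))
    (cong suc (toℕ-fromℕ< i<1+L)))
  where
  i<1+L : toℕ i < suc L
  i<1+L = m<n⇒m<1+n (toℕ<n i)

next-≢ : ∀ {g} → 2 ≤ g → (i : Fin g) → next i ≢ i
next-≢ {suc zero} (s≤s ()) i
next-≢ {suc (suc L)} _ i eq with m≤n⇒m<n∨m≡n (≤-pred (toℕ<n i))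
... | inj₁ i<L = 1+n≢n (trans (sym (toℕ-next-< i i<L)) (cong toℕ eq))
... | inj₂ i≡L with () ← trans (sym i≡L) (trans (sym (cong toℕ eq)) (toℕ-next-last i i≡L))

module NonBacktracking (H : Hypergraph) (I : Vertex H → Edge H → Set)
  (I⊆ : ∀ {v e} → I v e → v ∈ edge H e) where

  -- Cycles are sought inside an arbitrary relation I so that the one found can be made to avoid a
  -- deleted incidence.
  CycleIn : Set
  CycleIn = Σ[ C ∈ Cycle H ] (∀ {v e} → Cycle.Traverses C v e → I v e)

  module _ (v : ℕ → Vertex H) (e : ℕ → Edge H)
    (Iˡ : ∀ i → I (v i) (e i)) (Iʳ : ∀ i → I (v (suc i)) (e i))
    (v≢ : ∀ i → v i ≢ v (suc i)) (e≢ : ∀ i → e i ≢ e (suc i)) where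

    Repeats : ℕ → ℕ → Set
    Repeats s l = v s ≡ v (s + l) ⊎ e s ≡ e (s + l)

    repeats? : ∀ s l → Dec (Repeats s l)
    repeats? s l = (v s ≟ v (s + l)) ⊎-dec (e s ≟ e (s + l))

    -- The stretch from v s to e (s + l) becomes a cycle because its last hyperedge also contains v
    -- s; the absence of repetitions within it makes its vertices and hyperedges distinct.
    close : ∀ s l → 1 ≤ l → I (v s) (e (s + l)) →
      (∀ o g → o + g < suc l → 1 ≤ g → ¬ Repeats (s + o) g) → CycleIn
    close s l 1≤l closing fresh = record
      { len = suc l
      ; len≥2 = s≤s 1≤l
      ; vertex = λ i → v (s + toℕ i)
      ; hyperedge = λ i → e (s + toℕ i)
      ; vertex-injective = λ {i} {j} → injective v inj₁ i j
      ; edge-injective = λ {i} {j} → injective e inj₂ i j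
      ; incidentˡ = λ i → I⊆ (Iˡ (s + toℕ i))
      ; incidentʳ = λ i → I⊆ (incʳ i)
      } , λ { (i , refl , inj₁ refl) → Iˡ (s + toℕ i) ; (i , refl , inj₂ refl) → incʳ i }
      where
      incʳ : ∀ (i : Fin (suc l)) → I (v (s + toℕ (next i))) (e (s + toℕ i))
      incʳ i with m≤n⇒m<n∨m≡n (≤-pred (toℕ<n i))
      ... | inj₁ i<l = subst (λ a → I (v a) (e (s + toℕ i)))
        (trans (sym (+-suc s (toℕ i))) (cong (s +_) (sym (toℕ-next-< i i<l)))) (Iʳ (s + toℕ i))
      ... | inj₂ i≡l = subst₂ (λ a b → I (v a) (e (s + b)))
        (trans (sym (+-identityʳ s)) (cong (s +_) (sym (toℕ-next-last i i≡l)))) (sym i≡l) closing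
      apart : ∀ {A : Set} (f : ℕ → A) → (∀ {s g} → f s ≡ f (s + g) → Repeats s g) →
        ∀ {i j} → i < j → j < suc l → f (s + i) ≢ f (s + j)
      apart f rep {i} {j} i<j j<l eq = fresh i (j ∸ i)
        (subst (_< suc l) (sym (m+[n∸m]≡n (<⇒≤ i<j))) j<l) (m<n⇒0<n∸m i<j)
        (rep (trans eq (cong f
          (trans (cong (s +_) (sym (m+[n∸m]≡n (<⇒≤ i<j)))) (sym (+-assoc s i (j ∸ i)))))))
      injective : ∀ {A : Set} (f : ℕ → A) → (∀ {s g} → f s ≡ f (s + g) → Repeats s g) →
        ∀ (i j : Fin (suc l)) → f (s + toℕ i) ≡ f (s + toℕ j) → i ≡ j
      injective f rep i j eq with <-cmp (toℕ i) (toℕ j)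
      ... | tri< i<j _ _ = contradiction eq (apart f rep i<j (toℕ<n j))
      ... | tri≈ _ i≡j _ = toℕ-injective i≡j
      ... | tri> _ _ j<i = contradiction (sym eq) (apart f rep j<i (toℕ<n i))

    -- A repetition of least gap closes up to a cycle: the incidences between the
    -- two occurrences form one, whether it is a vertex or a hyperedge that recurs.
    shortest : ∀ l → Acc _<_ l → ∀ s → 1 ≤ l → Repeats s l → CycleIn
    shortest l (acc rs) s 1≤l r
      -- It is enough to search the window of offsets up to l from s, since `close` asks for
      -- freshness only there.
      with any? {n = l} (λ g → any? {n = suc l} (λ o → (1 ≤? toℕ g) ×-dec repeats? (s + toℕ o) (toℕ g)))
    ... | yes (g , o , 1≤g , r′) = shortest (toℕ g) (rs (toℕ<n g)) (s + toℕ o) 1≤g r′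
    ... | no none = finish l 1≤l r fresh
      where
      fresh : ∀ o g → o ≤ l → g < l → 1 ≤ g → ¬ Repeats (s + o) g
      fresh o g o≤l g<l 1≤g r′ = none (fromℕ< g<l , fromℕ< (s≤s o≤l) ,
        subst (1 ≤_) (sym (toℕ-fromℕ< g<l)) 1≤g ,
        subst₂ (λ a b → Repeats (s + a) b) (sym (toℕ-fromℕ< (s≤s o≤l))) (sym (toℕ-fromℕ< g<l)) r′)
      finish : ∀ l → 1 ≤ l → Repeats s l →
        (∀ o g → o ≤ l → g < l → 1 ≤ g → ¬ Repeats (s + o) g) → CycleIn
      finish (suc zero) _ (inj₁ v≡) _ = contradiction (trans v≡ (cong v (+-comm s 1))) (v≢ s)
      finish (suc zero) _ (inj₂ e≡) _ = contradiction (trans e≡ (cong e (+-comm s 1))) (e≢ s)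
      finish (suc (suc l)) _ (inj₁ v≡) fresh = close s (suc l) (s≤s z≤n)
        (subst (λ a → I a (e (s + suc l))) (trans (cong v (sym (+-suc s (suc l)))) (sym v≡))
          (Iʳ (s + suc l)))
        (λ o g o+g<  1≤g → fresh o g (≤-trans (m≤m+n o g) (<⇒≤ o+g<)) (≤-<-trans (m≤n+m g o) o+g<) 1≤g)
      -- When e s recurs, v (s + 1) lies in its second occurrence too; the cycle therefore starts
      -- one step later than for a recurring vertex.
      finish (suc (suc l)) _ (inj₂ e≡) fresh = close (suc s) (suc l) (s≤s z≤n)
        (subst (I (v (suc s))) (trans e≡ (cong e (+-suc s (suc l)))) (Iʳ s))
        (λ o g o+g< 1≤g r′ → fresh (suc o) g
          (≤-trans (s≤s (subst (_≤ o + g) refl (m≤m+n o g))) o+g<) (≤-<-trans (m≤n+m g o) o+g<) 1≤g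
          (subst (λ a → Repeats a g) (sym (+-suc s o)) r′))

    walk-cycle : CycleIn
    walk-cycle with pigeonhole (n<1+n (order H)) (v ∘ toℕ)
    ... | i , j , i<j , v≡ = shortest (toℕ j ∸ toℕ i) (<-wellFounded _) (toℕ i) (m<n⇒0<n∸m i<j)
      (inj₁ (trans v≡ (cong v (sym (m+[n∸m]≡n (<⇒≤ i<j))))))

  -- With no dead end in I a walk can continue forever without backtracking, and on finitely many
  -- vertices it must repeat one.
  branching-cycle : (∀ {v e} → I v e → ∃[ v′ ] v ≢ v′ × I v′ e) →
    (∀ {v e} → I v e → ∃[ e′ ] e ≢ e′ × I v e′) → ∀ {v e} → I v e → CycleIn
  branching-cycle other-vertex other-edge {v₀} {e₀} I₀ = walk-cycle
    (λ i → proj₁ (state i)) (λ i → proj₁ (proj₂ (state i)))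
    (λ i → proj₂ (proj₂ (state i)))
    (λ i → proj₂ (proj₂ (other-vertex (proj₂ (proj₂ (state i))))))
    (λ i → proj₁ (proj₂ (other-vertex (proj₂ (proj₂ (state i))))))
    (λ i → proj₁ (proj₂ (other-edge (proj₂ (proj₂ (other-vertex (proj₂ (proj₂ (state i)))))))))
    where
    step : (Σ[ v ∈ Vertex H ] Σ[ e ∈ Edge H ] I v e) → Σ[ v ∈ Vertex H ] Σ[ e ∈ Edge H ] I v e
    step (v , e , i) with other-vertex i
    ... | v′ , _ , i′ with other-edge i′
    ...   | e′ , _ , i″ = v′ , e′ , i″
    state : ℕ → Σ[ v ∈ Vertex H ] Σ[ e ∈ Edge H ] I v e
    state zero    = v₀ , e₀ , I₀
    state (suc i) = step (state i)

-- Edge counts of graphs by adding and removing nodes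

extract : ∀ {A : Set} {x : A} {xs} → x ∈ˡ xs → ∃[ ys ] xs ↭ x ∷ ys
extract {x = x} x∈ with ∈-∃++ x∈
... | ys , zs , refl = ys ++ zs , shift x ys zs

filter-partition : ∀ {A : Set} {P : A → Set} (P? : Decidable P) xs →
  filter P? xs ++ filter (¬? ∘ P?) xs ↭ xs
filter-partition P? []       = ↭-refl
filter-partition P? (x ∷ xs) with P? x
... | yes _ = ↭-prep x (filter-partition P? xs)
... | no _  = ↭-trans (shift x (filter P? xs) _) (↭-prep x (filter-partition P? xs))

∑ℕ-∈ : ∀ {A : Set} (f : A → ℕ) {x xs} → x ∈ˡ xs → f x ≤ ∑ℕ xs f
∑ℕ-∈ f (here refl) = m≤m+n _ _
∑ℕ-∈ f (there x∈)  = ≤-trans (∑ℕ-∈ f x∈) (m≤n+m _ _)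

∑ℕ-two : ∀ {A : Set} (f : A → ℕ) {x y xs} → x ≢ y → x ∈ˡ xs → y ∈ˡ xs → f x + f y ≤ ∑ℕ xs f
∑ℕ-two f x≢y (here refl) (here refl) = contradiction refl x≢y
∑ℕ-two f x≢y (here refl) (there y∈)  = +-monoʳ-≤ _ (∑ℕ-∈ f y∈)
∑ℕ-two f {x} {y} {_ ∷ xs} x≢y (there x∈) (here refl) =
  subst (_≤ f y + ∑ℕ xs f) (+-comm (f y) (f x)) (+-monoʳ-≤ (f y) (∑ℕ-∈ f x∈))
∑ℕ-two f x≢y (there x∈)  (there y∈)  = ≤-trans (∑ℕ-two f x≢y x∈ y∈) (m≤n+m _ _)

∑ℕ-positive : ∀ {A : Set} (f : A → ℕ) xs → 1 ≤ ∑ℕ xs f → ∃[ x ] x ∈ˡ xs × 1 ≤ f x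
∑ℕ-positive f (x ∷ xs) 1≤ with f x in eq
... | suc _ = x , here refl , subst (1 ≤_) (sym eq) (s≤s z≤n)
... | zero  with ∑ℕ-positive f xs 1≤
...   | y , y∈ , 1≤y = y , there y∈ , 1≤y

module Degrees {A : Set} (b : A → A → ℕ) (b-sym : ∀ x y → b x y ≡ b y x) (b-irr : ∀ x → b x x ≡ 0) where

  -- Twice the number of edges of the subgraph induced on W, when b is the adjacency of a simple
  -- graph and W lists distinct nodes.
  degreeSum : List A → ℕ
  degreeSum W = ∑ℕ W (λ x → ∑ℕ W (b x))

  degreeSum-↭ : ∀ {V W} → V ↭ W → degreeSum V ≡ degreeSum W
  degreeSum-↭ {V} {W} p = trans (Σℕ.⨁-cong V (λ x → Σℕ.⨁-↭ (b x) p)) (Σℕ.⨁-↭ (λ x → ∑ℕ W (b x)) p)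

  degreeSum-∷ : ∀ x W → degreeSum (x ∷ W) ≡ 2 * ∑ℕ W (b x) + degreeSum W
  degreeSum-∷ x W = begin
    (b x x + ∑ℕ W (b x)) + ∑ℕ W (λ y → b y x + ∑ℕ W (b y))
      ≡⟨ cong₂ _+_ (cong (_+ ∑ℕ W (b x)) (b-irr x)) (Σℕ.⨁-+ W (λ y → b y x) (λ y → ∑ℕ W (b y))) ⟩
    ∑ℕ W (b x) + (∑ℕ W (λ y → b y x) + degreeSum W)
      ≡⟨ cong (λ s → ∑ℕ W (b x) + (s + degreeSum W)) (Σℕ.⨁-cong W (λ y → b-sym y x)) ⟩
    ∑ℕ W (b x) + (∑ℕ W (b x) + degreeSum W)
      ≡⟨ +-assoc (∑ℕ W (b x)) _ _ ⟨
    (∑ℕ W (b x) + ∑ℕ W (b x)) + degreeSum W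
      ≡⟨ cong (λ s → ∑ℕ W (b x) + s + degreeSum W) (+-identityʳ _) ⟨
    2 * ∑ℕ W (b x) + degreeSum W ∎
    where open ≡-Reasoning

  -- Acyclicity is taken to mean that no node set has minimum degree two, so at each step a node
  -- with at most one neighbour can be stripped; the last node has no edge. This is the edge bound
  -- for forests.
  degreeSum-acyclic : (∀ W → Unique W → ∀ {x} → x ∈ˡ W → ¬ (∀ y → y ∈ˡ W → 2 ≤ ∑ℕ W (b y))) →
    ∀ l W → length W ≡ suc l → Unique W → degreeSum W ≤ 2 * l
  degreeSum-acyclic core-free zero (x ∷ []) refl uniq =
    ≤-reflexive (trans (+-identityʳ _) (trans (+-identityʳ _) (b-irr x)))
  degreeSum-acyclic core-free (suc l) W@(w ∷ _) len uniq with Any.any? (λ x → ∑ℕ W (b x) ≤? 1) W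
  ... | no none = contradiction (λ y y∈ → ≰⇒> (λ y≤1 → none (Any.map (λ { refl → y≤1 }) y∈)))
    (core-free W uniq (here refl))
  ... | yes leaf with Any.satisfied leaf | extract (Any∈ leaf)
    where
    Any∈ : ∀ {P : A → Set} {xs} (p : Any.Any P xs) → Any.lookup p ∈ˡ xs
    Any∈ (here _)  = here refl
    Any∈ (there p) = there (Any∈ p)
  ...   | _ | V , p = begin
      degreeSum W             ≡⟨ degreeSum-↭ p ⟩
      degreeSum (x ∷ V)       ≡⟨ degreeSum-∷ x V ⟩
      2 * ∑ℕ V (b x) + degreeSum V
        ≤⟨ +-mono-≤ (*-monoʳ-≤ 2 x≤1)
          (degreeSum-acyclic core-free l V (suc-injective (trans (sym (↭-length p)) len))
             (unique-tail (PermSetoid.Unique-resp-↭ (setoid A) (↭⇒↭ₛ p) uniq))) ⟩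
      2 * 1 + 2 * l           ≡⟨ *-distribˡ-+ 2 1 l ⟨
      2 * suc l               ∎
    where
    open ≤-Reasoning
    x = Any.lookup leaf
    unique-tail : ∀ {y ys} → Unique (y ∷ ys) → Unique ys
    unique-tail (_ ∷ u) = u
    lookup-holds : ∀ {P : A → Set} {xs} (q : Any.Any P xs) → P (Any.lookup q)
    lookup-holds (here px) = px
    lookup-holds (there q) = lookup-holds q
    x≤1 : ∑ℕ V (b x) ≤ 1
    x≤1 = ≤-trans (m≤n+m (∑ℕ V (b x)) (b x x)) (subst (_≤ 1) (Σℕ.⨁-↭ (b x) p) (lookup-holds leaf))

  -- Each node added to W has a neighbour there and so brings at least one edge; a start with as
  -- many edges as nodes, such as a cycle, keeps that property to the end.
  degreeSum-connected : ∀ all →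
    (∀ W rest → W ++ rest ↭ all → ∀ {w} → w ∈ˡ W → ∀ {z} → z ∈ˡ rest →
      ∃[ y ] y ∈ˡ rest × 1 ≤ ∑ℕ W (b y)) →
    ∀ l W rest → length rest ≡ l → W ++ rest ↭ all → ∀ {w} → w ∈ˡ W →
    2 * length W ≤ degreeSum W → 2 * length all ≤ degreeSum all
  degreeSum-connected all extend zero W [] refl p w∈ bound = subst₂ (λ a c → 2 * a ≤ c)
    (↭-length q) (degreeSum-↭ q) bound
    where
    q : W ↭ all
    q = ↭-trans (↭-sym (↭-++-identityʳ W)) p
  degreeSum-connected all extend (suc l) W rest@(_ ∷ _) len p w∈ bound with extend W rest p w∈
    (here refl)
  ... | y , y∈ , 1≤ with extract y∈
  ...   | rest′ , q = degreeSum-connected all extend l (y ∷ W) rest′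
    (suc-injective (trans (sym (↭-length q)) len))
    (↭-trans (↭-sym (shift y W rest′)) (↭-trans (++⁺ˡ W (↭-sym q)) p)) (there w∈)
    (subst (2 * suc (length W) ≤_) (sym (degreeSum-∷ y W))
      (subst (_≤ 2 * ∑ℕ W (b y) + degreeSum W) (sym (*-distribˡ-+ 2 1 (length W)))
        (+-mono-≤ (*-monoʳ-≤ 2 1≤) bound)))

-- The relation J is a parameter because the incidence graph is used twice, once complete and once
-- with an incidence removed.
module Incidences (H : Hypergraph) {J : Vertex H → Edge H → Set} (J? : ∀ v e → Dec (J v e)) where

  Node : Set
  Node = Vertex H ⊎ Edge H

  adjacent : Node → Node → ℕ
  adjacent (inj₁ v) (inj₁ _) = 0
  adjacent (inj₁ v) (inj₂ e) = 𝟙 (J? v e)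
  adjacent (inj₂ e) (inj₁ v) = 𝟙 (J? v e)
  adjacent (inj₂ _) (inj₂ _) = 0

  adjacent-sym : ∀ x y → adjacent x y ≡ adjacent y x
  adjacent-sym (inj₁ _) (inj₁ _) = refl
  adjacent-sym (inj₁ _) (inj₂ _) = refl
  adjacent-sym (inj₂ _) (inj₁ _) = refl
  adjacent-sym (inj₂ _) (inj₂ _) = refl

  adjacent-irr : ∀ x → adjacent x x ≡ 0
  adjacent-irr (inj₁ _) = refl
  adjacent-irr (inj₂ _) = refl

  open Degrees adjacent adjacent-sym adjacent-irr public

  nodes : List Node
  nodes = map inj₁ (allFin (order H)) ++ map inj₂ (allFin (size H))

  ∈-nodes : ∀ x → x ∈ˡ nodes
  ∈-nodes (inj₁ v) = ∈-++⁺ˡ (∈-map⁺ inj₁ (∈-allFin v))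
  ∈-nodes (inj₂ e) = ∈-++⁺ʳ (map inj₁ (allFin (order H))) (∈-map⁺ inj₂ (∈-allFin e))

  length-nodes : length nodes ≡ order H + size H
  length-nodes = trans (length-++ (map inj₁ (allFin (order H)))) (cong₂ _+_
    (trans (length-map inj₁ (allFin (order H))) (length-allFin (order H)))
    (trans (length-map inj₂ (allFin (size H))) (length-allFin (size H))))

  nodes-unique : Unique nodes
  nodes-unique = Unique.++⁺ (Unique.map⁺ inj₁-injective (Unique.allFin⁺ (order H)))
    (Unique.map⁺ inj₂-injective (Unique.allFin⁺ (size H))) disjoint
    where
    disjoint : ∀ {x} → ¬ (x ∈ˡ map inj₁ (allFin (order H)) × x ∈ˡ map inj₂ (allFin (size H)))
    disjoint (x∈₁ , x∈₂) with ∈-map⁻ inj₁ x∈₁ | ∈-map⁻ inj₂ x∈₂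
    ... | _ , _ , refl | _ , _ , ()

  incidences : ℕ
  incidences = ∑ℕ (allFin (order H)) (λ v → ∑ℕ (allFin (size H)) (λ e → 𝟙 (J? v e)))

  degreeSum-nodes : degreeSum nodes ≡ 2 * incidences
  degreeSum-nodes = trans (Σℕ.⨁-++ (map inj₁ V) (map inj₂ E) _) (cong₂ _+_
    (trans (Σℕ.⨁-map inj₁ V _) (Σℕ.⨁-cong V λ v → trans (Σℕ.⨁-++ (map inj₁ V) (map inj₂ E) _)
      (cong₂ _+_ (trans (Σℕ.⨁-map inj₁ V _) (Σℕ.⨁-zero V λ _ _ → refl)) (Σℕ.⨁-map inj₂ E _))))
    (trans (Σℕ.⨁-map inj₂ E _) (trans (Σℕ.⨁-cong E λ e → trans (Σℕ.⨁-++ (map inj₁ V) (map inj₂ E) _)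
      (trans (cong₂ _+_ (Σℕ.⨁-map inj₁ V _) (trans (Σℕ.⨁-map inj₂ E _) (Σℕ.⨁-zero E λ _ _ → refl)))
        (+-identityʳ _)))
      (trans (Σℕ.⨁-swap E V _) (sym (+-identityʳ _))))))
    where
    V = allFin (order H)
    E = allFin (size H)

-- The number of vertices of a unicyclic hypergraph

module _ {H : Hypergraph} (C : Cycle H) where
  open Cycle C

  -- A path to a vertex of the cycle other than v begins with a hyperedge at v; connectedness alone
  -- would allow a single isolated vertex.
  edge-at : Connected H → ∀ v → ∃[ e ] v ∈ edge H e
  edge-at connected v with other-vertex len≥2 vertex vertex-injective
    where
    other-vertex : ∀ {l} → 2 ≤ l → (f : Fin l → Vertex H) → (∀ {i j} → f i ≡ f j → i ≡ j) →
      ∃[ i ] v ≢ f i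
    other-vertex (s≤s (s≤s z≤n)) f f-inj with v ≟ f zero
    ... | no v≢    = zero , v≢
    ... | yes refl = suc zero , λ eq → contradiction (f-inj eq) λ ()
  ... | i , v≢ with connected v (vertex i)
  ...   | Star.ε            = contradiction refl v≢
  ...   | (e , v∈e , _) ◅ _ = e , v∈e

edge-member : ∀ {k H} → 1 ≤ k → Uniform k H → ∀ e → ∃[ v ] v ∈ edge H e
edge-member {H = H} 1≤k uniform e with ∑ℕ-positive (λ v → 𝟙 (v ∈? edge H e)) (allFin (order H))
                                         (subst (1 ≤_) (trans (sym (uniform e)) (∣p∣≡∑ (edge H e))) 1≤k)
... | v , _ , 1≤ with v ∈? edge H e
...   | yes v∈e = v , v∈e

module _ {k} {H : Hypergraph} (1≤k : 1 ≤ k) (uniform : Uniform k H) (connected : Connected H)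
  (C : Cycle H) where
  open Cycle C

  private
    J? : ∀ v e → Dec (v ∈ edge H e)
    J? v e = v ∈? edge H e

    module B = Incidences H J?

    OnCycle : B.Node → Set
    OnCycle (inj₁ v) = ∃[ i ] v ≡ vertex i
    OnCycle (inj₂ e) = ∃[ i ] e ≡ hyperedge i

    onCycle? : Decidable OnCycle
    onCycle? (inj₁ v) = any? (λ i → v ≟ vertex i)
    onCycle? (inj₂ e) = any? (λ i → e ≟ hyperedge i)

    core : List B.Node
    core = filter onCycle? B.nodes

    ∈core : ∀ {x} → OnCycle x → x ∈ˡ core
    ∈core {x} on = ∈-filter⁺ onCycle? (B.∈-nodes x) on

    two-neighbours : ∀ x {y z} → y ≢ z → OnCycle y → OnCycle z →
      B.adjacent x y ≡ 1 → B.adjacent x z ≡ 1 → 2 ≤ ∑ℕ core (B.adjacent x)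
    two-neighbours x y≢z on-y on-z xy xz = subst (_≤ ∑ℕ core (B.adjacent x)) (cong₂ _+_ xy xz)
      (∑ℕ-two (B.adjacent x) y≢z (∈core on-y) (∈core on-z))

    on-cycle-degree : ∀ x → OnCycle x → 2 ≤ ∑ℕ core (B.adjacent x)
    on-cycle-degree (inj₁ _) (i , refl) with next-surjective i
    ... | j , refl = two-neighbours (inj₁ (vertex (next j))) {inj₂ (hyperedge j)}
      {inj₂ (hyperedge (next j))}
      (next-≢ len≥2 j ∘ sym ∘ edge-injective ∘ inj₂-injective) (j , refl) (next j , refl)
      (𝟙-yes (J? _ _) (incidentʳ j)) (𝟙-yes (J? _ _) (incidentˡ (next j)))
    on-cycle-degree (inj₂ _) (i , refl) =
      two-neighbours (inj₂ (hyperedge i)) {inj₁ (vertex i)} {inj₁ (vertex (next i))}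
      (next-≢ len≥2 i ∘ sym ∘ vertex-injective ∘ inj₁-injective) (i , refl) (next i , refl)
      (𝟙-yes (J? _ _) (incidentˡ i)) (𝟙-yes (J? _ _) (incidentʳ i))

    core-bound : 2 * length core ≤ B.degreeSum core
    core-bound = subst (_≤ B.degreeSum core) (trans (∑ℕ-const core 2) (*-comm (length core) 2))
      (∑ℕ-mono core (λ x x∈ → on-cycle-degree x (proj₂ (∈-filter⁻ onCycle? {xs = B.nodes} x∈))))

    neighbour : ∀ x → ∃[ y ] B.adjacent x y ≡ 1
    neighbour (inj₁ v) with edge-at C connected v
    ... | e , v∈e = inj₂ e , 𝟙-yes (J? v e) v∈e
    neighbour (inj₂ e) with edge-member {H = H} 1≤k uniform e
    ... | v , v∈e = inj₁ v , 𝟙-yes (J? v e) v∈e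

    extend : ∀ W rest → W ++ rest ↭ B.nodes → ∀ {w} → w ∈ˡ W → ∀ {z} → z ∈ˡ rest →
      ∃[ y ] y ∈ˡ rest × 1 ≤ ∑ℕ W (B.adjacent y)
    extend W rest p {w} w∈ {z} z∈ with Any.any? (λ y → 1 ≤? ∑ℕ W (B.adjacent y)) rest
    ... | yes found = satisfying found
      where
      satisfying : ∀ {P : B.Node → Set} {xs} → Any.Any P xs → ∃[ y ] y ∈ˡ xs × P y
      satisfying (here py) = _ , here refl , py
      satisfying (there q) with satisfying q
      ... | y , y∈ , py = y , there y∈ , py
    -- If nothing in `rest` is adjacent to W, then W is closed under adjacency and by connectedness
    -- contains every node, in particular a neighbour of z.
    ... | no none = z , z∈ , reached z
      where
      beyond : ∀ {x y} → x ∈ˡ W → B.adjacent y x ≡ 1 → y ∈ˡ W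
      beyond {x} {y} x∈ yx with ∈-++⁻ W (∈-resp-↭ (↭-sym p) (B.∈-nodes y))
      ... | inj₁ y∈W = y∈W
      ... | inj₂ y∈r = contradiction
        (Any.map (λ { refl → ≤-trans (≤-reflexive (sym yx)) (∑ℕ-∈ (B.adjacent y) x∈) }) y∈r) none
      along : ∀ {u v} → inj₁ u ∈ˡ W → Star (Adjacent H) u v → inj₁ v ∈ˡ W
      along u∈ Star.ε                          = u∈
      along u∈ ((e , u∈e , v∈e) ◅ path) = along
        (beyond {inj₂ e} (beyond u∈ (𝟙-yes (J? _ e) u∈e)) (𝟙-yes (J? _ e) v∈e)) path
      start : ∀ x → x ∈ˡ W → ∃[ v ] inj₁ v ∈ˡ W
      start (inj₁ v) v∈ = v , v∈
      start (inj₂ e) e∈ with edge-member {H = H} 1≤k uniform e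
      ... | v , v∈e = v , beyond e∈ (𝟙-yes (J? v e) v∈e)
      everything : ∀ x → x ∈ˡ W
      everything (inj₁ v) = along (proj₂ (start _ w∈)) (connected _ v)
      everything (inj₂ e) with edge-member {H = H} 1≤k uniform e
      ... | v , v∈e = beyond (everything (inj₁ v)) (𝟙-yes (J? v e) v∈e)
      reached : ∀ x → 1 ≤ ∑ℕ W (B.adjacent x)
      reached x with neighbour x
      ... | y , xy = ≤-trans (≤-reflexive (sym xy)) (∑ℕ-∈ (B.adjacent x) (everything y))

  incidences≡ : B.incidences ≡ size H * k
  incidences≡ = trans (Σℕ.⨁-cong (allFin (order H)) (λ v → sym (degree≡∑ H v))) (handshake H uniform)

  -- Each node of the cycle has two neighbours on it, so the cycle has at least as many incidences
  -- as nodes, and connectedness extends this to the whole incidence graph.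
  nodes≤incidences : order H + size H ≤ size H * k
  nodes≤incidences = subst₂ _≤_ B.length-nodes incidences≡ (*-cancelˡ-≤ 2
    (subst (2 * length B.nodes ≤_) B.degreeSum-nodes
      (B.degreeSum-connected B.nodes extend (length (filter (¬? ∘ onCycle?) B.nodes)) core _ refl
        (filter-partition onCycle? B.nodes) (∈core {inj₁ (vertex first)} (first , refl)) core-bound)))
    where
    first : Fin len
    first = fromℕ< (≤-trans (s≤s z≤n) len≥2)

  module _ (unique : ∀ D → SameCycle C D) where

    private
      i₀ : Fin len
      i₀ = fromℕ< (≤-trans (s≤s z≤n) len≥2)
      v₀ = vertex i₀
      e₀ = hyperedge i₀

      -- One incidence of C is deleted. By uniqueness every cycle traverses it, so what remains is a
      -- forest.
      J′ : Vertex H → Edge H → Set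
      J′ v e = v ∈ edge H e × ¬ (v ≡ v₀ × e ≡ e₀)

      J′? : ∀ v e → Dec (J′ v e)
      J′? v e = (v ∈? edge H e) ×-dec ¬? ((v ≟ v₀) ×-dec (e ≟ e₀))

      module B′ = Incidences H J′?

      cut : ∀ v e → 𝟙 (J? v e) ≤ 𝟙 (J′? v e) + 𝟙 (v ≟ v₀) * 𝟙 (e ≟ e₀)
      cut v e with v ∈? edge H e | v ≟ v₀ | e ≟ e₀
      ... | no _  | _     | _     = z≤n
      ... | yes _ | no _  | _     = s≤s z≤n
      ... | yes _ | yes _ | no _  = s≤s z≤n
      ... | yes _ | yes _ | yes _ = s≤s z≤n

      incidences≤ : B.incidences ≤ B′.incidences + 1
      incidences≤ = subst (B.incidences ≤_)
        (trans (Σℕ.⨁-cong (allFin (order H)) λ v → Σℕ.⨁-+ (allFin (size H)) _ _)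
          (trans (Σℕ.⨁-+ (allFin (order H)) _ _) (cong (B′.incidences +_) one)))
        (∑ℕ-mono (allFin (order H)) λ v _ → ∑ℕ-mono (allFin (size H)) λ e _ → cut v e)
        where
        one : ∑ℕ (allFin (order H)) (λ v → ∑ℕ (allFin (size H)) (λ e → 𝟙 (v ≟ v₀) * 𝟙 (e ≟ e₀))) ≡ 1
        one = trans (Σℕ.⨁-single (order H) _ v₀ λ v v≢ → Σℕ.⨁-zero (allFin (size H)) λ e _ →
                cong (_* 𝟙 (e ≟ e₀)) (𝟙-no (v ≟ v₀) v≢))
              (trans (Σℕ.⨁-single (size H) _ e₀ λ e e≢ →
                trans (cong (𝟙 (v₀ ≟ v₀) *_) (𝟙-no (e ≟ e₀) e≢)) (*-zeroʳ (𝟙 (v₀ ≟ v₀))))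
                (cong₂ _*_ (𝟙-yes (v₀ ≟ v₀) refl) (𝟙-yes (e₀ ≟ e₀) refl)))

      acyclic : (D : Cycle H) → ¬ (∀ {v e} → Cycle.Traverses D v e → J′ v e)
      acyclic D J′D = proj₂ (J′D (Equivalence.to (unique D v₀ e₀) (i₀ , refl , inj₁ refl)))
        (refl , refl)

      adjacent≤1 : ∀ x y → B′.adjacent x y ≤ 1
      adjacent≤1 (inj₁ _) (inj₁ _) = z≤n
      adjacent≤1 (inj₁ v) (inj₂ e) = 𝟙≤1 (J′? v e)
      adjacent≤1 (inj₂ e) (inj₁ v) = 𝟙≤1 (J′? v e)
      adjacent≤1 (inj₂ _) (inj₂ _) = z≤n

      -- Minimum degree two within W would allow a walk without backtracking, hence a cycle that
      -- avoids the deleted incidence.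
      core-free : ∀ W → Unique W → ∀ {x} → x ∈ˡ W → ¬ (∀ y → y ∈ˡ W → 2 ≤ ∑ℕ W (B′.adjacent y))
      core-free W uniq {x} x∈ branching = uncurry acyclic (initial x x∈)
        where
        I : Vertex H → Edge H → Set
        I v e = J′ v e × inj₁ v ∈ˡ W × inj₂ e ∈ˡ W

        another : ∀ x → x ∈ˡ W → ∀ y → ∃[ z ] z ∈ˡ W × y ≢ z × 1 ≤ B′.adjacent x z
        another x x∈ y = second W uniq (branching x x∈)
          where
          second : ∀ V → Unique V → 2 ≤ ∑ℕ V (B′.adjacent x) →
            ∃[ z ] z ∈ˡ V × y ≢ z × 1 ≤ B′.adjacent x z
          second (u ∷ V) (u∉V ∷ uniqV) 2≤ with B′.adjacent x u in eq
          ... | zero = let z , z∈ , rest = second V uniqV 2≤ in z , there z∈ , rest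
          ... | suc (suc a) = contradiction (subst (_≤ 1) eq (adjacent≤1 x u)) λ { (s≤s ()) }
          -- As u contributes exactly 1 to a sum of at least 2, there is a second neighbour beyond
          -- u, and one of the two differs from y.
          ... | suc zero with ∑ℕ-positive (B′.adjacent x) V (≤-pred 2≤) | u ≟ᴺ y
            where
            _≟ᴺ_ : (a b : B′.Node) → Dec (a ≡ b)
            _≟ᴺ_ = ⊎-≡-dec _≟_ _≟_
          ...   | _          | no u≢y   = u , here refl , u≢y ∘ sym , ≤-reflexive (sym eq)
          ...   | z , z∈ , p | yes refl = z , there z∈ , ListAll.lookup u∉V z∈ , p

        J′-of : ∀ v e → 1 ≤ 𝟙 (J′? v e) → J′ v e
        J′-of v e 1≤ with J′? v e
        ... | yes j = j
        ... | no _ with () ← 1≤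

        cycle : ∀ {v e} → I v e → Σ[ D ∈ Cycle H ] (∀ {v e} → Cycle.Traverses D v e → J′ v e)
        cycle i = map₂ (λ sub {v} {e} t → proj₁ (sub {v} {e} t))
          (NonBacktracking.branching-cycle H I (proj₁ ∘ proj₁)
          other-vertex other-edge i)
          where
          other-vertex : ∀ {v e} → I v e → ∃[ v′ ] v ≢ v′ × I v′ e
          other-vertex {v} {e} (_ , v∈ , e∈) with another (inj₂ e) e∈ (inj₁ v)
          ... | inj₁ v′ , v′∈ , v≢ , 1≤ = v′ , v≢ ∘ cong inj₁ , J′-of v′ e 1≤ , v′∈ , e∈
          other-edge : ∀ {v e} → I v e → ∃[ e′ ] e ≢ e′ × I v e′
          other-edge {v} {e} (_ , v∈ , e∈) with another (inj₁ v) v∈ (inj₂ e)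
          ... | inj₂ e′ , e′∈ , e≢ , 1≤ = e′ , e≢ ∘ cong inj₂ , J′-of v e′ 1≤ , v∈ , e′∈

        initial : ∀ x → x ∈ˡ W → Σ[ D ∈ Cycle H ] (∀ {v e} → Cycle.Traverses D v e → J′ v e)
        initial (inj₁ v) v∈ with another (inj₁ v) v∈ (inj₁ v)
        ... | inj₂ e , e∈ , _ , 1≤ = cycle (J′-of v e 1≤ , v∈ , e∈)
        initial (inj₂ e) e∈ with another (inj₂ e) e∈ (inj₂ e)
        ... | inj₁ v , v∈ , _ , 1≤ = cycle (J′-of v e 1≤ , v∈ , e∈)

    incidences≤nodes : size H * k ≤ order H + size H
    incidences≤nodes with order H + size H in eq
    ... | zero  = contradiction v₀ (λ v → no-vertex (m+n≡0⇒m≡0 (order H) eq) v)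
      where
      no-vertex : ∀ {a} → a ≡ 0 → ¬ Fin a
      no-vertex refl ()
    ... | suc l = begin
      size H * k           ≡⟨ incidences≡ ⟨
      B.incidences         ≤⟨ incidences≤ ⟩
      B′.incidences + 1    ≤⟨ +-monoˡ-≤ 1 (*-cancelˡ-≤ 2 (subst (_≤ 2 * l) B′.degreeSum-nodes
                                (B′.degreeSum-acyclic core-free l B′.nodes (trans B′.length-nodes eq)
                                  B′.nodes-unique))) ⟩
      l + 1                ≡⟨ +-comm l 1 ⟩
      suc l                ∎
      where open ≤-Reasoning

-- The relation n = m(k-1), written without subtraction.
unicyclic-order : ∀ {k m H} → 1 ≤ k → LinearUnicyclic k m H → order H + m ≡ m * k
unicyclic-order 1≤k record { uniform = uniform ; unicyclic = connected , C , unique ; size≡m = refl } =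
  ≤-antisym (nodes≤incidences 1≤k uniform connected C) (incidences≤nodes 1≤k uniform connected C unique)

-- Triangles with pendant hyperedges

∑ℕ-punchIn : ∀ n (f : Fin (suc n) → ℕ) i →
  ∑ℕ (allFin (suc n)) f ≡ f i + ∑ℕ (allFin n) (f ∘ punchIn i)
∑ℕ-punchIn n f zero = Σℕ.⨁-suc n f
∑ℕ-punchIn (suc n) f (suc i) = begin
  ∑ℕ (allFin (suc (suc n))) f                              ≡⟨ Σℕ.⨁-suc (suc n) f ⟩
  f zero + ∑ℕ (allFin (suc n)) (f ∘ suc)
    ≡⟨ cong (f zero +_) (∑ℕ-punchIn n (f ∘ suc) i) ⟩
  f zero + (f (suc i) + ∑ℕ (allFin n) (f ∘ suc ∘ punchIn i)) ≡⟨ +-assoc (f zero) _ _ ⟨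
  f zero + f (suc i) + ∑ℕ (allFin n) (f ∘ suc ∘ punchIn i)
    ≡⟨ cong (_+ ∑ℕ (allFin n) (f ∘ suc ∘ punchIn i)) (+-comm (f zero) _) ⟩
  f (suc i) + f zero + ∑ℕ (allFin n) (f ∘ suc ∘ punchIn i) ≡⟨ +-assoc (f (suc i)) _ _ ⟩
  f (suc i) + (f zero + ∑ℕ (allFin n) (f ∘ suc ∘ punchIn i))
    ≡⟨ cong (f (suc i) +_) (Σℕ.⨁-suc n (f ∘ punchIn (suc i))) ⟨
  f (suc i) + ∑ℕ (allFin (suc n)) (f ∘ punchIn (suc i))    ∎
  where open ≡-Reasoning

module _ {T : Set} (_≟ᵀ_ : DecidableEquality T) where

  tally : ∀ {n} → (Fin n → T) → T → ℕ
  tally f t = ∑ℕ (allFin _) (λ i → 𝟙 (f i ≟ᵀ t))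

  -- Pair `f zero` with an equal value of g and remove both; the remaining tallies still agree. The
  -- isomorphisms of triangles are assembled from such matchings.
  matching : ∀ {m n} (f : Fin m → T) (g : Fin n → T) → (∀ t → tally f t ≡ tally g t) →
    ∃[ π ] ∀ i → g (π ⟨$⟩ʳ i) ≡ f i
  matching {zero} {zero}  f g eq = Permutation.id , λ ()
  matching {zero} {suc n} f g eq with () ← trans (eq (g zero))
    (trans (Σℕ.⨁-suc n (λ i → 𝟙 (g i ≟ᵀ g zero)))
      (cong (_+ ∑ℕ (allFin n) (λ i → 𝟙 (g (suc i) ≟ᵀ g zero))) (𝟙-yes (g zero ≟ᵀ g zero) refl)))
  matching {suc m} {n} f g eq with any? (λ j → g j ≟ᵀ f zero)
  ... | no none = contradiction
    (trans (sym (trans (Σℕ.⨁-suc m (λ i → 𝟙 (f i ≟ᵀ f zero)))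
      (cong (_+ ∑ℕ (allFin m) (λ i → 𝟙 (f (suc i) ≟ᵀ f zero))) (𝟙-yes (f zero ≟ᵀ f zero) refl))))
      (trans (eq (f zero)) (Σℕ.⨁-zero (allFin n) λ j _ → 𝟙-no (g j ≟ᵀ f zero) (λ e → none (j , e)))))
        λ ()
  matching {suc m} {suc n} f g eq | yes (j , gj≡) =
    let π , ok = matching (f ∘ suc) (g ∘ punchIn j) rest
    in  insert zero j π , λ
          { zero → gj≡ ; (suc i) → trans (cong g (insert-punchIn zero j π i)) (ok i) }
    where
    rest : ∀ t → tally (f ∘ suc) t ≡ tally (g ∘ punchIn j) t
    rest t = +-cancelˡ-≡ (𝟙 (f zero ≟ᵀ t)) _ _ (trans (sym (Σℕ.⨁-suc m (λ i → 𝟙 (f i ≟ᵀ t))))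
      (trans (eq t) (trans (∑ℕ-punchIn n (λ i → 𝟙 (g i ≟ᵀ t)) j)
        (cong (λ x → 𝟙 (x ≟ᵀ t) + tally (g ∘ punchIn j) t) gj≡))))

  tally-unique : ∀ {n} (f : Fin n → T) {t} i → f i ≡ t → (∀ {j} → f j ≡ t → j ≡ i) → tally f t ≡ 1
  tally-unique f {t} i fi≡t only = trans
    (Σℕ.⨁-single _ (λ i → 𝟙 (f i ≟ᵀ t)) i λ j j≢i → 𝟙-no (f j ≟ᵀ t) (j≢i ∘ only))
      (𝟙-yes (f i ≟ᵀ t) fi≡t)

Kind : Set
Kind = Fin 3 ⊎ Fin 3

_≟ᴷ_ : DecidableEquality Kind
_≟ᴷ_ = ⊎-≡-dec _≟_ _≟_

Touches : Fin 3 → Kind → Set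
Touches j (inj₁ i) = j ≢ i
Touches j (inj₂ i) = j ≡ i

touches? : ∀ j κ → Dec (Touches j κ)
touches? j (inj₁ i) = ¬? (j ≟ i)
touches? j (inj₂ i) = j ≟ i

third : ∀ (i j : Fin 3) → ∃[ l ] i ≢ l × j ≢ l
third = from-yes (all? λ (i : Fin 3) → all? λ (j : Fin 3) → any? λ (l : Fin 3) →
  ¬? (i ≟ l) ×-dec ¬? (j ≟ l))

third-unique : ∀ (i j l l′ : Fin 3) → i ≢ j → i ≢ l → j ≢ l → i ≢ l′ → j ≢ l′ → l ≡ l′
third-unique = from-yes
  (all? λ (i : Fin 3) → all? λ (j : Fin 3) → all? λ (l : Fin 3) → all? λ (l′ : Fin 3) → ¬? (i ≟ j) →-dec
  (¬? (i ≟ l) →-dec (¬? (j ≟ l) →-dec (¬? (i ≟ l′) →-dec (¬? (j ≟ l′) →-dec (l ≟ l′))))))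

one-of-two : ∀ (i j l x : Fin 3) → i ≢ j → i ≢ l → j ≢ l → x ≢ l → x ≡ i ⊎ x ≡ j
one-of-two = from-yes
  (all? λ (i : Fin 3) → all? λ (j : Fin 3) → all? λ (l : Fin 3) → all? λ (x : Fin 3) → ¬? (i ≟ j) →-dec
  (¬? (i ≟ l) →-dec (¬? (j ≟ l) →-dec (¬? (x ≟ l) →-dec ((x ≟ i) ⊎-dec (x ≟ j))))))

Meets : {E : Set} → (E → Kind) → Fin 3 ⊎ E → E → Set
Meets kind (inj₁ j) e = Touches j (kind e)
Meets kind (inj₂ f) e = f ≡ e

-- A triangle with pendant hyperedges at its corners.  A hyperedge of kind inj₁ i
-- is the side missing corner i, one of kind inj₂ i is pendant at corner i; a
-- vertex is labelled by the corner it is or by the only hyperedge containing it.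
record Triangle (H : Hypergraph) (n : Fin 3 → ℕ) : Set where
  field
    kind          : Edge H → Kind
    label         : Vertex H → Fin 3 ⊎ Edge H
    side          : Fin 3 → Edge H
    corner        : Fin 3 → Vertex H
    kind-side     : ∀ i → kind (side i) ≡ inj₁ i
    side-unique   : ∀ {i e} → kind e ≡ inj₁ i → e ≡ side i
    label-corner  : ∀ i → label (corner i) ≡ inj₁ i
    corner-unique : ∀ {i v} → label v ≡ inj₁ i → v ≡ corner i
    pendants      : ∀ i → tally _≟ᴷ_ kind (inj₂ i) ≡ n i
    incident      : ∀ v e → v ∈ edge H e ⇔ Meets kind (label v) e

  _≟ᴸ_ : DecidableEquality (Fin 3 ⊎ Edge H)
  _≟ᴸ_ = ⊎-≡-dec _≟_ _≟_

  tally-side : ∀ i → tally _≟ᴷ_ kind (inj₁ i) ≡ 1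
  tally-side i = tally-unique _≟ᴷ_ kind (side i) (kind-side i) side-unique

  tally-corner : ∀ i → tally _≟ᴸ_ label (inj₁ i) ≡ 1
  tally-corner i = tally-unique _≟ᴸ_ label (corner i) (label-corner i) corner-unique

  corner-∈ : ∀ {j e} → Touches j (kind e) → corner j ∈ edge H e
  corner-∈ {j} {e} t = Equivalence.from (incident (corner j) e)
    (subst (λ l → Meets kind l e) (sym (label-corner j)) t)

  corner-∈⁻ : ∀ {j e} → corner j ∈ edge H e → Touches j (kind e)
  corner-∈⁻ {j} {e} c∈ =
    subst (λ l → Meets kind l e) (label-corner j) (Equivalence.to (incident (corner j) e) c∈)

  corner-∈-side : ∀ {j i} → j ≢ i → corner j ∈ edge H (side i)
  corner-∈-side {j} {i} j≢i = corner-∈ (subst (Touches j) (sym (kind-side i)) j≢i)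

  corner-injective : ∀ {i j} → corner i ≡ corner j → i ≡ j
  corner-injective {i} {j} eq =
    inj₁-injective (trans (sym (label-corner i)) (trans (cong label eq) (label-corner j)))

  side-injective : ∀ {i j} → side i ≡ side j → i ≡ j
  side-injective {i} {j} eq =
    inj₁-injective (trans (sym (kind-side i)) (trans (cong kind eq) (kind-side j)))

  shared-corner : ∀ {v e f} → e ≢ f → v ∈ edge H e → v ∈ edge H f → ∃[ j ] v ≡ corner j
  shared-corner {v} {e} {f} e≢f v∈e v∈f
    with label v in eq | Equivalence.to (incident v e) v∈e | Equivalence.to (incident v f) v∈f
  ... | inj₁ j | _    | _    = j , corner-unique eq
  ... | inj₂ g | refl | refl = contradiction refl e≢f

  two-corners-side : ∀ {i j e} → i ≢ j → corner i ∈ edge H e → corner j ∈ edge H e →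
    ∃[ l ] e ≡ side l × i ≢ l × j ≢ l
  two-corners-side {i} {j} {e} i≢j i∈e j∈e with kind e in eq | corner-∈⁻ i∈e | corner-∈⁻ j∈e
  ... | inj₁ l | i≢l  | j≢l  = l , side-unique eq , i≢l , j≢l
  ... | inj₂ l | refl | refl = contradiction refl i≢j

  -- A vertex in two different hyperedges is a corner, and only one hyperedge contains two given
  -- corners: the side missing the third.
  linear : Linear H
  linear e f e≢f with any? (λ v → (v ∈? edge H e) ×-dec (v ∈? edge H f))
  ... | no none = ≤-trans
    (≤-reflexive (trans (∣p∣≡∑ (edge H e ∩ edge H f)) (Σℕ.⨁-zero (allFin (order H)) λ v _ →
          𝟙-no (v ∈? (edge H e ∩ edge H f)) λ v∈ → none (v , x∈p∩q⁻ (edge H e) (edge H f) v∈)))) z≤n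
  ... | yes (u , u∈e , u∈f) = ∣p∣≤1 {i = u} λ {v} v∈ → same (x∈p∩q⁻ (edge H e) (edge H f) v∈)
    where
    same : ∀ {v} → v ∈ edge H e × v ∈ edge H f → v ≡ u
    same {v} (v∈e , v∈f) with v ≟ u
    ... | yes v≡u = v≡u
    ... | no v≢u with shared-corner e≢f v∈e v∈f | shared-corner e≢f u∈e u∈f
    ...   | j , refl | i , refl with two-corners-side (v≢u ∘ cong corner) v∈e u∈e | two-corners-side
      (v≢u ∘ cong corner) v∈f u∈f
    ...     | l , refl , j≢l , i≢l | l′ , refl , j≢l′ , i≢l′ =
      contradiction (cong side (third-unique j i l l′ (v≢u ∘ cong corner) j≢l i≢l j≢l′ i≢l′)) e≢f

  touching : ∀ κ → ∃[ j ] Touches j κ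
  touching (inj₁ i) with third i i
  ... | j , i≢j , _ = j , i≢j ∘ sym
  touching (inj₂ i) = i , refl

  covered : ∀ v → ∃[ e ] v ∈ edge H e
  covered v with label v in eq
  ... | inj₁ j with third j j
  ...   | l , j≢l , _ = side l , subst (_∈ edge H (side l)) (sym (corner-unique eq)) (corner-∈-side j≢l)
  covered v | inj₂ f = f , Equivalence.from (incident v f) (subst (λ l → Meets kind l f) (sym eq) refl)

  connected : Connected H
  connected u v with covered u | covered v
  ... | e , u∈e | f , v∈f with touching (kind e) | touching (kind f)
  ...   | i , i∈e | j , j∈f with third i j
  ...     | l , i≢l , j≢l = (e , u∈e , corner-∈ i∈e) ◅ (side l , corner-∈-side i≢l , corner-∈-side j≢l)
                          ◅ (f , corner-∈ j∈f , v∈f) ◅ Star.ε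

  boundary : Cycle H
  boundary = record
    { len = 3
    ; len≥2 = s≤s (s≤s z≤n)
    ; vertex = corner
    -- Corners i and i + 1 are joined by the side that misses corner i + 2.
    ; hyperedge = side ∘ next ∘ next
    ; vertex-injective = corner-injective
    ; edge-injective = λ {i} {j} eq → next² i j (side-injective eq)
    ; incidentˡ = λ i → corner-∈-side (proj₁ (opposite i))
    ; incidentʳ = λ i → corner-∈-side (proj₂ (opposite i))
    }
    where
    next² : ∀ (i j : Fin 3) → next (next i) ≡ next (next j) → i ≡ j
    next² = from-yes (all? λ (i : Fin 3) → all? λ (j : Fin 3) →
      (next (next i) ≟ next (next j)) →-dec (i ≟ j))
    opposite : ∀ (i : Fin 3) → i ≢ next (next i) × next i ≢ next (next i)
    opposite = from-yes (all? λ (i : Fin 3) → ¬? (i ≟ next (next i)) ×-dec ¬? (next i ≟ next (next i)))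

  -- The six incidences of corners with sides, described without reference to a cycle, so that any
  -- two cycles can be compared through them.
  OnBoundary : Vertex H → Edge H → Set
  OnBoundary v e = ∃[ j ] ∃[ i ] v ≡ corner j × e ≡ side i × j ≢ i

  module _ (D : Cycle H) where
    open Cycle D

    -- The vertex lies in two consecutive hyperedges of D, which are distinct.
    corner-at : ∀ i → ∃[ j ] vertex i ≡ corner j
    corner-at i with next-surjective i
    ... | i′ , refl =
      shared-corner (next-≢ len≥2 i′ ∘ edge-injective) (incidentˡ (next i′)) (incidentʳ i′)

    cornerIndex : Fin len → Fin 3
    cornerIndex i = proj₁ (corner-at i)

    cornerIndex-injective : ∀ {i j} → cornerIndex i ≡ cornerIndex j → i ≡ j
    cornerIndex-injective {i} {j} eq = vertex-injective
      (trans (proj₂ (corner-at i)) (trans (cong corner eq) (sym (proj₂ (corner-at j)))))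

    side-at : ∀ i → ∃[ l ] hyperedge i ≡ side l × cornerIndex i ≢ l × cornerIndex (next i) ≢ l
    side-at i = two-corners-side (next-≢ len≥2 i ∘ sym ∘ cornerIndex-injective)
      (subst (_∈ edge H (hyperedge i)) (proj₂ (corner-at i)) (incidentˡ i))
      (subst (_∈ edge H (hyperedge i)) (proj₂ (corner-at (next i))) (incidentʳ i))

    sideIndex : Fin len → Fin 3
    sideIndex i = proj₁ (side-at i)

    sideIndex-injective : ∀ {i j} → sideIndex i ≡ sideIndex j → i ≡ j
    sideIndex-injective {i} {j} eq = edge-injective
      (trans (proj₁ (proj₂ (side-at i))) (trans (cong side eq) (sym (proj₁ (proj₂ (side-at j))))))

    -- If a side were missed, D would have length 2, and its two distinct sides would contain the
    -- same two corners, hence miss the same third one.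
    sideIndex-surjective : ∀ l → ∃[ i ] sideIndex i ≡ l
    sideIndex-surjective l with any? (λ i → sideIndex i ≟ l)
    ... | yes found = found
    ... | no none   = contradiction (≤-antisym len≤2 len≥2) len≢2
      where
      len≤2 : len ≤ 2
      len≤2 = injective⇒≤ {f = λ i → punchOut {i = l} {j = sideIndex i} (λ eq → none (i , sym eq))}
        (λ {i} {j} eq → sideIndex-injective (punchOut-injective {i = l} _ _ eq))
      len≢2 : len ≢ 2
      len≢2 refl = contradiction
        (third-unique (cornerIndex 0F) (cornerIndex 1F) (sideIndex 0F) (sideIndex 1F)
          (λ eq → contradiction (cornerIndex-injective {0F} {1F} eq) λ ())
          (proj₁ (proj₂ (proj₂ (side-at 0F)))) (proj₂ (proj₂ (proj₂ (side-at 0F))))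
          (proj₂ (proj₂ (proj₂ (side-at 1F)))) (proj₁ (proj₂ (proj₂ (side-at 1F)))))
        (λ eq → contradiction (sideIndex-injective {0F} {1F} eq) λ ())

    traverses⇔boundary : ∀ v e → Traverses v e ⇔ OnBoundary v e
    traverses⇔boundary v e = mk⇔
      (λ { (i , refl , inj₁ refl) → cornerIndex i , sideIndex i , proj₂ (corner-at i)
                                  , proj₁ (proj₂ (side-at i)) , proj₁ (proj₂ (proj₂ (side-at i)))
         ; (i , refl , inj₂ refl) → cornerIndex (next i) , sideIndex i , proj₂ (corner-at (next i))
                                  , proj₁ (proj₂ (side-at i)) , proj₂ (proj₂ (proj₂ (side-at i))) })
      (λ { (j , l , refl , refl , j≢l) → back j l j≢l })
      where
      back : ∀ j l → j ≢ l → Traverses (corner j) (side l)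
      back j l j≢l with sideIndex-surjective l
      ... | i , refl = i , sym (proj₁ (proj₂ (side-at i))) , Sum.map
        (λ eq → trans (cong corner eq) (sym (proj₂ (corner-at i))))
        (λ eq → trans (cong corner eq) (sym (proj₂ (corner-at (next i)))))
        (one-of-two (cornerIndex i) (cornerIndex (next i)) (sideIndex i) j
          (next-≢ len≥2 i ∘ sym ∘ cornerIndex-injective)
          (proj₁ (proj₂ (proj₂ (side-at i)))) (proj₂ (proj₂ (proj₂ (side-at i)))) j≢l)

  unicyclic : Unicyclic H
  unicyclic = connected , boundary , λ D v e → mk⇔
    (Equivalence.from (traverses⇔boundary D v e) ∘ Equivalence.to (traverses⇔boundary boundary v e))
    (Equivalence.from (traverses⇔boundary boundary v e) ∘ Equivalence.to (traverses⇔boundary D v e))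

total : (Fin 3 → ℕ) → ℕ
total n = ∑ℕ (allFin 3) n

squares : (Fin 3 → ℕ) → ℕ
squares n = ∑ℕ (allFin 3) (λ i → n i * n i)

cornersOf : Kind → ℕ
cornersOf κ = ∑ℕ (allFin 3) (λ j → 𝟙 (touches? j κ))

module _ {H n} (Δ : Triangle H n) where
  open Triangle Δ

  private
    count₁ count₂ : Edge H → Fin 3 → ℕ
    count₁ e i = 𝟙 (kind e ≟ᴷ inj₁ i)
    count₂ e i = 𝟙 (kind e ≟ᴷ inj₂ i)

    sum-sides : ∀ i → ∑ℕ (allFin (size H)) (λ e → count₁ e i) ≡ 1
    sum-sides = tally-side

  triangle-size : size H ≡ 3 + total n
  triangle-size = begin
    size H
      ≡⟨ trans (sym (*-identityʳ _)) (cong (_* 1) (sym (length-allFin (size H)))) ⟩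
    length (allFin (size H)) * 1             ≡⟨ ∑ℕ-const (allFin (size H)) 1 ⟨
    ∑ℕ (allFin (size H)) (λ _ → 1)           ≡⟨ Σℕ.⨁-cong (allFin (size H)) (one ∘ kind) ⟩
    ∑ℕ (allFin (size H)) (λ e → ∑ℕ (allFin 3) (λ i → count₁ e i + count₂ e i))
      ≡⟨ Σℕ.⨁-swap (allFin (size H)) (allFin 3) (λ e i → count₁ e i + count₂ e i) ⟩
    ∑ℕ (allFin 3) (λ i → ∑ℕ (allFin (size H)) (λ e → count₁ e i + count₂ e i))
      ≡⟨ Σℕ.⨁-cong (allFin 3)
        (λ i → trans (Σℕ.⨁-+ (allFin (size H)) (λ e → count₁ e i) (λ e → count₂ e i))
           (cong₂ _+_ (sum-sides i) (pendants i))) ⟩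
    ∑ℕ (allFin 3) (λ i → 1 + n i)            ≡⟨ Σℕ.⨁-+ (allFin 3) (λ _ → 1) n ⟩
    3 + total n                              ∎
    where
    open ≡-Reasoning
    one : ∀ κ → 1 ≡ ∑ℕ (allFin 3) (λ i → 𝟙 (κ ≟ᴷ inj₁ i) + 𝟙 (κ ≟ᴷ inj₂ i))
    one (inj₁ 0F) = refl
    one (inj₁ 1F) = refl
    one (inj₁ 2F) = refl
    one (inj₂ 0F) = refl
    one (inj₂ 1F) = refl
    one (inj₂ 2F) = refl

  degree-corner : ∀ j → degree H (corner j) ≡ 2 + n j
  degree-corner j = begin
    degree H (corner j)                                     ≡⟨ degree≡∑ H (corner j) ⟩
    ∑ℕ (allFin (size H)) (incidence H (corner j))           ≡⟨ Σℕ.⨁-cong (allFin (size H)) (λ e →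
      trans (𝟙-cong (corner j ∈? edge H e) (touches? j (kind e)) corner-∈⁻ corner-∈) (split j (kind e)))
        ⟩
    ∑ℕ (allFin (size H)) (λ e → ∑ℕ (allFin 3) (λ i → 𝟙 (¬? (j ≟ i)) * count₁ e i) + count₂ e j)
      ≡⟨ Σℕ.⨁-+ (allFin (size H)) _ (λ e → count₂ e j) ⟩
    ∑ℕ (allFin (size H)) (λ e → ∑ℕ (allFin 3) (λ i → 𝟙 (¬? (j ≟ i)) * count₁ e i)) + tally _≟ᴷ_ kind
      (inj₂ j)
      ≡⟨ cong₂ _+_ (Σℕ.⨁-swap (allFin (size H)) (allFin 3) (λ e i → 𝟙 (¬? (j ≟ i)) * count₁ e i))
        (pendants j) ⟩
    ∑ℕ (allFin 3) (λ i → ∑ℕ (allFin (size H)) (λ e → 𝟙 (¬? (j ≟ i)) * count₁ e i)) + n j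
      ≡⟨ cong (_+ n j) (Σℕ.⨁-cong (allFin 3) λ i →
        trans (Σℕ.⨁-*ˡ (allFin (size H)) (𝟙 (¬? (j ≟ i))) (λ e → count₁ e i))
           (trans (cong (𝟙 (¬? (j ≟ i)) *_) (sum-sides i)) (*-identityʳ (𝟙 (¬? (j ≟ i)))))) ⟩
    ∑ℕ (allFin 3) (λ i → 𝟙 (¬? (j ≟ i))) + n j               ≡⟨ cong (_+ n j) (two j) ⟩
    2 + n j ∎
    where
    open ≡-Reasoning
    two : ∀ (j : Fin 3) → ∑ℕ (allFin 3) (λ i → 𝟙 (¬? (j ≟ i))) ≡ 2
    two 0F = refl
    two 1F = refl
    two 2F = refl
    split : ∀ j κ → 𝟙 (touches? j κ) ≡
      ∑ℕ (allFin 3) (λ i → 𝟙 (¬? (j ≟ i)) * 𝟙 (κ ≟ᴷ inj₁ i)) + 𝟙 (κ ≟ᴷ inj₂ j)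
    split = λ
      { 0F (inj₁ 0F) → refl ; 0F (inj₁ 1F) → refl ; 0F (inj₁ 2F) → refl
      ; 1F (inj₁ 0F) → refl ; 1F (inj₁ 1F) → refl ; 1F (inj₁ 2F) → refl
      ; 2F (inj₁ 0F) → refl ; 2F (inj₁ 1F) → refl ; 2F (inj₁ 2F) → refl
      ; 0F (inj₂ 0F) → refl ; 0F (inj₂ 1F) → refl ; 0F (inj₂ 2F) → refl
      ; 1F (inj₂ 0F) → refl ; 1F (inj₂ 1F) → refl ; 1F (inj₂ 2F) → refl
      ; 2F (inj₂ 0F) → refl ; 2F (inj₂ 1F) → refl ; 2F (inj₂ 2F) → refl }

  degree-other : ∀ {v f} → label v ≡ inj₂ f → degree H v ≡ 1
  degree-other {v} {f} eq = trans (degree≡∑ H v) (trans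
    (Σℕ.⨁-single (size H) (incidence H v) f λ e e≢f → 𝟙-no (v ∈? edge H e) (λ v∈ →
      e≢f (sym (subst (λ l → Meets kind l e) eq (Equivalence.to (incident v e) v∈)))))
    (𝟙-yes (v ∈? edge H f)
      (Equivalence.from (incident v f) (subst (λ l → Meets kind l f) (sym eq) refl))))

  triangle-∑d² : ∑ℕ (allFin (order H)) (λ v → degree H v * degree H v) ≡ order H +
    (9 + 4 * total n + squares n)
  triangle-∑d² = begin
    ∑ℕ (allFin (order H)) (λ v → degree H v * degree H v)
      ≡⟨ Σℕ.⨁-cong (allFin (order H)) square ⟩
    ∑ℕ (allFin (order H)) (λ v → 1 + ∑ℕ (allFin 3) (λ j → excess j * 𝟙 (label v ≟ᴸ inj₁ j)))
      ≡⟨ Σℕ.⨁-+ (allFin (order H)) (λ _ → 1) _ ⟩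
    ∑ℕ (allFin (order H)) (λ _ → 1) + ∑ℕ (allFin (order H))
      (λ v → ∑ℕ (allFin 3) (λ j → excess j * 𝟙 (label v ≟ᴸ inj₁ j)))
      ≡⟨ cong₂ _+_ (trans (∑ℕ-const (allFin (order H)) 1)
        (trans (*-identityʳ _) (length-allFin (order H))))
           (Σℕ.⨁-swap (allFin (order H)) (allFin 3) (λ v j → excess j * 𝟙 (label v ≟ᴸ inj₁ j))) ⟩
    order H + ∑ℕ (allFin 3) (λ j → ∑ℕ (allFin (order H)) (λ v → excess j * 𝟙 (label v ≟ᴸ inj₁ j)))
      ≡⟨ cong (order H +_) (Σℕ.⨁-cong (allFin 3) λ j → trans (Σℕ.⨁-*ˡ (allFin (order H)) (excess j) _)
           (trans (cong (excess j *_) (tally-corner j)) (*-identityʳ (excess j)))) ⟩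
    order H + ∑ℕ (allFin 3) excess
      ≡⟨ cong (order H +_) (solve 3 (λ a b c →
           (con 3 :+ con 4 :* a :+ a :* a) :+
             ((con 3 :+ con 4 :* b :+ b :* b) :+ ((con 3 :+ con 4 :* c :+ c :* c) :+ con 0))
           := con 9 :+ con 4 :* (a :+ (b :+ (c :+ con 0))) :+ (a :* a :+ (b :* b :+ (c :* c :+ con 0))))
             refl (n 0F) (n 1F) (n 2F)) ⟩
    order H + (9 + 4 * total n + squares n) ∎
    where
    open ≡-Reasoning
    open +-*-Solver
    -- This is (2 + n j)² - 1: every vertex contributes 1 to the sum of squares, and a corner has
    -- degree 2 + n j.
    excess : Fin 3 → ℕ
    excess j = 3 + 4 * n j + n j * n j
    select : ∀ j l → l ≡ inj₁ j → ∑ℕ (allFin 3) (λ i → excess i * 𝟙 (l ≟ᴸ inj₁ i)) ≡ excess j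
    select j _ refl = trans (Σℕ.⨁-single 3 (λ i → excess i * 𝟙 (inj₁ j ≟ᴸ inj₁ i)) j λ i i≢j →
      trans (cong (excess i *_) (𝟙-no (inj₁ j ≟ᴸ inj₁ i) (i≢j ∘ sym ∘ inj₁-injective)))
        (*-zeroʳ (excess i)))
      (trans (cong (excess j *_) (𝟙-yes (inj₁ j ≟ᴸ inj₁ j) refl)) (*-identityʳ (excess j)))
    skip : ∀ f l → l ≡ inj₂ f → ∑ℕ (allFin 3) (λ i → excess i * 𝟙 (l ≟ᴸ inj₁ i)) ≡ 0
    skip f _ refl = Σℕ.⨁-zero (allFin 3) λ i _ →
      trans (cong (excess i *_) (𝟙-no (inj₂ f ≟ᴸ inj₁ i) λ ())) (*-zeroʳ (excess i))
    square : ∀ v → degree H v * degree H v ≡ 1 + ∑ℕ (allFin 3) (λ j → excess j * 𝟙 (label v ≟ᴸ inj₁ j))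
    square v with by-label (label v) refl
      where
      by-label : ∀ l → label v ≡ l → (∃[ j ] label v ≡ inj₁ j) ⊎ (∃[ f ] label v ≡ inj₂ f)
      by-label (inj₁ j) eq = inj₁ (j , eq)
      by-label (inj₂ f) eq = inj₂ (f , eq)
    ... | inj₁ (j , eq) =
      trans (cong (λ d → d * d) (trans (cong (degree H) (corner-unique eq)) (degree-corner j)))
      (trans (solve 1 (λ a → (con 2 :+ a) :* (con 2 :+ a) := con 1 :+ (con 3 :+ con 4 :* a :+ a :* a))
        refl (n j))
        (cong suc (sym (select j (label v) eq))))
    ... | inj₂ (f , eq) =
      trans (cong (λ d → d * d) (degree-other eq)) (cong suc (sym (skip f (label v) eq)))

  -- In a k-uniform hypergraph this determines the number of cored vertices of e from its kind, so
  -- that vertices can be matched once hyperedges are.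
  own-vertices : ∀ e → tally _≟ᴸ_ label (inj₂ e) + cornersOf (kind e) ≡ ∣ edge H e ∣
  own-vertices e = sym (begin
    ∣ edge H e ∣                                    ≡⟨ ∣p∣≡∑ (edge H e) ⟩
    ∑ℕ (allFin (order H)) (λ v → 𝟙 (v ∈? edge H e))
      ≡⟨ Σℕ.⨁-cong (allFin (order H)) (λ v → pointwise v (label v) refl) ⟩
    ∑ℕ (allFin (order H))
      (λ v → 𝟙 (label v ≟ᴸ inj₂ e) + ∑ℕ (allFin 3) (λ j → t j * 𝟙 (label v ≟ᴸ inj₁ j)))
      ≡⟨ Σℕ.⨁-+ (allFin (order H)) (λ v → 𝟙 (label v ≟ᴸ inj₂ e)) _ ⟩
    tally _≟ᴸ_ label (inj₂ e) + ∑ℕ (allFin (order H))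
      (λ v → ∑ℕ (allFin 3) (λ j → t j * 𝟙 (label v ≟ᴸ inj₁ j)))
      ≡⟨ cong (tally _≟ᴸ_ label (inj₂ e) +_) (trans
           (Σℕ.⨁-swap (allFin (order H)) (allFin 3) (λ v j → t j * 𝟙 (label v ≟ᴸ inj₁ j)))
           (Σℕ.⨁-cong (allFin 3) λ j → trans (Σℕ.⨁-*ˡ (allFin (order H)) (t j) _)
             (trans (cong (t j *_) (tally-corner j)) (*-identityʳ (t j))))) ⟩
    tally _≟ᴸ_ label (inj₂ e) + cornersOf (kind e) ∎)
    where
    open ≡-Reasoning
    t : Fin 3 → ℕ
    t j = 𝟙 (touches? j (kind e))
    pointwise : ∀ v l → label v ≡ l →
      𝟙 (v ∈? edge H e) ≡ 𝟙 (label v ≟ᴸ inj₂ e) + ∑ℕ (allFin 3) (λ j → t j * 𝟙 (label v ≟ᴸ inj₁ j))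
    pointwise v (inj₁ j) eq = trans
      (𝟙-cong (v ∈? edge H e) (touches? j (kind e))
        (subst (λ l → Meets kind l e) eq ∘ Equivalence.to (incident v e))
        (Equivalence.from (incident v e) ∘ subst (λ l → Meets kind l e) (sym eq)))
      (sym (cong₂ _+_ (𝟙-no (label v ≟ᴸ inj₂ e) λ eq′ → case-absurd (trans (sym eq) eq′))
        (trans (Σℕ.⨁-single 3 (λ i → t i * 𝟙 (label v ≟ᴸ inj₁ i)) j λ i i≢j → trans
          (cong (t i *_) (𝟙-no (label v ≟ᴸ inj₁ i) λ eq′ →
            i≢j (sym (inj₁-injective (trans (sym eq) eq′))))) (*-zeroʳ (t i)))
          (trans (cong (t j *_) (𝟙-yes (label v ≟ᴸ inj₁ j) eq)) (*-identityʳ (t j))))))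
      where
      case-absurd : ∀ {j : Fin 3} {f : Edge H} → ¬ (inj₁ j ≡ inj₂ f)
      case-absurd ()
    pointwise v (inj₂ f) eq = sym (trans (cong (𝟙 (label v ≟ᴸ inj₂ e) +_)
        (Σℕ.⨁-zero (allFin 3) λ i _ →
          trans (cong (t i *_) (𝟙-no (label v ≟ᴸ inj₁ i) λ eq′ → case-absurd (trans (sym eq) eq′)))
          (*-zeroʳ (t i))))
      (trans (+-identityʳ _) (𝟙-cong (label v ≟ᴸ inj₂ e) (v ∈? edge H e)
        (λ eq′ → Equivalence.from (incident v e) (subst (λ l → Meets kind l e) (sym eq′) refl))
        (λ v∈ → trans eq (cong inj₂
          (subst (λ l → Meets kind l e) eq (Equivalence.to (incident v e) v∈)))))))
      where
      case-absurd : ∀ {j : Fin 3} {f : Edge H} → ¬ (inj₂ f ≡ inj₁ j)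
      case-absurd ()

module _ {k G H n} (Γ : Triangle G n) (Δ : Triangle H n) (uniG : Uniform k G) (uniH : Uniform k H) where
  private
    module Γ = Triangle Γ
    module Δ = Triangle Δ

    tally-kind : ∀ κ → tally _≟ᴷ_ Γ.kind κ ≡ tally _≟ᴷ_ Δ.kind κ
    tally-kind (inj₁ i) = trans (Γ.tally-side i) (sym (Δ.tally-side i))
    tally-kind (inj₂ i) = trans (Γ.pendants i) (sym (Δ.pendants i))

    edgeMatching : ∃[ π ] ∀ e → Δ.kind (π ⟨$⟩ʳ e) ≡ Γ.kind e
    edgeMatching = matching _≟ᴷ_ Γ.kind Δ.kind tally-kind

    φ : Permutation (size G) (size H)
    φ = proj₁ edgeMatching

    transfer : Fin 3 ⊎ Edge G → Fin 3 ⊎ Edge H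
    transfer = Sum.map₂ (φ ⟨$⟩ʳ_)

    φ-injective : ∀ {e f} → φ ⟨$⟩ʳ e ≡ φ ⟨$⟩ʳ f → e ≡ f
    φ-injective {e} {f} eq = trans (sym (inverseˡ φ)) (trans (cong (φ ⟨$⟩ˡ_) eq) (inverseˡ φ))

    tally-own : ∀ e → tally Γ._≟ᴸ_ Γ.label (inj₂ e) ≡ tally Δ._≟ᴸ_ Δ.label (inj₂ (φ ⟨$⟩ʳ e))
    tally-own e = +-cancelʳ-≡ (cornersOf (Γ.kind e)) _ _
      (trans (own-vertices Γ e) (trans (trans (uniG e) (sym (uniH (φ ⟨$⟩ʳ e))))
      (trans (sym (own-vertices Δ (φ ⟨$⟩ʳ e)))
        (cong (λ κ → tally Δ._≟ᴸ_ Δ.label (inj₂ (φ ⟨$⟩ʳ e)) + cornersOf κ) (proj₂ edgeMatching e)))))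

    tally-label : ∀ l → tally Δ._≟ᴸ_ (transfer ∘ Γ.label) l ≡ tally Δ._≟ᴸ_ Δ.label l
    tally-label (inj₁ j) = trans (Σℕ.⨁-cong (allFin (order G)) λ v →
        𝟙-cong (transfer (Γ.label v) Δ.≟ᴸ inj₁ j) (Γ.label v Γ.≟ᴸ inj₁ j) (back (Γ.label v))
          (cong transfer))
      (trans (Γ.tally-corner j) (sym (Δ.tally-corner j)))
      where
      back : ∀ l → transfer l ≡ inj₁ j → l ≡ inj₁ j
      back (inj₁ i) refl = refl
    tally-label (inj₂ f) = trans (Σℕ.⨁-cong (allFin (order G)) λ v →
        𝟙-cong (transfer (Γ.label v) Δ.≟ᴸ inj₂ f) (Γ.label v Γ.≟ᴸ inj₂ e) (back (Γ.label v))
          (λ eq → trans (cong transfer eq) (cong inj₂ (inverseʳ φ))))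
      (trans (tally-own e) (cong (λ g → tally Δ._≟ᴸ_ Δ.label (inj₂ g)) (inverseʳ φ)))
      where
      e : Edge G
      e = φ ⟨$⟩ˡ f
      back : ∀ l → transfer l ≡ inj₂ f → l ≡ inj₂ e
      back (inj₂ g) refl = cong inj₂ (sym (inverseˡ φ))

    vertexMatching : ∃[ π ] ∀ v → Δ.label (π ⟨$⟩ʳ v) ≡ transfer (Γ.label v)
    vertexMatching = matching Δ._≟ᴸ_ (transfer ∘ Γ.label) Δ.label tally-label

    meets-transfer : ∀ l e → Meets Γ.kind l e ⇔ Meets Δ.kind (transfer l) (φ ⟨$⟩ʳ e)
    meets-transfer (inj₁ j) e =
      mk⇔ (subst (Touches j) (sym (proj₂ edgeMatching e))) (subst (Touches j) (proj₂ edgeMatching e))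
    meets-transfer (inj₂ f) e = mk⇔ (cong (φ ⟨$⟩ʳ_)) φ-injective

  -- Hyperedges are matched by kind, then vertices by the label carried along that matching;
  -- incidence depends on kind and label alone, so it is preserved.
  triangle-≅ : G ≅ H
  triangle-≅ = record
    { vertices = proj₁ vertexMatching
    ; edges = φ
    ; incident = λ v e → mk⇔
        (λ v∈ → Equivalence.from (Δ.incident _ _)
          (subst (λ l → Meets Δ.kind l (φ ⟨$⟩ʳ e)) (sym (proj₂ vertexMatching v))
          (Equivalence.to (meets-transfer (Γ.label v) e) (Equivalence.to (Γ.incident v e) v∈))))
        (λ v∈ → Equivalence.from (Γ.incident v e) (Equivalence.from (meets-transfer (Γ.label v) e)
          (subst (λ l → Meets Δ.kind l (φ ⟨$⟩ʳ e)) (proj₂ vertexMatching v)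
            (Equivalence.to (Δ.incident _ _) v∈))))
    }

-- The new corner i is the old corner π i, hence the indices stored in kinds and labels move by the
-- inverse of π.
relabel : ∀ {H n} → Triangle H n → (π : Permutation′ 3) → Triangle H (λ i → n (π ⟨$⟩ʳ i))
relabel {H} {n} Δ π = record
  { kind          = Sum.map to′ to′ ∘ kind
  ; label         = Sum.map₁ to′ ∘ label
  ; side          = side ∘ (π ⟨$⟩ʳ_)
  ; corner        = corner ∘ (π ⟨$⟩ʳ_)
  ; kind-side     = λ i → trans (cong (Sum.map to′ to′) (kind-side _)) (cong inj₁ (inverseˡ π))
  ; side-unique   = λ {i} {e} eq → side-unique (kind⁻₁ (kind e) eq)
  ; label-corner  = λ i → trans (cong (Sum.map₁ to′) (label-corner _)) (cong inj₁ (inverseˡ π))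
  ; corner-unique = λ {i} {v} eq → corner-unique (label⁻ (label v) eq)
  ; pendants      = λ i → trans (Σℕ.⨁-cong (allFin (size H)) λ e →
      𝟙-cong (Sum.map to′ to′ (kind e) ≟ᴷ inj₂ i) (kind e ≟ᴷ inj₂ (π ⟨$⟩ʳ i)) (kind⁻₂ (kind e))
        (λ eq → trans (cong (Sum.map to′ to′) eq) (cong inj₂ (inverseˡ π)))) (pendants (π ⟨$⟩ʳ i))
  ; incident      = λ v e → mk⇔ (to-meets (label v) e ∘ Equivalence.to (incident v e))
                                (Equivalence.from (incident v e) ∘ from-meets (label v) e)
  }
  where
  open Triangle Δ
  to′ : Fin 3 → Fin 3
  to′ = π ⟨$⟩ˡ_
  to′⁻ : ∀ {i j} → to′ i ≡ j → i ≡ π ⟨$⟩ʳ j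
  to′⁻ refl = sym (inverseʳ π)
  kind⁻₁ : ∀ κ {i} → Sum.map to′ to′ κ ≡ inj₁ i → κ ≡ inj₁ (π ⟨$⟩ʳ i)
  kind⁻₁ (inj₁ l) eq = cong inj₁ (to′⁻ (inj₁-injective eq))
  kind⁻₂ : ∀ κ {i} → Sum.map to′ to′ κ ≡ inj₂ i → κ ≡ inj₂ (π ⟨$⟩ʳ i)
  kind⁻₂ (inj₂ l) eq = cong inj₂ (to′⁻ (inj₂-injective eq))
  label⁻ : ∀ (l : Fin 3 ⊎ Edge H) {i} → Sum.map₁ to′ l ≡ inj₁ i → l ≡ inj₁ (π ⟨$⟩ʳ i)
  label⁻ (inj₁ j) eq = cong inj₁ (to′⁻ (inj₁-injective eq))
  to′-injective : ∀ {i j} → to′ i ≡ to′ j → i ≡ j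
  to′-injective eq = trans (to′⁻ eq) (inverseʳ π)
  touches-to : ∀ j κ → Touches j κ → Touches (to′ j) (Sum.map to′ to′ κ)
  touches-to j (inj₁ i) j≢i = j≢i ∘ to′-injective
  touches-to j (inj₂ i) refl = refl
  touches-from : ∀ j κ → Touches (to′ j) (Sum.map to′ to′ κ) → Touches j κ
  touches-from j (inj₁ i) j≢i = j≢i ∘ cong to′
  touches-from j (inj₂ i) eq  = to′-injective eq
  to-meets : ∀ l e → Meets kind l e → Meets (Sum.map to′ to′ ∘ kind) (Sum.map₁ to′ l) e
  to-meets (inj₁ j) e t = touches-to j (kind e) t
  to-meets (inj₂ f) e t = t
  from-meets : ∀ l e → Meets (Sum.map to′ to′ ∘ kind) (Sum.map₁ to′ l) e → Meets kind l e
  from-meets (inj₁ j) e t = touches-from j (kind e) t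
  from-meets (inj₂ f) e t = t

-- Recognising a triangle with pendant hyperedges

module FromCorners {H : Hypergraph} (linear : Linear H) (connected : Connected H)
  (member : ∀ e → ∃[ v ] v ∈ edge H e) (covered : ∀ v → ∃[ e ] v ∈ edge H e)
  (corner : Fin 3 → Vertex H) (corner-injective : ∀ {i j} → corner i ≡ corner j → i ≡ j)
  (side : Fin 3 → Edge H) (side-injective : ∀ {i j} → side i ≡ side j → i ≡ j)
  (∈side : ∀ {j i} → j ≢ i → corner j ∈ edge H (side i))
  (simple : ∀ v → (∀ i → v ≢ corner i) → degree H v ≤ 1) where

  only-edge : ∀ {v} → (∀ i → v ≢ corner i) → ∀ {e f} → v ∈ edge H e → v ∈ edge H f → e ≡ f
  only-edge {v} v≢ {e} {f} v∈e v∈f with e ≟ f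
  ... | yes e≡f = e≡f
  ... | no e≢f  = contradiction (simple v v≢) (<⇒≱ (subst₂ _≤_
    (cong₂ _+_ (𝟙-yes (v ∈? edge H e) v∈e) (𝟙-yes (v ∈? edge H f) v∈f)) (sym (degree≡∑ H v))
    (∑ℕ-two (incidence H v) e≢f (∈-allFin e) (∈-allFin f))))

  -- A hyperedge without corners would have only vertices of degree one, so no path could leave it
  -- to reach a corner.
  touch : ∀ e → ∃[ j ] corner j ∈ edge H e
  touch e with any? (λ j → corner j ∈? edge H e)
  ... | yes found = found
  ... | no none   = contradiction (0F , along (proj₂ (member e)) (connected _ (corner 0F))) none
    where
    along : ∀ {u w} → u ∈ edge H e → Star (Adjacent H) u w → w ∈ edge H e
    along u∈ Star.ε                         = u∈
    along u∈ ((f , u∈f , x∈f) ◅ path) = along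
      (subst (λ g → _ ∈ edge H g) (only-edge (λ i u≡ → none (i , subst (_∈ edge H e) u≡ u∈)) u∈f u∈)
        x∈f) path

  -- Otherwise `side i` would hold all three corners and share two of them with another side,
  -- against linearity.
  ∉side : ∀ {i} → ¬ corner i ∈ edge H (side i)
  ∉side {i} i∈ with third i i
  ... | j , i≢j , _ with third i j
  ...   | l , i≢l , j≢l =
    contradiction (side-injective (linear-unique {H} linear (i≢l ∘ corner-injective)
    i∈ (∈side (i≢l ∘ sym)) (∈side i≢j) (∈side (j≢l ∘ sym)))) i≢j

  -- Two corners in e would make e, by linearity, the side through both.
  at-most-one : ∀ {e j l} → (∀ i → e ≢ side i) → corner j ∈ edge H e → corner l ∈ edge H e → j ≡ l
  at-most-one {e} {j} {l} e≢ j∈ l∈ with j ≟ l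
  ... | yes j≡l = j≡l
  ... | no j≢l with third j l
  ...   | i , j≢i , l≢i =
    contradiction (linear-unique {H} linear (j≢l ∘ corner-injective) j∈ l∈ (∈side j≢i) (∈side l≢i))
    (e≢ i)

  kind : Edge H → Kind
  kind e with any? (λ i → e ≟ side i)
  ... | yes (i , _) = inj₁ i
  ... | no _        = inj₂ (proj₁ (touch e))

  -- Away from the corners the hyperedge chosen by `covered` is the only one, by `only-edge`.
  label : Vertex H → Fin 3 ⊎ Edge H
  label v with any? (λ j → v ≟ corner j)
  ... | yes (j , _) = inj₁ j
  ... | no _        = inj₂ (proj₁ (covered v))

  ∈⇔touches : ∀ j e → corner j ∈ edge H e ⇔ Touches j (kind e)
  ∈⇔touches j e with any? (λ i → e ≟ side i)
  ... | yes (i , refl) = mk⇔ (λ { j∈ refl → ∉side j∈ }) ∈side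
  ... | no none        = mk⇔ (λ j∈ → at-most-one (λ i eq → none (i , eq)) j∈ (proj₂ (touch e)))
                             (λ { refl → proj₂ (touch e) })

  triangle : Triangle H (λ i → tally _≟ᴷ_ kind (inj₂ i))
  triangle = record
    { kind = kind ; label = label ; side = side ; corner = corner
    ; kind-side = kind-side ; side-unique = side-unique
    ; label-corner = label-corner ; corner-unique = corner-unique
    ; pendants = λ _ → refl ; incident = incident }
    where
    kind-side : ∀ i → kind (side i) ≡ inj₁ i
    kind-side i with any? (λ j → side i ≟ side j)
    ... | yes (j , eq) = cong inj₁ (sym (side-injective eq))
    ... | no none      = contradiction (i , refl) none
    side-unique : ∀ {i e} → kind e ≡ inj₁ i → e ≡ side i
    side-unique {i} {e} eq with any? (λ j → e ≟ side j)
    side-unique refl | yes (i , e≡) = e≡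
    label-corner : ∀ i → label (corner i) ≡ inj₁ i
    label-corner i with any? (λ j → corner i ≟ corner j)
    ... | yes (j , eq) = cong inj₁ (sym (corner-injective eq))
    ... | no none      = contradiction (i , refl) none
    corner-unique : ∀ {i v} → label v ≡ inj₁ i → v ≡ corner i
    corner-unique {i} {v} eq with any? (λ j → v ≟ corner j)
    corner-unique refl | yes (i , v≡) = v≡
    incident : ∀ v e → v ∈ edge H e ⇔ Meets kind (label v) e
    incident v e with any? (λ j → v ≟ corner j)
    ... | yes (j , refl) = ∈⇔touches j e
    ... | no none        = mk⇔ (only-edge (λ i eq → none (i , eq)) (proj₂ (covered v)))
                               (λ { refl → proj₂ (covered v) })

-- Hypercycles with pendant hyperedges as triangles

∣++∣ : ∀ {m n} (p : Subset m) (q : Subset n) → ∣ p Vec.++ q ∣ ≡ ∣ p ∣ + ∣ q ∣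
∣++∣ []            q = refl
∣++∣ (inside ∷ p)  q = cong suc (∣++∣ p q)
∣++∣ (outside ∷ p) q = ∣++∣ p q

↑ˡ∈++ : ∀ {m n} (p : Subset m) (q : Subset n) i → i ↑ˡ n ∈ p Vec.++ q ⇔ i ∈ p
↑ˡ∈++ p q i = mk⇔ (to p i) (from p i)
  where
  to : ∀ {m} (p : Subset m) i → i ↑ˡ _ ∈ p Vec.++ q → i ∈ p
  to (_ ∷ p) zero    here       = here
  to (_ ∷ p) (suc i) (there i∈) = there (to p i i∈)
  from : ∀ {m} (p : Subset m) i → i ∈ p → i ↑ˡ _ ∈ p Vec.++ q
  from (_ ∷ p) zero    here       = here
  from (_ ∷ p) (suc i) (there i∈) = there (from p i i∈)

↑ʳ∈++ : ∀ {m n} (p : Subset m) (q : Subset n) i → m ↑ʳ i ∈ p Vec.++ q ⇔ i ∈ q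
↑ʳ∈++ p q i = mk⇔ (to p) (from p)
  where
  to : ∀ {m} (p : Subset m) → m ↑ʳ i ∈ p Vec.++ q → i ∈ q
  to []      i∈         = i∈
  to (_ ∷ p) (there i∈) = to p i∈
  from : ∀ {m} (p : Subset m) → i ∈ q → m ↑ʳ i ∈ p Vec.++ q
  from []      i∈ = i∈
  from (_ ∷ p) i∈ = there (from p i∈)

combine∈concat : ∀ {m n} (ps : Vec (Subset n) m) i j → combine i j ∈ Vec.concat ps ⇔ j ∈ lookup ps i
combine∈concat (p ∷ ps) zero    j = ↑ˡ∈++ p (Vec.concat ps) j
combine∈concat (p ∷ ps) (suc i) j = mk⇔
  (Equivalence.to (combine∈concat ps i j) ∘ Equivalence.to (↑ʳ∈++ p (Vec.concat ps) (combine i j)))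
  (Equivalence.from (↑ʳ∈++ p (Vec.concat ps) (combine i j)) ∘ Equivalence.from (combine∈concat ps i j))

retally : ∀ {H n n′} → (∀ i → n i ≡ n′ i) → Triangle H n → Triangle H n′
retally n≡ Δ = record { Triangle Δ ; pendants = λ i → trans (Triangle.pendants Δ i) (n≡ i) }

bump : Fin 3 → (Fin 3 → ℕ) → Fin 3 → ℕ
bump i n j = 𝟙 (i ≟ j) + n j

module _ (k : ℕ) {H n} (Δ : Triangle H n) (i : Fin 3) where
  open Triangle Δ

  private
    H⁺ : Hypergraph
    H⁺ = addPendant k H (corner i)

    kind⁺ : Edge H⁺ → Kind
    kind⁺ zero    = inj₂ i
    kind⁺ (suc e) = kind e

    label⁺ : Vertex H⁺ → Fin 3 ⊎ Edge H⁺
    label⁺ v = Sum.[ Sum.map₂ suc ∘ label , (λ _ → inj₂ zero) ]′ (splitAt (order H) v)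

    label⁺-↑ˡ : ∀ u → label⁺ (u ↑ˡ (k ∸ 1)) ≡ Sum.map₂ suc (label u)
    label⁺-↑ˡ u = cong Sum.[ Sum.map₂ suc ∘ label , (λ _ → inj₂ zero) ]′
      (splitAt-↑ˡ (order H) u (k ∸ 1))

    meets-↑ˡ : ∀ u e → u ↑ˡ (k ∸ 1) ∈ edge H⁺ e ⇔ Meets kind⁺ (Sum.map₂ suc (label u)) e
    meets-↑ˡ u zero = mk⇔
      (λ u∈ → subst (λ l → Meets kind⁺ (Sum.map₂ suc l) zero) (trans (sym (label-corner i)) (cong label
        (sym (x∈⁅y⁆⇒x≡y (corner i) (Equivalence.to (↑ˡ∈++ ⁅ corner i ⁆ ⊤ u) u∈))))) refl)
      (λ m → Equivalence.from (↑ˡ∈++ ⁅ corner i ⁆ ⊤ u)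
        (subst (_∈ ⁅ corner i ⁆) (sym (is-corner (label u) refl m)) (x∈⁅x⁆ (corner i))))
      where
      is-corner : ∀ l → label u ≡ l → Meets kind⁺ (Sum.map₂ suc l) zero → u ≡ corner i
      is-corner (inj₁ j) eq refl = corner-unique eq
    meets-↑ˡ u (suc e) = mk⇔
      (to (label u) ∘ Equivalence.to (incident u e) ∘ Equivalence.to (↑ˡ∈++ (edge H e) ⊥ u))
      (Equivalence.from (↑ˡ∈++ (edge H e) ⊥ u) ∘ Equivalence.from (incident u e) ∘ from (label u))
      where
      to : ∀ l → Meets kind l e → Meets kind⁺ (Sum.map₂ suc l) (suc e)
      to (inj₁ j) t = t
      to (inj₂ f) refl = refl
      from : ∀ l → Meets kind⁺ (Sum.map₂ suc l) (suc e) → Meets kind l e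
      from (inj₁ j) t = t
      from (inj₂ f) refl = refl

    meets-↑ʳ : ∀ w e → order H ↑ʳ w ∈ edge H⁺ e ⇔ Meets kind⁺ (inj₂ zero) e
    meets-↑ʳ w zero    = mk⇔ (λ _ → refl) (λ _ → Equivalence.from (↑ʳ∈++ ⁅ corner i ⁆ ⊤ w) ∈⊤)
    meets-↑ʳ w (suc e) = mk⇔ (λ w∈ → contradiction (Equivalence.to (↑ʳ∈++ (edge H e) ⊥ w) w∈) ∉⊥) (λ ())

  addPendant-triangle : Triangle H⁺ (bump i n)
  addPendant-triangle = record
    { kind          = kind⁺
    ; label         = label⁺
    ; side          = λ j → suc (side j)
    ; corner        = λ j → corner j ↑ˡ (k ∸ 1)
    ; kind-side     = kind-side
    ; side-unique   = λ { {e = suc e} eq → cong suc (side-unique eq) }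
    ; label-corner  = λ j → trans (label⁺-↑ˡ (corner j)) (cong (Sum.map₂ suc) (label-corner j))
    ; corner-unique = λ {j} {v} → corner-unique⁺ j v
    ; pendants      = λ j → trans (Σℕ.⨁-suc (size H) (λ e → 𝟙 (kind⁺ e ≟ᴷ inj₂ j)))
        (cong₂ _+_ (𝟙-cong (inj₂ i ≟ᴷ inj₂ j) (i ≟ j) inj₂-injective (cong inj₂)) (pendants j))
    ; incident      = incident⁺
    }
    where
    corner-unique⁺ : ∀ j v → label⁺ v ≡ inj₁ j → v ≡ corner j ↑ˡ (k ∸ 1)
    corner-unique⁺ j v eq with splitAt (order H) v in split
    ... | inj₁ u = trans (sym (splitAt⁻¹-↑ˡ split))
      (cong (_↑ˡ (k ∸ 1)) (corner-unique (back (label u) eq)))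
      where
      back : ∀ (l : Fin 3 ⊎ Edge H) → Sum.map₂ suc l ≡ inj₁ j → l ≡ inj₁ j
      back (inj₁ _) refl = refl
    incident⁺ : ∀ v e → v ∈ edge H⁺ e ⇔ Meets kind⁺ (label⁺ v) e
    incident⁺ v e with splitAt (order H) v in split
    ... | inj₁ u = subst (λ x → x ∈ edge H⁺ e ⇔ Meets kind⁺ (Sum.map₂ suc (label u)) e)
      (splitAt⁻¹-↑ˡ split) (meets-↑ˡ u e)
    ... | inj₂ w = subst (λ x → x ∈ edge H⁺ e ⇔ Meets kind⁺ (inj₂ zero) e) (splitAt⁻¹-↑ʳ split)
      (meets-↑ʳ w e)

addPendant-uniform : ∀ {k H} → 1 ≤ k → Uniform k H → ∀ v → Uniform k (addPendant k H v)
addPendant-uniform {k} {H} 1≤k uniform v zero = trans (∣++∣ ⁅ v ⁆ (⊤ {k ∸ 1}))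
  (trans (cong₂ _+_ (∣⁅x⁆∣≡1 v) (∣⊤∣≡n (k ∸ 1))) (m+[n∸m]≡n 1≤k))
addPendant-uniform {k} {H} 1≤k uniform v (suc e) = trans (∣++∣ (edge H e) (⊥ {k ∸ 1}))
  (trans (cong₂ _+_ (uniform e) (∣⊥∣≡0 (k ∸ 1))) (+-identityʳ k))

bumps : ∀ {t} → Vec (Fin 3) t → (Fin 3 → ℕ) → Fin 3 → ℕ
bumps []       n = n
bumps (i ∷ is) n = bumps is (bump i n)

addPendants-triangle : ∀ k {H n t} (Δ : Triangle H n) (is : Vec (Fin 3) t) →
  Triangle (addPendants k H (Vec.map (Triangle.corner Δ) is)) (bumps is n)
addPendants-triangle k Δ []       = Δ
addPendants-triangle k {H} Δ (i ∷ is) = subst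
  (λ vs → Triangle (addPendants k (addPendant k H (Triangle.corner Δ i)) vs) _)
  (map-∘ (_↑ˡ (k ∸ 1)) (Triangle.corner Δ) is)
  (addPendants-triangle k (addPendant-triangle k Δ i) is)

addPendants-uniform : ∀ {k H t} → 1 ≤ k → Uniform k H → (vs : Vec (Vertex H) t) →
  Uniform k (addPendants k H vs)
addPendants-uniform 1≤k uniform []       = uniform
addPendants-uniform 1≤k uniform (v ∷ vs) =
  addPendants-uniform 1≤k (addPendant-uniform 1≤k uniform v) (Vec.map _ vs)

bumps-++ : ∀ {s t} (is : Vec (Fin 3) s) (js : Vec (Fin 3) t) n →
  bumps (is Vec.++ js) n ≡ bumps js (bumps is n)
bumps-++ []       js n = refl
bumps-++ (i ∷ is) js n = bumps-++ is js (bump i n)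

bumps-replicate : ∀ a i n j → bumps (Vec.replicate a i) n j ≡ a * 𝟙 (i ≟ j) + n j
bumps-replicate zero    i n j = refl
bumps-replicate (suc a) i n j = trans (bumps-replicate a i (bump i n) j)
  (trans (sym (+-assoc (a * 𝟙 (i ≟ j)) _ _)) (cong (_+ n j) (+-comm (a * 𝟙 (i ≟ j)) _)))

⟨_,_,_⟩ : ℕ → ℕ → ℕ → Fin 3 → ℕ
⟨ a , b , c ⟩ = lookup (a ∷ b ∷ c ∷ [])

module _ (k : ℕ) where
  private
    H₃ : Hypergraph
    H₃ = hypercycle k 3

    c : ℕ
    c = k ∸ 2

    blocks : Fin 3 → Vec (Subset c) 3
    blocks b = Vec.replicate 3 ⊥ Vec.[ b ]≔ ⊤

    label₃ : Vertex H₃ → Fin 3 ⊎ Edge H₃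
    label₃ v = Sum.map₂ (proj₁ ∘ remQuot c) (splitAt 3 v)

    -- Hyperedge b of the hypercycle joins corners b and b + 1, so the corner that it misses is b +
    -- 2. The inverse of this shift modulo 3 is `next`.
    opposite : Fin 3 → Fin 3
    opposite b = next (next b)

    opposite-next : ∀ (i : Fin 3) → opposite (next i) ≡ i
    opposite-next = from-yes (all? λ (i : Fin 3) → opposite (next i) ≟ i)

    next-opposite : ∀ (b : Fin 3) → next (opposite b) ≡ b
    next-opposite = from-yes (all? λ (b : Fin 3) → next (opposite b) ≟ b)

    on-side⁻ : ∀ (j b : Fin 3) → j ∈ ⁅ b ⁆ ∪ ⁅ next b ⁆ → j ≢ opposite b
    on-side⁻ = from-yes
      (all? λ (j : Fin 3) → all? λ (b : Fin 3) → (j ∈? ⁅ b ⁆ ∪ ⁅ next b ⁆) →-dec ¬? (j ≟ opposite b))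

    on-side⁺ : ∀ (j b : Fin 3) → j ≢ opposite b → j ∈ ⁅ b ⁆ ∪ ⁅ next b ⁆
    on-side⁺ = from-yes
      (all? λ (j : Fin 3) → all? λ (b : Fin 3) → ¬? (j ≟ opposite b) →-dec (j ∈? ⁅ b ⁆ ∪ ⁅ next b ⁆))

    incident-corner : ∀ j b → j ↑ˡ (3 * c) ∈ edge H₃ b ⇔ j ≢ opposite b
    incident-corner j b = mk⇔
      (on-side⁻ j b ∘ Equivalence.to (↑ˡ∈++ (⁅ b ⁆ ∪ ⁅ next b ⁆) (Vec.concat (blocks b)) j))
      (Equivalence.from (↑ˡ∈++ (⁅ b ⁆ ∪ ⁅ next b ⁆) (Vec.concat (blocks b)) j) ∘ on-side⁺ j b)

    incident-cored : ∀ w b → 3 ↑ʳ w ∈ edge H₃ b ⇔ proj₁ (remQuot {3} c w) ≡ b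
    incident-cored w b = mk⇔ to from
      where
      a = proj₁ (remQuot {3} c w)
      x = proj₂ (remQuot {3} c w)
      ∈blocks : w ∈ Vec.concat (blocks b) ⇔ x ∈ lookup (blocks b) a
      ∈blocks = subst (λ y → y ∈ Vec.concat (blocks b) ⇔ x ∈ lookup (blocks b) a)
        (combine-remQuot {3} c w) (combine∈concat (blocks b) a x)
      to : 3 ↑ʳ w ∈ edge H₃ b → a ≡ b
      to w∈ with a ≟ b
      ... | yes a≡b = a≡b
      ... | no a≢b  = contradiction
        (subst (x ∈_) (trans (lookup∘update′ a≢b (Vec.replicate 3 ⊥) ⊤) (lookup-replicate a ⊥))
        (Equivalence.to ∈blocks
          (Equivalence.to (↑ʳ∈++ (⁅ b ⁆ ∪ ⁅ next b ⁆) (Vec.concat (blocks b)) w) w∈))) ∉⊥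
      from : a ≡ b → 3 ↑ʳ w ∈ edge H₃ b
      from a≡b = Equivalence.from (↑ʳ∈++ (⁅ b ⁆ ∪ ⁅ next b ⁆) (Vec.concat (blocks b)) w)
        (Equivalence.from ∈blocks
        (subst (x ∈_) (sym
          (trans (cong (lookup (blocks b)) a≡b) (lookup∘update b (Vec.replicate 3 ⊥) ⊤))) ∈⊤))

  hypercycle-triangle : Triangle H₃ (λ _ → 0)
  hypercycle-triangle = record
    { kind          = inj₁ ∘ opposite
    ; label         = label₃
    ; side          = next
    ; corner        = _↑ˡ (3 * c)
    ; kind-side     = cong inj₁ ∘ opposite-next
    ; side-unique   = λ {i} {e} eq → trans (sym (next-opposite e)) (cong next (inj₁-injective eq))
    ; label-corner  = λ i → cong (Sum.map₂ (proj₁ ∘ remQuot c)) (splitAt-↑ˡ 3 i (3 * c))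
    ; corner-unique = λ {i} {v} → corner-unique₃ i v
    ; pendants      = λ _ → refl
    ; incident      = incident₃
    }
    where
    corner-unique₃ : ∀ i v → label₃ v ≡ inj₁ i → v ≡ i ↑ˡ (3 * c)
    corner-unique₃ i v eq with splitAt 3 v in split
    corner-unique₃ i v refl | inj₁ _ = sym (splitAt⁻¹-↑ˡ split)
    incident₃ : ∀ v e → v ∈ edge H₃ e ⇔ Meets (inj₁ ∘ opposite) (label₃ v) e
    incident₃ v e with splitAt 3 v in split
    ... | inj₁ j = subst (λ x → x ∈ edge H₃ e ⇔ j ≢ opposite e) (splitAt⁻¹-↑ˡ split)
      (incident-corner j e)
    ... | inj₂ w = subst (λ x → x ∈ edge H₃ e ⇔ proj₁ (remQuot {3} c w) ≡ e) (splitAt⁻¹-↑ʳ split)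
      (incident-cored w e)

  hypercycle-uniform : 2 ≤ k → Uniform k H₃
  hypercycle-uniform 2≤k b = trans (∣++∣ (⁅ b ⁆ ∪ ⁅ next b ⁆) (Vec.concat (blocks b)))
    (trans (cong₂ _+_ (two b) (block b)) (m+[n∸m]≡n 2≤k))
    where
    two : ∀ (b : Fin 3) → ∣ ⁅ b ⁆ ∪ ⁅ next b ⁆ ∣ ≡ 2
    two 0F = refl
    two 1F = refl
    two 2F = refl
    three : ∀ (p q r : Subset c) → ∣ p Vec.++ (q Vec.++ (r Vec.++ [])) ∣ ≡ ∣ p ∣ + (∣ q ∣ + (∣ r ∣ + 0))
    three p q r = trans (∣++∣ p _) (cong (∣ p ∣ +_) (trans (∣++∣ q _) (cong (∣ q ∣ +_) (∣++∣ r []))))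
    empty : ∣ ⊥ {c} ∣ ≡ 0
    empty = ∣⊥∣≡0 c
    block : ∀ b → ∣ Vec.concat (blocks b) ∣ ≡ c
    block 0F = trans (three ⊤ ⊥ ⊥)
      (trans (cong₂ _+_ (∣⊤∣≡n c) (cong₂ _+_ empty (cong (_+ 0) empty))) (+-identityʳ c))
    block 1F = trans (three ⊥ ⊤ ⊥)
      (trans (cong₂ _+_ empty (cong₂ _+_ (∣⊤∣≡n c) (cong (_+ 0) empty))) (+-identityʳ c))
    block 2F = trans (three ⊥ ⊥ ⊤)
      (trans (cong₂ _+_ empty (cong₂ _+_ empty (cong (_+ 0) (∣⊤∣≡n c)))) (+-identityʳ c))

  C₃-triangle : ∀ n₁ n₂ n₃ → Triangle (C₃ k n₁ n₂ n₃) ⟨ n₁ , n₂ , n₃ ⟩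
  C₃-triangle n₁ n₂ n₃ =
    retally tallies (subst (λ vs → Triangle (addPendants k H₃ vs) (bumps is (λ _ → 0))) corners
    (addPendants-triangle k hypercycle-triangle is))
    where
    is = Vec.replicate n₁ 0F Vec.++ Vec.replicate n₂ 1F Vec.++ Vec.replicate n₃ 2F
    f : Fin 3 → Vertex H₃
    f = _↑ˡ (3 * c)
    corners : Vec.map f is ≡ Vec.replicate n₁ (f 0F) Vec.++ Vec.replicate n₂ (f 1F) Vec.++ Vec.replicate
      n₃ (f 2F)
    corners = trans (map-++ f (Vec.replicate n₁ 0F) _) (cong₂ Vec._++_ (map-replicate f 0F n₁)
      (trans (map-++ f (Vec.replicate n₂ 1F) _)
        (cong₂ Vec._++_ (map-replicate f 1F n₂) (map-replicate f 2F n₃))))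
    tallies : ∀ j → bumps is (λ _ → 0) j ≡ ⟨ n₁ , n₂ , n₃ ⟩ j
    tallies j = begin
      bumps is (λ _ → 0) j
        ≡⟨ cong (λ n → n j)
          (trans (bumps-++ (Vec.replicate n₁ 0F) _ _) (bumps-++ (Vec.replicate n₂ 1F) _ _)) ⟩
      bumps (Vec.replicate n₃ 2F) (bumps (Vec.replicate n₂ 1F) (bumps (Vec.replicate n₁ 0F) (λ _ → 0)))
        j
        ≡⟨ trans (bumps-replicate n₃ 2F _ j) (cong (n₃ * 𝟙 (2F ≟ j) +_)
             (trans (bumps-replicate n₂ 1F _ j)
               (cong (n₂ * 𝟙 (1F ≟ j) +_) (bumps-replicate n₁ 0F _ j)))) ⟩
      n₃ * 𝟙 (2F ≟ j) + (n₂ * 𝟙 (1F ≟ j) + (n₁ * 𝟙 (0F ≟ j) + 0))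
        ≡⟨ evaluate j ⟩
      ⟨ n₁ , n₂ , n₃ ⟩ j ∎
      where
      open ≡-Reasoning
      open +-*-Solver
      evaluate : ∀ (j : Fin 3) →
        n₃ * 𝟙 (2F ≟ j) + (n₂ * 𝟙 (1F ≟ j) + (n₁ * 𝟙 (0F ≟ j) + 0)) ≡ ⟨ n₁ , n₂ , n₃ ⟩ j
      evaluate 0F = solve 3 (λ a b d → d :* con 0 :+ (b :* con 0 :+ (a :* con 1 :+ con 0)) := a) refl n₁
        n₂ n₃
      evaluate 1F = solve 3 (λ a b d → d :* con 0 :+ (b :* con 1 :+ (a :* con 0 :+ con 0)) := b) refl n₁
        n₂ n₃
      evaluate 2F = solve 3 (λ a b d → d :* con 1 :+ (b :* con 0 :+ (a :* con 0 :+ con 0)) := d) refl n₁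
        n₂ n₃

  C₃-uniform : 2 ≤ k → ∀ n₁ n₂ n₃ → Uniform k (C₃ k n₁ n₂ n₃)
  C₃-uniform 2≤k n₁ n₂ n₃ = addPendants-uniform {k} {H₃} (<⇒≤ 2≤k) (hypercycle-uniform 2≤k)
    (Vec.replicate n₁ (f 0F) Vec.++ Vec.replicate n₂ (f 1F) Vec.++ Vec.replicate n₃ (f 2F))
    where
    f : Fin 3 → Vertex H₃
    f = _↑ˡ (3 * c)

-- Extremal sums of squares of degrees

∑ℕ-permute : ∀ {m n} (π : Permutation m n) (f : Fin n → ℕ) →
  ∑ℕ (allFin m) (f ∘ (π ⟨$⟩ʳ_)) ≡ ∑ℕ (allFin n) f
∑ℕ-permute {m} {n} π f = begin
  ∑ℕ (allFin m) (f ∘ (π ⟨$⟩ʳ_))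
    ≡⟨ Σℕ.⨁-cong (allFin m) (λ i → sym (trans (Σℕ.⨁-single n _ (π ⟨$⟩ʳ i) λ j j≢ →
         trans (cong (f j *_) (𝟙-no (π ⟨$⟩ʳ i ≟ j) (j≢ ∘ sym))) (*-zeroʳ (f j)))
         (trans (cong (f (π ⟨$⟩ʳ i) *_) (𝟙-yes (π ⟨$⟩ʳ i ≟ π ⟨$⟩ʳ i) refl)) (*-identityʳ _)))) ⟩
  ∑ℕ (allFin m) (λ i → ∑ℕ (allFin n) (λ j → f j * 𝟙 (π ⟨$⟩ʳ i ≟ j)))
    ≡⟨ Σℕ.⨁-swap (allFin m) (allFin n) (λ i j → f j * 𝟙 (π ⟨$⟩ʳ i ≟ j)) ⟩
  ∑ℕ (allFin n) (λ j → ∑ℕ (allFin m) (λ i → f j * 𝟙 (π ⟨$⟩ʳ i ≟ j)))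
    ≡⟨ Σℕ.⨁-cong (allFin n) (λ j → trans (Σℕ.⨁-*ˡ (allFin m) (f j) _) (trans
         (cong (f j *_) (tally-unique _≟_ (π ⟨$⟩ʳ_) (π ⟨$⟩ˡ j) (inverseʳ π) λ eq →
           trans (sym (inverseˡ π)) (cong (π ⟨$⟩ˡ_) eq)))
         (*-identityʳ (f j)))) ⟩
  ∑ℕ (allFin n) f ∎
  where open ≡-Reasoning

-- An isomorphism permutes the degrees. This keeps the two candidates of `second-last` apart and
-- carries their values to isomorphic copies.
≅⇒∑d²≡ : ∀ {G H} → G ≅ H → ∑d² G ≡ ∑d² H
≅⇒∑d²≡ {G} {H} iso = trans (Σℕ.⨁-cong (allFin (order G)) (λ v → cong (λ d → d * d) (degree≡ v)))
  (∑ℕ-permute vertices (λ v → degree H v * degree H v))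
  where
  open _≅_ iso
  degree≡ : ∀ v → degree G v ≡ degree H (vertices ⟨$⟩ʳ v)
  degree≡ v = trans (degree≡∑ G v) (trans (Σℕ.⨁-cong (allFin (size G)) λ e →
      𝟙-cong (v ∈? edge G e) ((vertices ⟨$⟩ʳ v) ∈? edge H (edges ⟨$⟩ʳ e))
        (Equivalence.to (incident v e)) (Equivalence.from (incident v e)))
    (trans (∑ℕ-permute edges (incidence H (vertices ⟨$⟩ʳ v))) (sym (degree≡∑ H (vertices ⟨$⟩ʳ v)))))

∈-tail : ∀ {A : Set} {x y : A} {xs} → x ∈ˡ y ∷ xs → x ≢ y → x ∈ˡ xs
∈-tail (here eq)  x≢y = contradiction eq x≢y
∈-tail (there x∈) _   = x∈

square-+ : ∀ x y → x * x + y * y ≤ (x + y) * (x + y)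
square-+ x y = subst (x * x + y * y ≤_)
  (solve 2 (λ x y → x :* x :+ y :* y :+ (x :* y :+ x :* y) := (x :+ y) :* (x :+ y)) refl x y)
  (m≤m+n (x * x + y * y) (x * y + x * y))
  where open +-*-Solver

square-+₃ : ∀ x y z → x * x + (y * y + z * z) ≤ (x + (y + z)) * (x + (y + z))
square-+₃ x y z = ≤-trans (+-monoʳ-≤ (x * x) (square-+ y z)) (square-+ x (y + z))

square-∑ : ∀ {A : Set} (xs : List A) f → ∑ℕ xs (λ x → f x * f x) ≤ ∑ℕ xs f * ∑ℕ xs f
square-∑ []       f = z≤n
square-∑ (x ∷ xs) f = ≤-trans (+-monoʳ-≤ (f x * f x) (square-∑ xs f)) (square-+ (f x) (∑ℕ xs f))

-- The right side is the value at (p, 1, 0). Subtract 2 from the first two entries, or 1 from all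
-- three; superadditivity of squares bounds what is left, and the lower terms leave room to spare.
squares-bound : ∀ {p} a b c → b ≤ a → c ≤ b → a + (b + (c + 0)) ≡ suc p → 2 ≤ b ⊎ 1 ≤ c →
  a * a + (b * b + (c * c + 0)) < p * p + 1
squares-bound (suc (suc a)) (suc (suc b)) zero _ _ refl (inj₁ _) = begin-strict
  (2 + a) * (2 + a) + ((2 + b) * (2 + b) + 0)
    ≡⟨ solve 2 (λ a b → (con 2 :+ a) :* (con 2 :+ a) :+ ((con 2 :+ b) :* (con 2 :+ b) :+ con 0)
                     := (a :* a :+ b :* b) :+ (con 4 :* (a :+ b) :+ con 8)) refl a b ⟩
  (a * a + b * b) + (4 * (a + b) + 8)       ≤⟨ +-monoˡ-≤ (4 * (a + b) + 8) (square-+ a b) ⟩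
  (a + b) * (a + b) + (4 * (a + b) + 8)
    <⟨ +-monoʳ-< ((a + b) * (a + b)) (+-mono-≤-< (*-monoˡ-≤ (a + b) (m≤m+n 4 2)) (s≤s (m≤m+n 8 1))) ⟩
  (a + b) * (a + b) + (6 * (a + b) + 10)
    ≡⟨ solve 2 (λ a b → (a :+ b) :* (a :+ b) :+ (con 6 :* (a :+ b) :+ con 10)
                     := (con 1 :+ a :+ (con 2 :+ b :+ con 0)) :* (con 1 :+ a :+ (con 2 :+ b :+ con 0))
                       :+ con 1) refl a b ⟩
  (1 + a + (2 + b + 0)) * (1 + a + (2 + b + 0)) + 1 ∎
  where
  open ≤-Reasoning
  open +-*-Solver
squares-bound (suc a) (suc b) (suc c) _ _ refl _ = begin-strict
  (1 + a) * (1 + a) + ((1 + b) * (1 + b) + ((1 + c) * (1 + c) + 0))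
    ≡⟨ solve 3 (λ a b c →
      (con 1 :+ a) :* (con 1 :+ a) :+
      ((con 1 :+ b) :* (con 1 :+ b) :+ ((con 1 :+ c) :* (con 1 :+ c) :+ con 0))
                     := (a :* a :+ (b :* b :+ c :* c)) :+ (con 2 :* (a :+ (b :+ c)) :+ con 3)) refl a b
                       c ⟩
  (a * a + (b * b + c * c)) + (2 * s + 3)   ≤⟨ +-monoˡ-≤ (2 * s + 3) (square-+₃ a b c) ⟩
  s * s + (2 * s + 3)
    <⟨ +-monoʳ-< (s * s) (+-mono-≤-< (*-monoˡ-≤ s (m≤m+n 2 2)) (s≤s (m≤m+n 3 1))) ⟩
  s * s + (4 * s + 5)
    ≡⟨ solve 3 (λ a b c → (a :+ (b :+ c)) :* (a :+ (b :+ c)) :+ (con 4 :* (a :+ (b :+ c)) :+ con 5)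
         := (a :+ (con 1 :+ b :+ (con 1 :+ c :+ con 0))) :* (a :+ (con 1 :+ b :+ (con 1 :+ c :+ con 0)))
           :+ con 1) refl a b c ⟩
  (a + (1 + b + (1 + c + 0))) * (a + (1 + b + (1 + c + 0))) + 1 ∎
  where
  open ≤-Reasoning
  open +-*-Solver
  s = a + (b + c)
squares-bound (suc zero) (suc (suc b)) c (s≤s ()) _ _ _
squares-bound _ (suc zero) zero _ _ _ (inj₁ (s≤s ()))
squares-bound _ zero zero _ _ _ (inj₁ ())
squares-bound _ zero zero _ _ _ (inj₂ ())
squares-bound _ zero (suc _) _ () _ _
squares-bound zero (suc _) _ () _ _ _

sort₃ : ∀ (n : Fin 3 → ℕ) →
  Σ[ π ∈ Permutation′ 3 ] n (π ⟨$⟩ʳ 1F) ≤ n (π ⟨$⟩ʳ 0F) × n (π ⟨$⟩ʳ 2F) ≤ n (π ⟨$⟩ʳ 1F)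
sort₃ n with ≤-total (n 1F) (n 0F) | ≤-total (n 2F) (n 1F) | ≤-total (n 2F) (n 0F)
... | inj₁ 1≤0 | inj₁ 2≤1 | _        = Permutation.id , 1≤0 , 2≤1
... | inj₁ 1≤0 | inj₂ 1≤2 | inj₁ 2≤0 = transpose 1F 2F , 2≤0 , 1≤2
... | inj₁ 1≤0 | inj₂ 1≤2 | inj₂ 0≤2 = transpose 0F 1F ∘ₚ transpose 1F 2F , 0≤2 , 1≤0
... | inj₂ 0≤1 | _        | inj₁ 2≤0 = transpose 0F 1F , 0≤1 , 2≤0
... | inj₂ 0≤1 | inj₁ 2≤1 | inj₂ 0≤2 = transpose 1F 2F ∘ₚ transpose 0F 1F , 2≤1 , 0≤2
... | inj₂ 0≤1 | inj₂ 1≤2 | inj₂ _   = transpose 0F 2F , 1≤2 , 0≤1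

module Extremal {k p H} (2≤k : 2 ≤ k) (lu : LinearUnicyclic k (4 + p) H) where
  open LinearUnicyclic lu

  private
    connected : Connected H
    connected = proj₁ unicyclic

    C : Cycle H
    C = proj₁ (proj₂ unicyclic)

    covered : ∀ v → ∃[ e ] v ∈ edge H e
    covered = edge-at C connected

    V : List (Vertex H)
    V = allFin (order H)

    excess : Vertex H → ℕ
    excess v = degree H v ∸ 1

    degree≡1+excess : ∀ v → degree H v ≡ 1 + excess v
    degree≡1+excess v = sym (m+[n∸m]≡n (subst (1 ≤_) (sym (degree≡∑ H v))
      (≤-trans (≤-reflexive (sym (𝟙-yes (v ∈? edge H (proj₁ (covered v))) (proj₂ (covered v)))))
        (∑ℕ-∈ (incidence H v) (∈-allFin (proj₁ (covered v)))))))

    ∑1 : ∑ℕ V (λ _ → 1) ≡ order H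
    ∑1 = trans (∑ℕ-const V 1) (trans (*-identityʳ _) (length-allFin (order H)))

    ∑excess : ∑ℕ V excess ≡ 4 + p
    ∑excess = +-cancelˡ-≡ (order H) _ _ (begin
      order H + ∑ℕ V excess            ≡⟨ cong (_+ ∑ℕ V excess) ∑1 ⟨
      ∑ℕ V (λ _ → 1) + ∑ℕ V excess     ≡⟨ Σℕ.⨁-+ V (λ _ → 1) excess ⟨
      ∑ℕ V (λ v → 1 + excess v)        ≡⟨ Σℕ.⨁-cong V degree≡1+excess ⟨
      ∑ℕ V (degree H)                  ≡⟨ handshake H uniform ⟩
      size H * k                       ≡⟨ cong (_* k) size≡m ⟩
      (4 + p) * k                      ≡⟨ unicyclic-order (<⇒≤ 2≤k) lu ⟨
      order H + (4 + p)                ∎)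
      where open ≡-Reasoning

    ∑d²≡ : ∑d² H ≡ order H + (2 * (4 + p) + ∑ℕ V (λ v → excess v * excess v))
    ∑d²≡ = begin
      ∑d² H ≡⟨ Σℕ.⨁-cong V (λ v → trans (cong (λ d → d * d) (degree≡1+excess v))
        (solve 1 (λ x → (con 1 :+ x) :* (con 1 :+ x) := con 1 :+ (con 2 :* x :+ x :* x)) refl
          (excess v))) ⟩
      ∑ℕ V (λ v → 1 + (2 * excess v + excess v * excess v))
        ≡⟨ trans (Σℕ.⨁-+ V (λ _ → 1) _) (cong₂ _+_ ∑1 (trans (Σℕ.⨁-+ V (λ v → 2 * excess v) _)
             (cong (_+ ∑ℕ V (λ v → excess v * excess v))
               (trans (Σℕ.⨁-*ˡ V 2 excess) (cong (2 *_) ∑excess))))) ⟩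
      order H + (2 * (4 + p) + ∑ℕ V (λ v → excess v * excess v)) ∎
      where
      open ≡-Reasoning
      open +-*-Solver

    excess-cycle : (C : Cycle H) → ∀ i → 1 ≤ excess (Cycle.vertex C i)
    excess-cycle C i with next-surjective i
    ... | j , refl = ∸-monoˡ-≤ 1 (subst₂ _≤_
      (cong₂ _+_ (𝟙-yes (v ∈? edge H _) (incidentʳ j)) (𝟙-yes (v ∈? edge H _) (incidentˡ (next j))))
      (sym (degree≡∑ H v))
      (∑ℕ-two (incidence H v) (next-≢ len≥2 j ∘ sym ∘ edge-injective) (∈-allFin _) (∈-allFin _)))
      where
      open Cycle C
      v = vertex (next j)

    -- With m = 4 + p the right side is n + 2m + (m-3)² + 3, two less than the value of
    -- `C₃ k p 1 0`.
    Small : Set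
    Small = ∑d² H ≤ order H + (12 + 4 * p + p * p)

    -- Used for three vertices of the cycle; in the second case H is a triangle
    -- with pendant hyperedges.
    spread : ∀ {u v w} → u ≢ v → u ≢ w → v ≢ w → 1 ≤ excess u → 1 ≤ excess v → 1 ≤ excess w →
      Small ⊎ (∀ x → x ≢ u → x ≢ v → x ≢ w → excess x ≡ 0)
    spread {u} {v} {w} u≢v u≢w v≢w 1≤u 1≤v 1≤w with extract (∈-allFin u)
    ... | r₀ , p₀ with extract (∈-tail (∈-resp-↭ p₀ (∈-allFin v)) (u≢v ∘ sym))
    ...   | r₁ , p₁ with extract (∈-tail (∈-tail (∈-resp-↭ q (∈-allFin w)) (u≢w ∘ sym)) (v≢w ∘ sym))
      where
      q : V ↭ u ∷ v ∷ r₁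
      q = ↭-trans p₀ (↭-prep u p₁)
    ...     | rest , p₂ = conclude (∑ℕ rest excess) refl
      where
      perm : V ↭ u ∷ v ∷ w ∷ rest
      perm = ↭-trans p₀ (↭-prep u (↭-trans p₁ (↭-prep v p₂)))

      elsewhere : ∑ℕ rest excess ≡ 0 → ∀ x → x ≢ u → x ≢ v → x ≢ w → excess x ≡ 0
      elsewhere R≡0 x x≢u x≢v x≢w with ∈-resp-↭ perm (∈-allFin x)
      ... | here x≡u                     = contradiction x≡u x≢u
      ... | there (here x≡v)             = contradiction x≡v x≢v
      ... | there (there (here x≡w))     = contradiction x≡w x≢w
      ... | there (there (there x∈rest)) = n≤0⇒n≡0 (subst (excess x ≤_) R≡0 (∑ℕ-∈ excess x∈rest))

      small : ∀ a b c R → excess u ≡ suc a → excess v ≡ suc b → excess w ≡ suc c →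
        ∑ℕ rest excess ≡ suc R → Small
      small a b c R u≡ v≡ w≡ R≡ = begin
        ∑d² H ≡⟨ ∑d²≡ ⟩
        order H + (2 * (4 + p) + ∑ℕ V (λ x → excess x * excess x))
          ≤⟨ +-monoʳ-≤ (order H) (+-monoʳ-≤ (2 * (4 + p)) bound) ⟩
        order H + (2 * (4 + p) + (4 + (2 * p + p * p)))
          ≡⟨ cong (order H +_)
            (solve 1 (λ p → con 2 :* (con 4 :+ p) :+ (con 4 :+ (con 2 :* p :+ p :* p))
               := con 12 :+ con 4 :* p :+ p :* p) refl p) ⟩
        order H + (12 + 4 * p + p * p) ∎
        where
        open ≤-Reasoning
        open +-*-Solver
        sum≡p : (a + (b + c)) + R ≡ p
        sum≡p = +-cancelˡ-≡ 4 _ _ (trans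
          (solve 4 (λ a b c R → con 4 :+ ((a :+ (b :+ c)) :+ R) :=
            (con 1 :+ a) :+ ((con 1 :+ b) :+ ((con 1 :+ c) :+ (con 1 :+ R)))) refl a b c R)
          (trans (sym (cong₂ _+_ u≡ (cong₂ _+_ v≡ (cong₂ _+_ w≡ R≡))))
            (trans (sym (Σℕ.⨁-↭ excess perm)) ∑excess)))
        -- All vertices of `rest` are merged into one quantity 1 + R. Writing the four quantities as
        -- 1 + y with ∑ y = p gives ∑ (1 + y)² = 4 + 2p + ∑ y², and ∑ y² ≤ p².
        bound : ∑ℕ V (λ x → excess x * excess x) ≤ 4 + (2 * p + p * p)
        bound = begin
          ∑ℕ V (λ x → excess x * excess x)
            ≡⟨ Σℕ.⨁-↭ (λ x → excess x * excess x) perm ⟩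
          excess u * excess u +
            (excess v * excess v + (excess w * excess w + ∑ℕ rest (λ x → excess x * excess x)))
            ≤⟨ +-monoʳ-≤ (excess u * excess u)
              (+-monoʳ-≤ (excess v * excess v) (+-monoʳ-≤ (excess w * excess w) (square-∑ rest excess)))
              ⟩
          excess u * excess u +
            (excess v * excess v + (excess w * excess w + ∑ℕ rest excess * ∑ℕ rest excess))
            ≡⟨ cong₂ _+_ (cong₂ _*_ u≡ u≡)
              (cong₂ _+_ (cong₂ _*_ v≡ v≡) (cong₂ _+_ (cong₂ _*_ w≡ w≡) (cong₂ _*_ R≡ R≡))) ⟩
          suc a * suc a + (suc b * suc b + (suc c * suc c + suc R * suc R))
            ≡⟨ solve 4 (λ a b c R →
              (con 1 :+ a) :* (con 1 :+ a) :+
              ((con 1 :+ b) :* (con 1 :+ b) :+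
              ((con 1 :+ c) :* (con 1 :+ c) :+ (con 1 :+ R) :* (con 1 :+ R)))
                 := con 4 :+ (con 2 :* ((a :+ (b :+ c)) :+ R) :+
                   ((a :* a :+ (b :* b :+ c :* c)) :+ R :* R))) refl a b c R ⟩
          4 + (2 * ((a + (b + c)) + R) + ((a * a + (b * b + c * c)) + R * R))
            ≤⟨ +-monoʳ-≤ 4 (+-monoʳ-≤ (2 * ((a + (b + c)) + R))
              (≤-trans (+-monoˡ-≤ (R * R) (square-+₃ a b c)) (square-+ (a + (b + c)) R))) ⟩
          4 + (2 * ((a + (b + c)) + R) + ((a + (b + c)) + R) * ((a + (b + c)) + R))
            ≡⟨ cong (λ q → 4 + (2 * q + q * q)) sum≡p ⟩
          4 + (2 * p + p * p) ∎

      conclude : ∀ R → ∑ℕ rest excess ≡ R → Small ⊎ (∀ x → x ≢ u → x ≢ v → x ≢ w → excess x ≡ 0)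
      conclude zero    R≡0 = inj₂ (elsewhere R≡0)
      conclude (suc R) R≡  = inj₁ (small (excess u ∸ 1) (excess v ∸ 1) (excess w ∸ 1) R
        (sym (m+[n∸m]≡n 1≤u)) (sym (m+[n∸m]≡n 1≤v)) (sym (m+[n∸m]≡n 1≤w)) R≡)

    from-cycle : (C : Cycle H) → ∀ l → Cycle.len C ≡ l → Small ⊎ (∃[ n ] Triangle H n)
    from-cycle C zero refl with () ← Cycle.len≥2 C
    from-cycle C (suc zero) refl with s≤s () ← Cycle.len≥2 C
    -- In a cycle of length 2 both hyperedges contain both vertices, against linearity.
    from-cycle C (suc (suc zero)) refl = contradiction
      (edge-injective {0F} {1F}
        (linear-unique {H} linear (λ eq → contradiction (vertex-injective {0F} {1F} eq) λ ())
        (incidentˡ 0F) (incidentʳ 0F) (incidentʳ 1F) (incidentˡ 1F))) λ ()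
      where open Cycle C
    from-cycle C (suc (suc (suc l))) refl
      with spread (λ eq → contradiction (vertex-injective {0F} {1F} eq) λ ())
                  (λ eq → contradiction (vertex-injective {0F} {2F} eq) λ ())
                  (λ eq → contradiction (vertex-injective {1F} {2F} eq) λ ())
                  (excess-cycle C 0F) (excess-cycle C 1F) (excess-cycle C 2F)
      where open Cycle C
    ... | inj₁ small = inj₁ small
    -- A fourth vertex of the cycle has positive excess, although excess vanishes outside the first
    -- three.
    from-cycle C (suc (suc (suc (suc l)))) refl | inj₂ elsewhere = contradiction
      (elsewhere (vertex 3F) (λ eq → contradiction (vertex-injective {3F} {0F} eq) λ ())
                           (λ eq → contradiction (vertex-injective {3F} {1F} eq) λ ())
                           (λ eq → contradiction (vertex-injective {3F} {2F} eq) λ ()))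
      (m<n⇒n≢0 (excess-cycle C 3F))
      where
      open Cycle C
      3F : Fin (4 + l)
      3F = suc (suc (suc zero))
    from-cycle C (suc (suc (suc zero))) refl | inj₂ elsewhere =
      inj₂ (_ , FromCorners.triangle linear connected
      (edge-member {H = H} (<⇒≤ 2≤k) uniform) covered
      -- Hyperedge i joins vertices i and i + 1, so the side opposite vertex i is hyperedge i + 1.
      vertex vertex-injective (hyperedge ∘ next) (λ {i} {j} eq → next-injective i j (edge-injective eq))
        (λ {j} {i} → ∈side j i) simple)
      where
      open Cycle C
      next-injective : ∀ (i j : Fin 3) → next i ≡ next j → i ≡ j
      next-injective = from-yes
        (all? λ (i : Fin 3) → all? λ (j : Fin 3) → (next i ≟ next j) →-dec (i ≟ j))
      successor : ∀ (j i : Fin 3) → j ≢ i → j ≡ next i ⊎ j ≡ next (next i)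
      successor = from-yes
        (all? λ (j : Fin 3) → all? λ (i : Fin 3) →
        ¬? (j ≟ i) →-dec ((j ≟ next i) ⊎-dec (j ≟ next (next i))))
      ∈side : ∀ j i → j ≢ i → vertex j ∈ edge H (hyperedge (next i))
      ∈side j i j≢i with successor j i j≢i
      ... | inj₁ refl = incidentˡ (next i)
      ... | inj₂ refl = incidentʳ (next i)
      simple : ∀ v → (∀ i → v ≢ vertex i) → degree H v ≤ 1
      simple v v≢ = subst (_≤ 1)
        (sym (trans (degree≡1+excess v) (cong suc (elsewhere v (v≢ 0F) (v≢ 1F) (v≢ 2F))))) ≤-refl

  small-or-triangle : Small ⊎ (∃[ n ] Triangle H n)
  small-or-triangle = from-cycle C (Cycle.len C) refl

-- Classification and the last two hypergraphs

small-pair : ∀ {b c} → ¬ (2 ≤ b ⊎ 1 ≤ c) → (b ≡ 0 ⊎ b ≡ 1) × c ≡ 0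
small-pair {zero}        {zero}  _ = inj₁ refl , refl
small-pair {suc zero}    {zero}  _ = inj₂ refl , refl
small-pair {suc (suc b)} {zero}  ¬big = contradiction (inj₁ (s≤s (s≤s z≤n))) ¬big
small-pair {b}           {suc c} ¬big = contradiction (inj₂ (s≤s z≤n)) ¬big

precedes-∑d² : ∀ {c ℓ₁ ℓ₂ k m G H} → 2 ≤ k → (F : OrderedField c ℓ₁ ℓ₂) {α : OrderedField.Carrier F} →
  OrderedField._<_ F (OrderedField.0# F) α → LinearUnicyclic k m G → LinearUnicyclic k m H →
  order G ≡ order H → 3 ≤ order G → ∑d² G < ∑d² H → Precedes F k α G H
precedes-∑d² {k = suc (suc K)} _ F 0<α luG luH order≡ 3≤n d²< =
  Order.precedes F K 0<α (uniform luG) (linear luG) (uniform luH) (linear luH) order≡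
    (trans (size≡m luG) (sym (size≡m luH))) 3≤n d²<
  where open LinearUnicyclic
precedes-∑d² {k = suc zero} (s≤s ())

module _ {k p : ℕ} (2≤k : 2 ≤ k) where

  private
    last second : Hypergraph
    last   = C₃ k (suc p) 0 0
    second = C₃ k p 1 0

    Δ-last : Triangle last ⟨ suc p , 0 , 0 ⟩
    Δ-last = C₃-triangle k (suc p) 0 0

    Δ-second : Triangle second ⟨ p , 1 , 0 ⟩
    Δ-second = C₃-triangle k p 1 0

  triangle-linearUnicyclic : ∀ {H n m} → Uniform k H → Triangle H n → 3 + total n ≡ m →
    LinearUnicyclic k m H
  triangle-linearUnicyclic uniform Δ size = record
    { uniform = uniform ; linear = Triangle.linear Δ ; unicyclic = Triangle.unicyclic Δ
    ; size≡m = trans (triangle-size Δ) size }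

  last-linearUnicyclic : LinearUnicyclic k (4 + p) last
  last-linearUnicyclic =
    triangle-linearUnicyclic (C₃-uniform k 2≤k (suc p) 0 0) Δ-last (cong (4 +_) (+-identityʳ p))

  second-linearUnicyclic : LinearUnicyclic k (4 + p) second
  second-linearUnicyclic =
    triangle-linearUnicyclic (C₃-uniform k 2≤k p 1 0) Δ-second (cong (3 +_) (+-comm p 1))

  same-order : ∀ {G H m} → LinearUnicyclic k m G → LinearUnicyclic k m H → order G ≡ order H
  same-order {m = m} luG luH = +-cancelʳ-≡ m _ _
    (trans (unicyclic-order (<⇒≤ 2≤k) luG) (sym (unicyclic-order (<⇒≤ 2≤k) luH)))

  -- From n + m = mk with k ≥ 2. It supplies the bound 3 ≤ n that makes d = 2 an admissible index.
  order≥size : ∀ {H m} → LinearUnicyclic k m H → m ≤ order H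
  order≥size {H} {m} lu = +-cancelʳ-≤ m m (order H) (begin
    m + m         ≡⟨ cong (m +_) (*-identityʳ m) ⟨
    m + m * 1     ≡⟨ *-suc m 1 ⟨
    m * 2         ≤⟨ *-monoʳ-≤ m 2≤k ⟩
    m * k         ≡⟨ unicyclic-order (<⇒≤ 2≤k) lu ⟨
    order H + m   ∎)
    where open ≤-Reasoning

  ∑d²-second : ∑d² second ≡ order second + (14 + 4 * p + p * p)
  ∑d²-second = trans (triangle-∑d² Δ-second) (cong (order second +_)
    (solve 1 (λ p → con 9 :+ con 4 :* (p :+ con 1) :+ (p :* p :+ con 1) :=
      con 14 :+ con 4 :* p :+ p :* p) refl p))
    where open +-*-Solver

  -- Relabelling the corners sorts the pendant numbers as a ≥ b ≥ c. If neither b ≥ 2 nor c ≥ 1,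
  -- then (b, c) is (0, 0) or (1, 0), and the number of hyperedges fixes a.
  classify : ∀ {H} → LinearUnicyclic k (4 + p) H → H ≅ last ⊎ H ≅ second ⊎ ∑d² H < ∑d² second
  classify {H} lu with Extremal.small-or-triangle 2≤k lu
  ... | inj₁ small = inj₂ (inj₂ (begin-strict
    ∑d² H                                   ≤⟨ small ⟩
    order H + (12 + 4 * p + p * p)
      <⟨ +-monoʳ-< (order H) (+-monoˡ-< (p * p) (+-monoˡ-< (4 * p) (m≤m+n 13 1))) ⟩
    order H + (14 + 4 * p + p * p)
      ≡⟨ cong (_+ (14 + 4 * p + p * p)) (same-order lu second-linearUnicyclic) ⟩
    order second + (14 + 4 * p + p * p)     ≡⟨ ∑d²-second ⟨
    ∑d² second                              ∎))
    where open ≤-Reasoning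
  ... | inj₂ (n , Δ) with sort₃ n
  ...   | π , b≤a , c≤b = by-shape (n (π ⟨$⟩ʳ 0F)) (n (π ⟨$⟩ʳ 1F)) (n (π ⟨$⟩ʳ 2F)) b≤a c≤b
    (retally (λ { 0F → refl ; 1F → refl ; 2F → refl }) (relabel Δ π))
    where
    by-shape : ∀ a b c → b ≤ a → c ≤ b → Triangle H ⟨ a , b , c ⟩ →
      H ≅ last ⊎ H ≅ second ⊎ ∑d² H < ∑d² second
    by-shape a b c b≤a c≤b Δ with (2 ≤? b) ⊎-dec (1 ≤? c)
    ... | yes big = inj₂ (inj₂ (begin-strict
      ∑d² H                                                   ≡⟨ triangle-∑d² Δ ⟩
      order H + (9 + 4 * (a + (b + (c + 0))) + (a * a + (b * b + (c * c + 0))))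
        ≡⟨ cong₂ (λ x y → x + (9 + 4 * y + (a * a + (b * b + (c * c + 0)))))
          (same-order lu second-linearUnicyclic) sum ⟩
      order second + (9 + 4 * suc p + (a * a + (b * b + (c * c + 0))))
        <⟨ +-monoʳ-< (order second) (+-monoʳ-< (9 + 4 * suc p) (squares-bound a b c b≤a c≤b sum big)) ⟩
      order second + (9 + 4 * suc p + (p * p + 1))
        ≡⟨ cong (λ x → order second + (9 + 4 * x + (p * p + 1))) (+-comm 1 p) ⟩
      order second + (9 + 4 * (p + 1) + (p * p + 1))          ≡⟨ triangle-∑d² Δ-second ⟨
      ∑d² second                                              ∎))
      where
      open ≤-Reasoning
      sum : a + (b + (c + 0)) ≡ suc p
      sum = +-cancelˡ-≡ 3 _ _ (trans (sym (triangle-size Δ)) (LinearUnicyclic.size≡m lu))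
    ... | no ¬big with small-pair ¬big
    ...   | inj₁ refl , refl =
      inj₁ (triangle-≅ (retally (λ { 0F → sum ; 1F → refl ; 2F → refl }) Δ) Δ-last
      (LinearUnicyclic.uniform lu) (C₃-uniform k 2≤k (suc p) 0 0))
      where
      sum : a ≡ suc p
      sum = trans (sym (+-identityʳ a))
        (+-cancelˡ-≡ 3 _ _ (trans (sym (triangle-size Δ)) (LinearUnicyclic.size≡m lu)))
    ...   | inj₂ refl , refl =
      inj₂ (inj₁ (triangle-≅ (retally (λ { 0F → sum ; 1F → refl ; 2F → refl }) Δ) Δ-second
      (LinearUnicyclic.uniform lu) (C₃-uniform k 2≤k p 1 0)))
      where
      sum : a ≡ p
      sum = suc-injective
        (trans (+-comm 1 a)
        (+-cancelˡ-≡ 3 _ _ (trans (sym (triangle-size Δ)) (LinearUnicyclic.size≡m lu))))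

  -- The two values differ by 2p, so p has to be positive; for p = 0 the two hypergraphs are
  -- isomorphic.
  second<last : 1 ≤ p → ∑d² second < ∑d² last
  second<last 1≤p = begin-strict
    ∑d² second                                              ≡⟨ ∑d²-second ⟩
    order second + (14 + 4 * p + p * p)
      <⟨ +-monoʳ-< (order second)
        (+-monoˡ-< (p * p) (+-monoʳ-< 14 (*-monoˡ-< p {{>-nonZero 1≤p}} (m≤m+n 5 1)))) ⟩
    order second + (14 + 6 * p + p * p)
      ≡⟨ cong₂ _+_ (same-order second-linearUnicyclic last-linearUnicyclic)
           (solve 1 (λ p → con 14 :+ con 6 :* p :+ p :* p
             := con 9 :+ con 4 :* (con 1 :+ p :+ con 0) :+ ((con 1 :+ p) :* (con 1 :+ p) :+ con 0)) refl
               p) ⟩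
    order last + (9 + 4 * (suc p + 0) + (suc p * suc p + 0)) ≡⟨ triangle-∑d² Δ-last ⟨
    ∑d² last                                                ∎
    where
    open ≤-Reasoning
    open +-*-Solver

  second-last : ∀ {c ℓ₁ ℓ₂} (F : OrderedField c ℓ₁ ℓ₂) (α : OrderedField.Carrier F) →
    OrderedField._<_ F (OrderedField.0# F) α → 1 ≤ p →
    IsSecondLast (Precedes F k α) (LinearUnicyclic k (4 + p)) second
  second-last F α 0<α 1≤p = last
    , (last-linearUnicyclic , λ H lu H≇last →
      before lu last-linearUnicyclic (below-last lu H≇last (classify lu)))
    , ((second-linearUnicyclic , λ iso → <-irrefl (≅⇒∑d²≡ iso) (second<last 1≤p))
    , λ H (lu , H≇last) H≇second →
      before lu second-linearUnicyclic (below-second H≇last H≇second (classify lu)))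
    where
    before : ∀ {G H} → LinearUnicyclic k (4 + p) G → LinearUnicyclic k (4 + p) H → ∑d² G < ∑d² H →
      Precedes F k α G H
    before luG luH = precedes-∑d² 2≤k F 0<α luG luH (same-order luG luH)
      (≤-trans (m≤m+n 3 (1 + p)) (order≥size luG))
    below-last : ∀ {H} → LinearUnicyclic k (4 + p) H → ¬ (H ≅ last) →
      H ≅ last ⊎ H ≅ second ⊎ ∑d² H < ∑d² second → ∑d² H < ∑d² last
    below-last lu H≇last (inj₁ iso)         = contradiction iso H≇last
    below-last lu H≇last (inj₂ (inj₁ iso))  = ≤-<-trans (≤-reflexive (≅⇒∑d²≡ iso)) (second<last 1≤p)
    below-last lu H≇last (inj₂ (inj₂ smaller)) = <-trans smaller (second<last 1≤p)
    below-second : ∀ {H} → ¬ (H ≅ last) → ¬ (H ≅ second) →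
      H ≅ last ⊎ H ≅ second ⊎ ∑d² H < ∑d² second → ∑d² H < ∑d² second
    below-second H≇last H≇second (inj₁ iso)         = contradiction iso H≇last
    below-second H≇last H≇second (inj₂ (inj₁ iso))  = contradiction iso H≇second
    below-second H≇last H≇second (inj₂ (inj₂ smaller)) = smaller

-- For m = 4 the named hypergraph is isomorphic to the last one, and for m = 3 truncated subtraction
-- gives it four hyperedges, so it can be second last only from m = 5 on.
theorem5p3 :
    (c ℓ₁ ℓ₂ : Level) (F : OrderedField c ℓ₁ ℓ₂) (α : OrderedField.Carrier F) →
    OrderedField._<_ F (OrderedField.0# F) α →
    OrderedField._<_ F α (OrderedField.1# F) →
    (k m : ℕ) → 2 ≤ k → 5 ≤ m →
    IsSecondLast (Precedes F k α) (LinearUnicyclic k m) (C₃ k (m ∸ 4) 1 0)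
theorem5p3 c ℓ₁ ℓ₂ F α 0<α _ k _ 2≤k (s≤s (s≤s (s≤s (s≤s (s≤s {n = p} _))))) =
  second-last {k} {suc p} 2≤k F α 0<α (s≤s z≤n)
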